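{- Let $\alpha$ be a set with an involution $\tau$. The formula $w\mapsto p(w)$, assigning to a nanoword $w$ over $\alpha$ its $\alpha$-pairing $p(w)=(\mathcal A\cup\{s\},s,e_w)$ with values in $\pi=\pi(\alpha,\tau)$, defines a group homomorphism $p:\mathcal N_c(\alpha,\tau)\to\mathcal P_{sk}(\alpha,\tau,\pi)$ from the group of cobordism classes of nanowords over $\alpha$ to the group of cobordism classes of skew-symmetric $\alpha$-pairings. (In particular, cobordant nanowords have cobordant $\alpha$-pairings.)
   Context: **Nanowords.** $\alpha$ is a set with an involution $\tau:\alpha\to\alpha$ ($\tau^2=\mathrm{id}$; fixed points allowed). An $\alpha$-alphabet is a set $\mathcal A$ with a map $\mathcal A\to\alpha$, $A\mapsto|A|$. A nanoword of length $n$ over $\alpha$ is a pair $(\mathcal A,w)$ with $\mathcal A$ an $\alpha$-alphabet and $w:\{1,\dots,n\}\to\mathcal A$ a map (written as the sequence $w(1)\cdots w(n)$) taking every value in $\mathcal A$ exactly twice; there is a unique empty nanoword $\emptyset$. Nanowords $(\mathcal A,w),(\mathcal A',w')$ are isomorphic if $w'=fw$ for a bijection $f:\mathcal A\to\mathcal A'$ with $|f(A)|=|A|$. The opposite word of $w$ is $w^-=w(n)\cdots w(1)$. The product of two nanowords is their concatenation, after making the alphabets disjoint by an isomorphism. **Homotopy moves.** (1) $(\mathcal A,xAAy)\mapsto(\mathcal A-\{A\},xy)$; (2) $(\mathcal A,xAByBAz)\mapsto(\mathcal A-\{A,B\},xyz)$ if $|B|=\tau(|A|)$; (3) $(\mathcal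 A,xAByACzBCt)\mapsto(\mathcal A,xBAyCAzCBt)$ for distinct $A,B,C$ with $|A|=|B|=|C|$. **Surgery.** A nanophrase $\nabla=(\mathcal B,(v_1|\cdots|v_k))$ is a sequence of words in an $\alpha$-alphabet $\mathcal B$ such that every letter of $\mathcal B$ appears exactly twice in $v_1v_2\cdots v_k$. Put $\varepsilon_\nabla(B)=0$ if both occurrences of $B$ are in the same $v_r$, and $\varepsilon_\nabla(B)=1$ otherwise. $\nabla$ is even if all $v_r$ have even length; it is symmetric if there is a bijection $\iota:\mathcal B\to\mathcal B$ with $\iota v_r=v_r^-$ for all $r$ and $|\iota(B)|=\tau^{\varepsilon_\nabla(B)}(|B|)$ for all $B$. $\nabla$ is a factor of a nanoword $(\mathcal A,w)$ if $\mathcal B\subset\mathcal A$ (with restricted projection to $\alpha$) and $w=x_1v_1x_2v_2\cdots x_kv_kx_{k+1}$ with $x_i$ words in $\mathcal A-\mathcal B$. A surgery replaces $(\mathcal A,w)$ by $(\mathcal A-\mathcal B,x_1x_2\cdots x_{k+1})$, where $\nabla$ is an even symmetric factor. **Cobordism of nanowords.** Two nanowords are cobordant if they are related by a finite sequence of isomorphisms, homotopy moves, surgeries and inverse moves. The cobordism classes form a group $\mathcal N_c=\mathcal N_c(\alpha,\tau)$ under concatenation, with unit the class of $\emptyset$ and inverse of $w$ given by $w^-$. **$\alpha$-pairings.** $\pi=\pi(\alpha,\tau)$ is the (additive) abelian group with generators $a\in\alpha$ and relations $a+\tau(a)=0$, $a\in\alpha$. An $\alpha$-pairing is a triple $p=(S,s,e)$: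 a finite set $S$, an element $s\in S$, a map $S^\circ=S-\{s\}\to\alpha$, $A\mapsto|A|$, and a map $e:S\times S\to\pi$, extended to a bilinear form $\tilde e:\mathbb ZS\times\mathbb ZS\to\pi$ on the free abelian group $\mathbb ZS$. It is skew-symmetric if $e(A,A)=0$ and $e(A,B)=-e(B,A)$ for all $A,B\in S$. The opposite is $p^-=(S,s,-e)$. The sum $p_1\oplus p_2$ of $p_i=(S_i,s_i,e_i)$ is $(S_1^\circ\sqcup S_2^\circ\sqcup\{s\},s,e)$ with inherited projections, $e=e_i$ on $S_i^\circ\times S_i^\circ$, $e(S_1^\circ,S_2^\circ)=e(S_2^\circ,S_1^\circ)=0$, $e(A,s)=e_i(A,s_i)$, $e(s,A)=e_i(s_i,A)$ for $A\in S_i^\circ$, and $e(s,s)=e_1(s_1,s_1)+e_2(s_2,s_2)$. A vector $x\in\mathbb ZS$ is short if $x=A\in S^\circ$, or $x=A+B$ with $A\ne B\in S^\circ$, $|A|=|B|$, or $x=A-B$ with $A\neq B\in S^\circ$, $|A|=\tau(|B|)$. A filling of $p$ is a finite family $\{\lambda_i\}$ in $\mathbb ZS$ such that one $\lambda_i$ equals $s$, all others are short, and every element of $S^\circ$ occurs with non-zero coefficient in exactly one $\lambda_i$. It is annihilating if $\tilde e(\lambda_i,\lambda_j)=0$ for all $i,j$. $p$ is hyperbolic if it has an annihilating filling. $p_1,p_2$ are cobordant if $p_1\oplus p_2^-$ is hyperbolic; this is an equivalence relation, and the cobordism classes of $\alpha$-pairings form an abelian group $\mathcal P=\mathcal P(\alpha,\tau,\pi)$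 under $\oplus$. The classes of skew-symmetric $\alpha$-pairings form a subgroup $\mathcal P_{sk}=\mathcal P_{sk}(\alpha,\tau,\pi)$. **The $\alpha$-pairing $p(w)$ of a nanoword $(\mathcal A,w)$.** $p(w)=(S=\mathcal A\cup\{s\},s,e_w)$ with $S^\circ=\mathcal A\to\alpha$ the given projection. For $A,B\in\mathcal A$ let $n_w(A,B)=1$ if $w=\cdots A\cdots B\cdots A\cdots B\cdots$, $n_w(A,B)=-1$ if $w=\cdots B\cdots A\cdots B\cdots A\cdots$, and $0$ otherwise. Let $i_A<j_A$ be the two elements of $w^{ -1}(A)$, and $A\circ_wB=\sum|D|\in\pi$, the sum over $D\in\mathcal A$ with $i_A<i_D<j_A$ and $i_B<j_D<j_B$. Then $e_w(A,B)=2(A\circ_wB-B\circ_wA)+n_w(A,B)(|A|+|B|)$, $e_w(A,s)=-e_w(s,A)=\sum_{D\in\mathcal A}n_w(A,D)|D|$, $e_w(s,s)=0$. This is skew-symmetric. -}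

module Defs where

open import Algebra.Bundles using (AbelianGroup)
open import Algebra.Bundles.Raw using (RawGroup)
import Algebra.Definitions.RawMonoid as RawMonoidDefinitions
import Algebra.Properties.AbelianGroup as AbelianGroupProperties
import Algebra.Properties.CommutativeMonoid.Mult as Mult
import Algebra.Properties.CommutativeMonoid.Sum as Sum
open import Data.Bool.Base using (true; false; if_then_else_)
open import Data.Empty using (⊥; ⊥-elim)
open import Data.Fin.Base using (Fin)
open import Data.Fin.Properties using (+↔⊎; inj⇒≟)
open import Data.Integer.Base as ℤ using (ℤ; +_; -[1+_]; 0ℤ; 1ℤ; -1ℤ)
open import Data.List.Base using (List; []; _∷_; _++_; map; filter; length; reverse)
open import Data.List.Properties using (filter-++; length-++; filter-accept; filter-reject)
open import Data.List.Relation.Binary.Permutation.Propositional.Properties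
  using (↭-reverse; filter-↭; ↭-length)
open import Data.Maybe.Base using (Maybe; just; nothing)
import Data.Maybe.Properties as Maybe
open import Data.Nat.Base as ℕ using (ℕ; zero; suc; _<_)
open import Data.Nat.Divisibility using (_∣_)
import Data.Nat.Properties as ℕ
open import Data.Product using (∃!)
open import Data.Product.Base using (Σ; Σ-syntax; ∃; ∃-syntax; _×_; _,_; proj₁; proj₂)
open import Data.Sum.Base using (_⊎_; inj₁; inj₂; [_,_]′)
open import Data.Sum.Function.Propositional using (_⊎-↔_)
open import Data.Sum.Properties using (inj₁-injective; inj₂-injective)
open import Data.Vec.Base as Vec using (Vec; []; _∷_)
open import Data.Vec.Relation.Unary.All using (All)
open import Data.Vec.Relation.Unary.Any using (any?)
open import Function.Base using (_∘_)
open import Function.Bundles using (_↔_; _⇔_; Inverse)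
open import Function.Construct.Composition using (_↔-∘_)
open import Function.Construct.Symmetry using (↔-sym)
open import Function.Definitions using (Injective)
import Function.Endo.Propositional as Endo
open import Function.Properties.Inverse using (↔⇒↣)
open import Level using (_⊔_) renaming (zero to 0ℓ; suc to sucℓ)
open import Relation.Binary.Construct.Closure.Equivalence using (EqClosure)
open import Relation.Binary.Definitions using (DecidableEquality)
open import Relation.Binary.PropositionalEquality
  using (_≡_; _≢_; _≗_; refl; sym; trans; cong; cong₂)
open import Relation.Nullary.Decidable using (Dec; yes; no; does; _×-dec_)
open import Relation.Nullary.Negation using (¬_)

------------------------------------------------------------------------
-- Finite sets and words

record FiniteSet : Set₁ where
  field
    Elem        : Set
    size        : ℕ
    enumeration : Elem ↔ Fin size

  infix 4 _≟_
  _≟_ : DecidableEquality Elem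
  _≟_ = inj⇒≟ (↔⇒↣ enumeration)

  occurrences : Elem → List Elem → ℕ
  occurrences A w = length (filter (A ≟_) w)

  -- The positions i_A < j_A of the two occurrences of A in w, counted from 0.
  -- They are only used for letters that occur exactly twice.
  firstPos : Elem → List Elem → ℕ
  firstPos A []      = 0
  firstPos A (B ∷ w) = if does (A ≟ B) then 0 else suc (firstPos A w)

  secondPos : Elem → List Elem → ℕ
  secondPos A []      = 0
  secondPos A (B ∷ w) = suc (if does (A ≟ B) then firstPos A w else secondPos A w)

private
  ⊥↔Fin0 : ⊥ ↔ Fin 0
  ⊥↔Fin0 = record
    { to        = λ ()
    ; from      = λ ()
    ; to-cong   = λ { refl → refl }
    ; from-cong = λ { refl → refl }
    ; inverse   = (λ { {()} }) , (λ { {()} })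
    }

∅ᶠ : FiniteSet
∅ᶠ = record { Elem = ⊥ ; size = 0 ; enumeration = ⊥↔Fin0 }

_⊎ᶠ_ : FiniteSet → FiniteSet → FiniteSet
X ⊎ᶠ Y = record
  { Elem        = X.Elem ⊎ Y.Elem
  ; size        = X.size ℕ.+ Y.size
  ; enumeration = ↔-sym +↔⊎ ↔-∘ (X.enumeration ⊎-↔ Y.enumeration)
  }
  where
  module X = FiniteSet X
  module Y = FiniteSet Y

module _ (X Y : FiniteSet) where
  private
    module X = FiniteSet X
    module Y = FiniteSet Y

  occurrences-map : (f : X.Elem → Y.Elem) → Injective _≡_ _≡_ f →
                    ∀ A w → Y.occurrences (f A) (map f w) ≡ X.occurrences A w
  occurrences-map f inj A [] = refl
  occurrences-map f inj A (B ∷ w) = step (A X.≟ B)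
    where
    step : Dec (A ≡ B) →
           Y.occurrences (f A) (map f (B ∷ w)) ≡ X.occurrences A (B ∷ w)
    step (yes A≡B) = trans (cong length (filter-accept (f A Y.≟_) (cong f A≡B)))
      (trans (cong suc (occurrences-map f inj A w))
             (sym (cong length (filter-accept (A X.≟_) A≡B))))
    step (no  A≢B) = trans (cong length (filter-reject (f A Y.≟_) (A≢B ∘ inj)))
      (trans (occurrences-map f inj A w)
             (sym (cong length (filter-reject (A X.≟_) A≢B))))

  occurrences-map-∉ : (f : X.Elem → Y.Elem) {C : Y.Elem} → (∀ B → C ≢ f B) →
                      ∀ w → Y.occurrences C (map f w) ≡ 0
  occurrences-map-∉ f     C∉ []      = refl
  occurrences-map-∉ f {C} C∉ (B ∷ w) =
    trans (cong length (filter-reject (C Y.≟_) (C∉ B))) (occurrences-map-∉ f C∉ w)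

module _ (X : FiniteSet) where
  open FiniteSet X

  occurrences-++ : ∀ A v w →
                   occurrences A (v ++ w) ≡ occurrences A v ℕ.+ occurrences A w
  occurrences-++ A v w =
    trans (cong length (filter-++ (A ≟_) v w)) (length-++ (filter (A ≟_) v))

  occurrences-reverse : ∀ A w → occurrences A (reverse w) ≡ occurrences A w
  occurrences-reverse A w = ↭-length (filter-↭ (A ≟_) (↭-reverse w))

------------------------------------------------------------------------
-- Nanowords

-- Only finite alphabets are considered: the alphabet of a nanoword or of a
-- nanophrase is finite, because each of its letters occurs in a finite word.
record Alphabet {a} (α : Set a) : Set (sucℓ 0ℓ ⊔ a) where
  field
    letters : FiniteSet
  open FiniteSet letters public renaming (Elem to Letter)
  field
    ∣_∣ : Letter → α

sign : ∀ {P Q : Set} → Dec P → Dec Q → ℤ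
sign p? q? = if does p? then 1ℤ else if does q? then -1ℤ else 0ℤ

record Nanoword {a} (α : Set a) : Set (sucℓ 0ℓ ⊔ a) where
  field
    alphabet : Alphabet α
  open Alphabet alphabet public
  field
    word  : List Letter
    twice : ∀ A → occurrences A word ≡ 2

  i j : Letter → ℕ
  i A = firstPos A word
  j A = secondPos A word

  -- w = ⋯A⋯B⋯A⋯B⋯
  Pattern : Letter → Letter → Set
  Pattern A B = i A < i B × i B < j A × j A < j B

  pattern? : ∀ A B → Dec (Pattern A B)
  pattern? A B = i A ℕ.<? i B ×-dec i B ℕ.<? j A ×-dec j A ℕ.<? j B

  n : Letter → Letter → ℤ
  n A B = sign (pattern? A B) (pattern? B A)

  Between : Letter → Letter → Letter → Set
  Between A B D = (i A < i D × i D < j A) × (i B < j D × j D < j B)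

  between? : ∀ A B D → Dec (Between A B D)
  between? A B D =
    (i A ℕ.<? i D ×-dec i D ℕ.<? j A) ×-dec (i B ℕ.<? j D ×-dec j D ℕ.<? j B)

module _ {a} {α : Set a} where

  ∅ᵃ : Alphabet α
  ∅ᵃ = record { letters = ∅ᶠ ; ∣_∣ = λ () }

  _⊎ᵃ_ : Alphabet α → Alphabet α → Alphabet α
  𝒜 ⊎ᵃ ℬ = record { letters = letters 𝒜 ⊎ᶠ letters ℬ ; ∣_∣ = [ ∣_∣ 𝒜 , ∣_∣ ℬ ]′ }
    where open Alphabet

  ∅ʷ : Nanoword α
  ∅ʷ = record { alphabet = ∅ᵃ ; word = [] ; twice = λ () }

  infixl 7 _·ʷ_
  _·ʷ_ : Nanoword α → Nanoword α → Nanoword α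
  v ·ʷ w = record
    { alphabet = v.alphabet ⊎ᵃ w.alphabet
    ; word     = map inj₁ v.word ++ map inj₂ w.word
    ; twice    = λ A → trans (occurrences-++ V⊎W A (map inj₁ v.word) (map inj₂ w.word))
                             (twice′ A)
    }
    where
    module v = Nanoword v
    module w = Nanoword w
    V⊎W = v.letters ⊎ᶠ w.letters
    occ = FiniteSet.occurrences V⊎W
    twice′ : ∀ A → occ A (map inj₁ v.word) ℕ.+ occ A (map inj₂ w.word) ≡ 2
    twice′ (inj₁ A) = cong₂ ℕ._+_
      (trans (occurrences-map v.letters V⊎W inj₁ inj₁-injective A v.word) (v.twice A))
      (occurrences-map-∉ w.letters V⊎W inj₂ (λ _ ()) w.word)
    twice′ (inj₂ A) = cong₂ ℕ._+_
      (occurrences-map-∉ v.letters V⊎W inj₁ (λ _ ()) v.word)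
      (trans (occurrences-map w.letters V⊎W inj₂ inj₂-injective A w.word) (w.twice A))

  infix 8 _⁻ʷ
  _⁻ʷ : Nanoword α → Nanoword α
  w ⁻ʷ = record
    { alphabet = alphabet
    ; word     = reverse word
    ; twice    = λ A → trans (occurrences-reverse letters A word) (twice A)
    }
    where open Nanoword w

  -- An identification of ℬ, with its projection to α, with a subset of 𝒜.
  record _↪_ (ℬ 𝒜 : Alphabet α) : Set a where
    private
      module 𝒜 = Alphabet 𝒜
      module ℬ = Alphabet ℬ
    field
      ⟦_⟧       : ℬ.Letter → 𝒜.Letter
      injective : Injective _≡_ _≡_ ⟦_⟧
      preserves : ∀ B → 𝒜.∣ ⟦ B ⟧ ∣ ≡ ℬ.∣ B ∣

    ⟦_⟧* : List ℬ.Letter → List 𝒜.Letter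
    ⟦_⟧* = map ⟦_⟧

    _∈image : 𝒜.Letter → Set
    A ∈image = ∃[ B ] ⟦ B ⟧ ≡ A

    -- ℬ is identified with 𝒜 - P.
    ComplementOf : (𝒜.Letter → Set) → Set
    ComplementOf P = ∀ A → (A ∈image) ⇔ (¬ P A)

------------------------------------------------------------------------
-- Nanophrases

record Nanophrase {a} (α : Set a) : Set (sucℓ 0ℓ ⊔ a) where
  field
    alphabet : Alphabet α
  open Alphabet alphabet public
  field
    k      : ℕ
    phrase : Vec (List Letter) k
    twice  : ∀ B → occurrences B (Vec.foldr′ _++_ [] phrase) ≡ 2

  -- All letters occur exactly twice, so a word contains both occurrences of B
  -- when it contains two.
  ε : Letter → ℕ
  ε B = if does (any? (λ v → occurrences B v ℕ.≟ 2) phrase) then 0 else 1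

  Even : Set
  Even = All (λ v → 2 ∣ length v) phrase

  Symmetric : (τ : α → α) → Set a
  Symmetric τ = Σ[ ι ∈ (Letter ↔ Letter) ]
      All (λ v → map (Inverse.to ι) v ≡ reverse v) phrase
    × (∀ B → ∣ Inverse.to ι B ∣ ≡ (τ ^ ε B) ∣ B ∣)
    where open Endo α using (_^_)

interleave : ∀ {X : Set} {k} → Vec (List X) (suc k) → Vec (List X) k → List X
interleave (x ∷ [])         []       = x
interleave (x ∷ xs@(_ ∷ _)) (v ∷ vs) = x ++ v ++ interleave xs vs

------------------------------------------------------------------------
-- Cobordism of nanowords

module _ {a} {α : Set a} (τ : α → α) where

  module _ (w w′ : Nanoword α) where
    private
      module w = Nanoword w
      module w′ = Nanoword w′

    record Isomorphism : Set a where
      field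
        f         : w.Letter ↔ w′.Letter
        preserves : ∀ A → w′.∣ Inverse.to f A ∣ ≡ w.∣ A ∣
        word≡     : w′.word ≡ map (Inverse.to f) w.word

    record Move₁ : Set a where
      field
        f : w′.alphabet ↪ w.alphabet
      open _↪_ f
      field
        A          : w.Letter
        x y        : List w′.Letter
        complement : ComplementOf (λ D → D ≡ A)
        word≡      : w.word  ≡ ⟦ x ⟧* ++ A ∷ A ∷ ⟦ y ⟧*
        word′≡     : w′.word ≡ x ++ y

    record Move₂ : Set a where
      field
        f : w′.alphabet ↪ w.alphabet
      open _↪_ f
      field
        A B        : w.Letter
        x y z      : List w′.Letter
        complement : ComplementOf (λ D → D ≡ A ⊎ D ≡ B)
        ∣B∣≡τ∣A∣   : w.∣ B ∣ ≡ τ w.∣ A ∣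
        word≡      : w.word  ≡ ⟦ x ⟧* ++ A ∷ B ∷ ⟦ y ⟧* ++ B ∷ A ∷ ⟦ z ⟧*
        word′≡     : w′.word ≡ x ++ y ++ z

    record Surgery : Set (sucℓ 0ℓ ⊔ a) where
      field
        ∇ : Nanophrase α
      module ∇ = Nanophrase ∇
      field
        even      : ∇.Even
        symmetric : ∇.Symmetric τ
        g         : ∇.alphabet  ↪ w.alphabet
        f         : w′.alphabet ↪ w.alphabet
      module g = _↪_ g
      module f = _↪_ f
      field
        complement : f.ComplementOf g._∈image
        xs         : Vec (List w′.Letter) (suc ∇.k)
        word≡      : w.word  ≡ interleave (Vec.map f.⟦_⟧* xs) (Vec.map g.⟦_⟧* ∇.phrase)
        word′≡     : w′.word ≡ Vec.foldr′ _++_ [] xs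

  module _ (𝒜 : Alphabet α) where
    open Alphabet 𝒜

    record Move₃ (w w′ : List Letter) : Set a where
      field
        A B C   : Letter
        x y z t : List Letter
        A≢B     : A ≢ B
        A≢C     : A ≢ C
        B≢C     : B ≢ C
        ∣A∣≡∣B∣ : ∣ A ∣ ≡ ∣ B ∣
        ∣B∣≡∣C∣ : ∣ B ∣ ≡ ∣ C ∣
        word≡   : w  ≡ x ++ A ∷ B ∷ y ++ A ∷ C ∷ z ++ B ∷ C ∷ t
        word′≡  : w′ ≡ x ++ B ∷ A ∷ y ++ C ∷ A ∷ z ++ C ∷ B ∷ t

  data Step : Nanoword α → Nanoword α → Set (sucℓ 0ℓ ⊔ a) where
    isomorphism : ∀ {w w′} → Isomorphism w w′ → Step w w′
    move₁       : ∀ {w w′} → Move₁ w w′ → Step w w′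
    move₂       : ∀ {w w′} → Move₂ w w′ → Step w w′
    move₃       : ∀ {𝒜 w w′ twice twice′} → Move₃ 𝒜 w w′ →
                  Step (record { alphabet = 𝒜 ; word = w  ; twice = twice  })
                       (record { alphabet = 𝒜 ; word = w′ ; twice = twice′ })
    surgery     : ∀ {w w′} → Surgery w w′ → Step w w′

  Cobordant : Nanoword α → Nanoword α → Set (sucℓ 0ℓ ⊔ a)
  Cobordant = EqClosure Step

  -- A raw group, as required by IsGroupHomomorphism: elements are compared up
  -- to cobordism, and the group laws up to cobordism are not part of the data.
  𝒩c : RawGroup (sucℓ 0ℓ ⊔ a) (sucℓ 0ℓ ⊔ a)
  𝒩c = record
    { Carrier = Nanoword α
    ; _≈_     = Cobordant
    ; _∙_     = _·ʷ_
    ; ε       = ∅ʷ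
    ; _⁻¹     = _⁻ʷ
    }

------------------------------------------------------------------------
-- The abelian group π with generators a ∈ α and relations a + τ(a) = 0

  infixl 6 _⊹_
  infix  8 ⊖_
  infix  4 _∼_

  data Expr : Set a where
    gen : α → Expr
    𝟘   : Expr
    _⊹_ : Expr → Expr → Expr
    ⊖_  : Expr → Expr

  data _∼_ : Expr → Expr → Set a where
    relation  : ∀ c → gen c ⊹ gen (τ c) ∼ 𝟘
    ∼-refl    : ∀ {x} → x ∼ x
    ∼-sym     : ∀ {x y} → x ∼ y → y ∼ x
    ∼-trans   : ∀ {x y z} → x ∼ y → y ∼ z → x ∼ z
    ⊹-cong    : ∀ {x x′ y y′} → x ∼ x′ → y ∼ y′ → x ⊹ y ∼ x′ ⊹ y′
    ⊖-cong    : ∀ {x y} → x ∼ y → ⊖ x ∼ ⊖ y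
    assoc     : ∀ x y z → (x ⊹ y) ⊹ z ∼ x ⊹ (y ⊹ z)
    comm      : ∀ x y → x ⊹ y ∼ y ⊹ x
    identityˡ : ∀ x → 𝟘 ⊹ x ∼ x
    inverseˡ  : ∀ x → ⊖ x ⊹ x ∼ 𝟘

  π : AbelianGroup a a
  π = record
    { Carrier = Expr
    ; _≈_     = _∼_
    ; _∙_     = _⊹_
    ; ε       = 𝟘
    ; _⁻¹     = ⊖_
    ; isAbelianGroup = record
      { isGroup = record
        { isMonoid = record
          { isSemigroup = record
            { isMagma = record
              { isEquivalence = record
                { refl = ∼-refl ; sym = ∼-sym ; trans = ∼-trans }
              ; ∙-cong = ⊹-cong
              }
            ; assoc = assoc
            }
          ; identity = identityˡ , λ x → ∼-trans (comm x 𝟘) (identityˡ x)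
          }
        ; inverse = inverseˡ , λ x → ∼-trans (comm x (⊖ x)) (inverseˡ x)
        ; ⁻¹-cong = ⊖-cong
        }
      ; comm = comm
      }
    }

  private
    module π = AbelianGroup π
  open AbelianGroupProperties π
    using (⁻¹-involutive; ⁻¹-∙-comm; ε⁻¹≈ε)
  open RawMonoidDefinitions π.rawMonoid using () renaming (_×_ to _×ℕ_)

  infixr 7 _∙_
  _∙_ : ℤ → π.Carrier → π.Carrier
  (+ n)    ∙ x = n ×ℕ x
  -[1+ n ] ∙ x = ⊖ (suc n ×ℕ x)

  ∑ : (X : FiniteSet) → (FiniteSet.Elem X → π.Carrier) → π.Carrier
  ∑ X f = Sum.sum π.commutativeMonoid (f ∘ Inverse.from (FiniteSet.enumeration X))

------------------------------------------------------------------------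
-- α-pairings

  -- A pointed finite set (S , s) is presented as S = S° ⊔ {s}, where
  -- S = Maybe S° and s = nothing.
  record Pairing : Set (sucℓ 0ℓ ⊔ a) where
    field
      S° : Alphabet α
    open Alphabet S° public using (∣_∣; letters; _≟_) renaming (Letter to Elem°)

    S : Set
    S = Maybe Elem°

    s : S
    s = nothing

    field
      e : S → S → π.Carrier

    ℤS : Set
    ℤS = S → ℤ

    ∑S : (S → π.Carrier) → π.Carrier
    ∑S f = f s ⊹ ∑ letters (f ∘ just)

    ẽ : ℤS → ℤS → π.Carrier
    ẽ x y = ∑S λ A → ∑S λ B → (x A ℤ.* y B) ∙ e A B

    basis : S → ℤS
    basis A B = if does (Maybe.≡-dec _≟_ A B) then 1ℤ else 0ℤ

    data Short (x : ℤS) : Set a where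
      single : ∀ A → x ≗ basis (just A) → Short x
      plus   : ∀ A B → A ≢ B → ∣ A ∣ ≡ ∣ B ∣ →
               x ≗ (λ C → basis (just A) C ℤ.+ basis (just B) C) → Short x
      minus  : ∀ A B → A ≢ B → ∣ A ∣ ≡ τ ∣ B ∣ →
               x ≗ (λ C → basis (just A) C ℤ.- basis (just B) C) → Short x

    record Filling : Set a where
      field
        size     : ℕ
        vector   : Fin size → ℤS
        i₀       : Fin size
        vector-s : vector i₀ ≗ basis s
        short    : ∀ i → i ≢ i₀ → Short (vector i)
        covers   : ∀ (A : Elem°) → ∃! _≡_ λ i → vector i (just A) ≢ 0ℤ

    Annihilating : Filling → Set a
    Annihilating Λ = ∀ i j → ẽ (vector i) (vector j) ∼ 𝟘
      where open Filling Λ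

    Hyperbolic : Set a
    Hyperbolic = ∃ Annihilating

    SkewSymmetric : Set a
    SkewSymmetric = (∀ A → e A A ∼ 𝟘) × (∀ A B → e A B ∼ ⊖ e B A)

  infix 8 _⁻ᵖ
  _⁻ᵖ : Pairing → Pairing
  p ⁻ᵖ = record { S° = S° ; e = λ A B → ⊖ e A B }
    where open Pairing p

  infixl 6 _⊕_
  _⊕_ : Pairing → Pairing → Pairing
  p₁ ⊕ p₂ = record { S° = p₁.S° ⊎ᵃ p₂.S° ; e = e }
    where
    module p₁ = Pairing p₁
    module p₂ = Pairing p₂
    S = Maybe (p₁.Elem° ⊎ p₂.Elem°)
    e : S → S → π.Carrier
    e nothing         nothing         = p₁.e p₁.s p₁.s ⊹ p₂.e p₂.s p₂.s
    e nothing         (just (inj₁ B)) = p₁.e p₁.s (just B)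
    e nothing         (just (inj₂ B)) = p₂.e p₂.s (just B)
    e (just (inj₁ A)) nothing         = p₁.e (just A) p₁.s
    e (just (inj₂ A)) nothing         = p₂.e (just A) p₂.s
    e (just (inj₁ A)) (just (inj₁ B)) = p₁.e (just A) (just B)
    e (just (inj₂ A)) (just (inj₂ B)) = p₂.e (just A) (just B)
    e (just (inj₁ A)) (just (inj₂ B)) = 𝟘
    e (just (inj₂ A)) (just (inj₁ B)) = 𝟘

  ∅ᵖ : Pairing
  ∅ᵖ = record { S° = ∅ᵃ ; e = λ _ _ → 𝟘 }

  Cobordantᵖ : Pairing → Pairing → Set a
  Cobordantᵖ p₁ p₂ = Pairing.Hyperbolic (p₁ ⊕ p₂ ⁻ᵖ)

  private
    𝟘∼⊖𝟘 : 𝟘 ∼ ⊖ 𝟘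
    𝟘∼⊖𝟘 = ∼-sym ε⁻¹≈ε

    𝟘⊹𝟘 : ∀ {x y} → x ∼ 𝟘 → y ∼ 𝟘 → x ⊹ y ∼ 𝟘
    𝟘⊹𝟘 p q = ∼-trans (⊹-cong p q) (identityˡ 𝟘)

  SkewPairing : Set (sucℓ 0ℓ ⊔ a)
  SkewPairing = Σ Pairing Pairing.SkewSymmetric

  ∅ᵖ-skew : Pairing.SkewSymmetric ∅ᵖ
  ∅ᵖ-skew = (λ _ → ∼-refl) , (λ _ _ → 𝟘∼⊖𝟘)

  ⁻ᵖ-skew : ∀ p → Pairing.SkewSymmetric p → Pairing.SkewSymmetric (p ⁻ᵖ)
  ⁻ᵖ-skew p (diag , skew) =
    (λ A → ∼-trans (⊖-cong (diag A)) ε⁻¹≈ε) , (λ A B → ⊖-cong (skew A B))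

  ⊕-skew : ∀ p₁ p₂ → Pairing.SkewSymmetric p₁ → Pairing.SkewSymmetric p₂ →
           Pairing.SkewSymmetric (p₁ ⊕ p₂)
  ⊕-skew p₁ p₂ (diag₁ , skew₁) (diag₂ , skew₂) = diag , skew
    where
    open Pairing (p₁ ⊕ p₂)
    diag : ∀ A → e A A ∼ 𝟘
    diag nothing         = 𝟘⊹𝟘 (diag₁ nothing) (diag₂ nothing)
    diag (just (inj₁ A)) = diag₁ (just A)
    diag (just (inj₂ A)) = diag₂ (just A)
    skew : ∀ A B → e A B ∼ ⊖ e B A
    skew nothing         nothing         =
      ∼-trans (⊹-cong (skew₁ nothing nothing) (skew₂ nothing nothing)) (⁻¹-∙-comm _ _)
    skew nothing         (just (inj₁ B)) = skew₁ nothing (just B)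
    skew nothing         (just (inj₂ B)) = skew₂ nothing (just B)
    skew (just (inj₁ A)) nothing         = skew₁ (just A) nothing
    skew (just (inj₂ A)) nothing         = skew₂ (just A) nothing
    skew (just (inj₁ A)) (just (inj₁ B)) = skew₁ (just A) (just B)
    skew (just (inj₂ A)) (just (inj₂ B)) = skew₂ (just A) (just B)
    skew (just (inj₁ A)) (just (inj₂ B)) = 𝟘∼⊖𝟘
    skew (just (inj₂ A)) (just (inj₁ B)) = 𝟘∼⊖𝟘

  𝒫sk : RawGroup (sucℓ 0ℓ ⊔ a) a
  𝒫sk = record
    { Carrier = SkewPairing
    ; _≈_     = λ p₁ p₂ → Cobordantᵖ (proj₁ p₁) (proj₁ p₂)
    ; _∙_     = λ (p₁ , sk₁) (p₂ , sk₂) → p₁ ⊕ p₂ , ⊕-skew p₁ p₂ sk₁ sk₂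
    ; ε       = ∅ᵖ , ∅ᵖ-skew
    ; _⁻¹     = λ (p , sk) → p ⁻ᵖ , ⁻ᵖ-skew p sk
    }

------------------------------------------------------------------------
-- The α-pairing of a nanoword

  module _ (w : Nanoword α) where
    open Nanoword w

    infix 7 _∘ʷ_
    _∘ʷ_ : Letter → Letter → π.Carrier
    A ∘ʷ B = ∑ letters λ D → if does (between? A B D) then gen ∣ D ∣ else 𝟘

    eʷ : Maybe Letter → Maybe Letter → π.Carrier
    eʷ (just A) (just B) =
      (+ 2) ∙ (A ∘ʷ B ⊹ ⊖ (B ∘ʷ A)) ⊹ n A B ∙ (gen ∣ A ∣ ⊹ gen ∣ B ∣)
    eʷ (just A) nothing  = ∑ letters λ D → n A D ∙ gen ∣ D ∣
    eʷ nothing  (just A) = ⊖ (∑ letters λ D → n A D ∙ gen ∣ D ∣)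
    eʷ nothing  nothing  = 𝟘

    pairing : Pairing
    pairing = record { S° = alphabet ; e = eʷ }

    private
      open Mult π.commutativeMonoid using (×-congʳ; ×-distrib-+)
      open import Relation.Binary.Reasoning.Setoid π.setoid

      sign-antisym : ∀ {P Q : Set} → (P → ¬ Q) → (p? : Dec P) (q? : Dec Q) →
                     sign p? q? ≡ ℤ.- sign q? p?
      sign-antisym ¬PQ (yes p) (yes q) = ⊥-elim (¬PQ p q)
      sign-antisym ¬PQ (yes _) (no  _) = refl
      sign-antisym ¬PQ (no  _) (yes _) = refl
      sign-antisym ¬PQ (no  _) (no  _) = refl

      n-antisym : ∀ A B → n A B ≡ ℤ.- n B A
      n-antisym A B =
        sign-antisym (λ (A<B , _) (B<A , _) → ℕ.<-asym A<B B<A) (pattern? A B) (pattern? B A)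

      sign-zero : ∀ {P : Set} → ¬ P → (p? : Dec P) → sign p? p? ≡ 0ℤ
      sign-zero ¬P (yes p) = ⊥-elim (¬P p)
      sign-zero ¬P (no  _) = refl

      n-diag : ∀ A → n A A ≡ 0ℤ
      n-diag A = sign-zero (λ (A<A , _) → ℕ.<-irrefl refl A<A) (pattern? A A)

      ×ℕ-⊖ : ∀ m x → m ×ℕ (⊖ x) ∼ ⊖ (m ×ℕ x)
      ×ℕ-⊖ zero    x = 𝟘∼⊖𝟘
      ×ℕ-⊖ (suc m) x = ∼-trans (⊹-cong ∼-refl (×ℕ-⊖ m x)) (⁻¹-∙-comm _ _)

      ∙-cong : ∀ k {x y} → x ∼ y → k ∙ x ∼ k ∙ y
      ∙-cong (+ m)    p = ×-congʳ m p
      ∙-cong -[1+ m ] p = ⊖-cong (×-congʳ (suc m) p)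

      -‿∙ : ∀ k x → (ℤ.- k) ∙ x ∼ ⊖ (k ∙ x)
      -‿∙ (+ zero)  x = 𝟘∼⊖𝟘
      -‿∙ (+ suc m) x = ∼-refl
      -‿∙ -[1+ m ]  x = ∼-sym (⁻¹-involutive _)

      swap : ∀ x y → x ⊹ ⊖ y ∼ ⊖ (y ⊹ ⊖ x)
      swap x y = begin
        x ⊹ ⊖ y        ≈⟨ comm x (⊖ y) ⟩
        ⊖ y ⊹ x        ≈⟨ ⊹-cong ∼-refl (⁻¹-involutive x) ⟨
        ⊖ y ⊹ ⊖ (⊖ x)  ≈⟨ ⁻¹-∙-comm y (⊖ x) ⟩
        ⊖ (y ⊹ ⊖ x)    ∎

      skew : ∀ A B → eʷ A B ∼ ⊖ eʷ B A
      skew nothing  nothing  = 𝟘∼⊖𝟘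
      skew nothing  (just B) = ∼-refl
      skew (just A) nothing  = ∼-sym (⁻¹-involutive _)
      skew (just A) (just B) rewrite n-antisym A B = begin
        (+ 2) ∙ (A ∘ʷ B ⊹ ⊖ (B ∘ʷ A)) ⊹ (ℤ.- n B A) ∙ (gen ∣ A ∣ ⊹ gen ∣ B ∣)
          ≈⟨ ⊹-cong (∙-cong (+ 2) (swap (A ∘ʷ B) (B ∘ʷ A)))
                    (∙-cong (ℤ.- n B A) (comm (gen ∣ A ∣) (gen ∣ B ∣))) ⟩
        (+ 2) ∙ (⊖ (B ∘ʷ A ⊹ ⊖ (A ∘ʷ B))) ⊹ (ℤ.- n B A) ∙ (gen ∣ B ∣ ⊹ gen ∣ A ∣)
          ≈⟨ ⊹-cong (×ℕ-⊖ 2 _) (-‿∙ (n B A) _) ⟩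
        ⊖ ((+ 2) ∙ (B ∘ʷ A ⊹ ⊖ (A ∘ʷ B))) ⊹ ⊖ (n B A ∙ (gen ∣ B ∣ ⊹ gen ∣ A ∣))
          ≈⟨ ⁻¹-∙-comm _ _ ⟩
        ⊖ ((+ 2) ∙ (B ∘ʷ A ⊹ ⊖ (A ∘ʷ B)) ⊹ n B A ∙ (gen ∣ B ∣ ⊹ gen ∣ A ∣)) ∎

      diag : ∀ A → eʷ A A ∼ 𝟘
      diag nothing  = ∼-refl
      diag (just A) rewrite n-diag A =
        𝟘⊹𝟘 (∼-trans (∙-cong (+ 2) (π.inverseʳ (A ∘ʷ A)))
                     (𝟘⊹𝟘 ∼-refl (identityˡ 𝟘)))
            ∼-refl

    pairing-skew : Pairing.SkewSymmetric pairing
    pairing-skew = diag , skew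

  p : Nanoword α → SkewPairing
  p w = pairing w , pairing-skew w

{-# OPTIONS --safe #-}

-- To a letter A of a nanoword w associate the function h_A on positions with
-- value 2 strictly between the two occurrences of A, 1 at these occurrences and
-- 0 elsewhere, and let h_s = 1. Then, uniformly for x, y in S,
--
--   e_w(x, y) = ½ ∑_D (h_x(i_D) h_y(j_D) - h_x(j_D) h_y(i_D)) |D|,
--
-- where the coefficients are integers. By bilinearity the same formula computes
-- the form on vectors of ℤS, if h is extended linearly. For a surgery along a
-- phrase ∇ = (v₁ | ⋯ | v_k) with involution ι, fill p(w) ⊕ p(w′)⁻ by the vectors
-- A + A′ for the remaining letters A and by B ± ιB (or B, if ιB = B) for the
-- letters B of ∇. The functions attached to these vectors are invariant under the
-- reflections v_r ↦ v_r⁻ and agree with those of w′ outside of ∇, so the terms of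
-- D and ιD cancel in π for the letters D of ∇. The first two homotopy moves are
-- surgeries, and under the third one the form does not change, the contributions
-- of A, B and C having the same sum.
--
-- Cobordism of pairings is composed by eliminating the letters of the middle
-- pairing one after the other: the two vectors in which such a letter occurs are
-- replaced by their sum or difference.

module Submission where

open import Defs
open import Algebra.Definitions using (Involutive)
open import Algebra.Morphism.Structures using (module GroupMorphisms)
open import Relation.Binary.PropositionalEquality using (_≡_)
open GroupMorphisms using (IsGroupHomomorphism)

open import Algebra.Bundles using (AbelianGroup)
import Algebra.Properties.AbelianGroup as AbelianGroupProperties
import Algebra.Properties.CommutativeMonoid.Mult as MonoidMult
import Algebra.Properties.CommutativeMonoid.Sum as MonoidSum
import Algebra.Properties.CommutativeSemigroup as CommutativeSemigroupProperties
open import Data.Bool.Base using (Bool; true; false; if_then_else_; _∧_)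
open import Data.Fin.Base as Fin using (Fin; zero; suc)
open import Data.Fin.Patterns using (0F; 1F; 2F)
import Data.Fin.Properties as Fin
open import Data.Integer.Base as ℤ using (ℤ; -[1+_]; 0ℤ; 1ℤ; -1ℤ)
import Data.Integer.Properties as ℤ
open import Data.Integer.Tactic.RingSolver using (solve-∀)
open import Data.List.Base using (List; []; _∷_; _++_; map; filter; length; reverse; take; drop)
open import Data.List.Properties
  using ( ∷-injectiveˡ; ∷-injectiveʳ; ++-assoc; ++-identityʳ; map-++; map-∘; length-map
        ; reverse-++; reverse-map; reverse-involutive; unfold-reverse; length-reverse
        ; take++drop≡id; length-take; length-drop )
open import Data.Maybe.Base as Maybe using (Maybe; just; nothing)
import Data.Maybe.Properties as Maybe
open import Data.Nat.Base as ℕ using (ℕ; zero; suc; _+_; _≤_; _<_; z≤n; s≤s)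
open import Data.Nat.Divisibility as ℕ∣ using (_∣_; divides)
import Data.Nat.Properties as ℕ
import Data.Nat.Tactic.RingSolver as ℕ-Solver
open import Data.Product.Base using (Σ-syntax; ∃; ∃-syntax; _×_; _,_; proj₁; proj₂; map₂)
open import Data.Product using (∃!)
open import Data.Sign.Base as Sign using (Sign)
import Data.Sign.Properties as Sign
open import Data.Sum.Base as Sum using (_⊎_; inj₁; inj₂; [_,_]′; swap)
open import Data.Sum.Function.Propositional using (_⊎-↔_)
import Data.Sum.Properties as Sum
open import Data.Vec.Base as Vec using (Vec; []; _∷_)
open import Data.Vec.Relation.Unary.All as All using (All; []; _∷_)
open import Data.Vec.Relation.Unary.Any as Any using (Any; any?; here; there)
open import Function.Base using (_∘_; id; case_of_)
open import Function.Bundles using (_↔_; Inverse; mk↔ₛ′; mk⇔; Equivalence)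
open import Function.Construct.Composition using (_↔-∘_)
open import Function.Construct.Identity using (↔-id)
open import Function.Construct.Symmetry using (↔-sym)
open import Function.Definitions using (Injective)
import Function.Endo.Propositional as Endo
open import Level using (_⊔_; 0ℓ) renaming (suc to sucℓ)
open import Relation.Binary.Construct.Closure.Equivalence using (gfold)
open import Relation.Binary.Definitions using (DecidableEquality; module Tri)
open import Relation.Binary.PropositionalEquality
  using (_≢_; _≗_; refl; sym; trans; cong; cong₂; subst; subst₂; module ≡-Reasoning)
open import Relation.Binary.Structures using (IsEquivalence)
open import Relation.Nullary.Decidable
  using (Dec; yes; no; does; dec-true; dec-false; does-⇔; _×-dec_)
open import Relation.Nullary.Negation using (¬_; contradiction)

-- The group π and the bilinear forms of pairings

-- Two obstacles shape the argument. If `τ` fixes a, then 2a = 0 in `π`, so the factor ½ makes no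
-- sense there and an identity between doubles proves nothing. All halving is therefore done on
-- integer coefficients: a value of a form comes with a function N such that N(D) + N(D) is the
-- determinant of the functions h at D, and two values are compared through their N. For the same
-- reason a cancellation in pairs has to treat the fixed letters of `ι` separately, and the even
-- length of the words of a phrase enters there.
--
-- Moreover, hyperbolicity only provides a list of mutually orthogonal vectors, and lists are
-- awkward to compose. A `Bordism` strengthens it: it carries a whole subgroup `L` on which the two
-- forms agree, and a matching of the letters whose vectors lie in `L`. The sums and differences
-- made by an elimination then stay in the subgroup of the composite, and no form has to be computed
-- again. Fillings are extracted from bordisms only at the very end.

module Coefficients {a} {α : Set a} (τ : α → α) where

  module π = AbelianGroup (π τ)
  open AbelianGroupProperties (π τ) public
    using (⁻¹-involutive; ⁻¹-∙-comm; ε⁻¹≈ε; inverseʳ-unique; ∙-cancelˡ; x∙y⁻¹≈ε⇒x≈y)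
  open CommutativeSemigroupProperties π.commutativeSemigroup public using (interchange)
  open MonoidMult π.commutativeMonoid using (×-congʳ; ×-distrib-+)
  module ∑ = MonoidSum π.commutativeMonoid
  open import Relation.Binary.Reasoning.Setoid π.setoid

  infixr 7 _•_
  infix 4 _≋_
  _•_ : ℤ → Expr τ → Expr τ
  _•_ = _∙_ τ

  _≋_ : Expr τ → Expr τ → Set a
  _≋_ = _∼_ τ

  𝟘⊹𝟘≋𝟘 : ∀ {x y} → x ≋ 𝟘 → y ≋ 𝟘 → x ⊹ y ≋ 𝟘
  𝟘⊹𝟘≋𝟘 x≋𝟘 y≋𝟘 = ∼-trans (⊹-cong x≋𝟘 y≋𝟘) (identityˡ 𝟘)

  •-cong : ∀ k {x y} → x ≋ y → k • x ≋ k • y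
  •-cong (ℤ.+ m)    p = ×-congʳ m p
  •-cong -[1+ m ] p = ⊖-cong (×-congʳ (suc m) p)

  •-congˡ : ∀ {k l} x → k ≡ l → k • x ≋ l • x
  •-congˡ x refl = ∼-refl

  1• : ∀ x → 1ℤ • x ≋ x
  1• = π.identityʳ

  •-suc : ∀ k x → ℤ.suc k • x ≋ x ⊹ k • x
  •-suc (ℤ.+ m)        x = ∼-refl
  •-suc -[1+ zero ]  x = begin
    𝟘            ≈⟨ π.inverseʳ x ⟨
    x ⊹ ⊖ x      ≈⟨ ⊹-cong ∼-refl (⊖-cong (π.identityʳ x)) ⟨
    x ⊹ ⊖ (x ⊹ 𝟘)  ∎
  •-suc -[1+ suc m ] x = begin
    ⊖ y              ≈⟨ identityˡ _ ⟨
    𝟘 ⊹ ⊖ y          ≈⟨ ⊹-cong (π.inverseʳ x) ∼-refl ⟨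
    (x ⊹ ⊖ x) ⊹ ⊖ y  ≈⟨ assoc _ _ _ ⟩
    x ⊹ (⊖ x ⊹ ⊖ y)  ≈⟨ ⊹-cong ∼-refl (⁻¹-∙-comm x y) ⟩
    x ⊹ ⊖ (x ⊹ y)    ∎
    where y = (ℤ.+ suc m) • x

  +•-homo-+ : ∀ m l x → (ℤ.+ m ℤ.+ l) • x ≋ (ℤ.+ m) • x ⊹ l • x
  +•-homo-+ zero    l x = ∼-trans (•-congˡ x (ℤ.+-identityˡ l)) (∼-sym (identityˡ _))
  +•-homo-+ (suc m) l x = begin
    (ℤ.+ suc m ℤ.+ l) • x          ≡⟨ cong (_• x) (ℤ.+-assoc 1ℤ (ℤ.+ m) l) ⟩
    ℤ.suc (ℤ.+ m ℤ.+ l) • x        ≈⟨ •-suc (ℤ.+ m ℤ.+ l) x ⟩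
    x ⊹ (ℤ.+ m ℤ.+ l) • x          ≈⟨ ⊹-cong ∼-refl (+•-homo-+ m l x) ⟩
    x ⊹ ((ℤ.+ m) • x ⊹ l • x)      ≈⟨ assoc _ _ _ ⟨
    (ℤ.+ suc m) • x ⊹ l • x        ∎

  •-homo-neg : ∀ k x → (ℤ.- k) • x ≋ ⊖ (k • x)
  •-homo-neg (ℤ.+ zero)  x = ∼-sym ε⁻¹≈ε
  •-homo-neg (ℤ.+ suc m) x = ∼-refl
  •-homo-neg -[1+ m ]  x = ∼-sym (⁻¹-involutive _)

  •-homo-+ : ∀ k l x → (k ℤ.+ l) • x ≋ k • x ⊹ l • x
  •-homo-+ (ℤ.+ m)    l x = +•-homo-+ m l x
  •-homo-+ -[1+ m ] l x = ∼-sym (begin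
    ⊖ y ⊹ l • x                      ≡⟨ cong (λ k → ⊖ y ⊹ k • x) l≡ ⟩
    ⊖ y ⊹ (ℤ.+ suc m ℤ.+ k) • x        ≈⟨ ⊹-cong ∼-refl (+•-homo-+ (suc m) k x) ⟩
    ⊖ y ⊹ (y ⊹ k • x)                ≈⟨ assoc _ _ _ ⟨
    (⊖ y ⊹ y) ⊹ k • x                ≈⟨ ⊹-cong (inverseˡ y) ∼-refl ⟩
    𝟘 ⊹ k • x                        ≈⟨ identityˡ _ ⟩
    k • x                            ∎)
    where
    y = (ℤ.+ suc m) • x
    k = -[1+ m ] ℤ.+ l
    l≡ : l ≡ ℤ.+ suc m ℤ.+ k
    l≡ = sym (trans (sym (ℤ.+-assoc (ℤ.+ suc m) -[1+ m ] l))
           (trans (cong (ℤ._+ l) (ℤ.+-inverseʳ (ℤ.+ suc m))) (ℤ.+-identityˡ l)))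

  •-distrib-⊹ : ∀ k x y → k • (x ⊹ y) ≋ k • x ⊹ k • y
  •-distrib-⊹ (ℤ.+ m)    x y = ×-distrib-+ x y m
  •-distrib-⊹ -[1+ m ] x y =
    ∼-trans (⊖-cong (×-distrib-+ x y (suc m))) (∼-sym (⁻¹-∙-comm _ _))

  •-𝟘 : ∀ k → k • 𝟘 ≋ 𝟘
  •-𝟘 k = ∙-cancelˡ (k • 𝟘) _ _ (begin
    k • 𝟘 ⊹ k • 𝟘  ≈⟨ •-distrib-⊹ k 𝟘 𝟘 ⟨
    k • (𝟘 ⊹ 𝟘)    ≈⟨ •-cong k (identityˡ 𝟘) ⟩
    k • 𝟘          ≈⟨ π.identityʳ _ ⟨
    k • 𝟘 ⊹ 𝟘      ∎)

  •-⊖ : ∀ k x → k • (⊖ x) ≋ ⊖ (k • x)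
  •-⊖ k x = inverseʳ-unique _ _ (begin
    k • x ⊹ k • (⊖ x)  ≈⟨ •-distrib-⊹ k x (⊖ x) ⟨
    k • (x ⊹ ⊖ x)      ≈⟨ •-cong k (π.inverseʳ x) ⟩
    k • 𝟘              ≈⟨ •-𝟘 k ⟩
    𝟘                  ∎)

  gen-τ : ∀ c → gen (τ c) ≋ ⊖ gen c
  gen-τ c = inverseʳ-unique _ _ (relation c)

  sum-⊎ : ∀ m {n} (g : Fin m ⊎ Fin n → Expr τ) →
          ∑.sum (g ∘ Fin.splitAt m) ≋ ∑.sum (g ∘ inj₁) ⊹ ∑.sum (g ∘ inj₂)
  sum-⊎ zero    g = ∼-sym (identityˡ _)
  sum-⊎ (suc m) g =
    ∼-trans (⊹-cong ∼-refl (sum-⊎ m (g ∘ [ inj₁ ∘ suc , inj₂ ]′))) (∼-sym (assoc _ _ _))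

  sum-single : ∀ {n} (f : Fin n → Expr τ) i → (∀ j → j ≢ i → f j ≋ 𝟘) → ∑.sum f ≋ f i
  sum-single {suc n} f zero    f≋𝟘 = ∼-trans
    (⊹-cong ∼-refl (∼-trans (∑.sum-cong-≋ (λ j → f≋𝟘 (suc j) λ ())) (∑.sum-replicate-zero n)))
    (π.identityʳ _)
  sum-single {suc n} f (suc i) f≋𝟘 = ∼-trans
    (⊹-cong (f≋𝟘 zero λ ()) (sum-single (f ∘ suc) i λ j j≢i → f≋𝟘 (suc j) (j≢i ∘ Fin.suc-injective)))
    (identityˡ _)

  module Summation (X : FiniteSet) where
    open FiniteSet X

    ∑ᶠ : (Elem → Expr τ) → Expr τ
    ∑ᶠ = ∑ τ X

    ∑-cong : ∀ {f g} → (∀ A → f A ≋ g A) → ∑ᶠ f ≋ ∑ᶠ g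
    ∑-cong {f} {g} f≋g =
      ∑.sum-cong-≋ {x = f ∘ Inverse.from enumeration} {g ∘ Inverse.from enumeration} (λ i → f≋g _)

    ∑-⊹ : ∀ f g → ∑ᶠ (λ A → f A ⊹ g A) ≋ ∑ᶠ f ⊹ ∑ᶠ g
    ∑-⊹ f g = ∑.∑-distrib-+ (f ∘ Inverse.from enumeration) (g ∘ Inverse.from enumeration)

    ∑-𝟘 : ∀ {f} → (∀ A → f A ≋ 𝟘) → ∑ᶠ f ≋ 𝟘
    ∑-𝟘 f≋𝟘 = ∼-trans (∑-cong f≋𝟘) (∑.sum-replicate-zero size)

    ∑-⊖ : ∀ f → ∑ᶠ (λ A → ⊖ f A) ≋ ⊖ ∑ᶠ f
    ∑-⊖ f = inverseʳ-unique _ _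
      (∼-trans (∼-sym (∑-⊹ f (λ A → ⊖ f A))) (∑-𝟘 λ A → π.inverseʳ (f A)))

    ∑-single : ∀ f A → (∀ B → B ≢ A → f B ≋ 𝟘) → ∑ᶠ f ≋ f A
    ∑-single f A f≋𝟘 = ∼-trans
      (sum-single _ (Inverse.to enumeration A) λ i i≢ → f≋𝟘 _ λ eq →
        i≢ (trans (sym (Inverse.inverseˡ enumeration refl)) (cong (Inverse.to enumeration) eq)))
      (π.reflexive (cong f (Inverse.inverseʳ enumeration refl)))

  ∑-⊎ : ∀ X Y f → ∑ τ (X ⊎ᶠ Y) f ≋ ∑ τ X (f ∘ inj₁) ⊹ ∑ τ Y (f ∘ inj₂)
  ∑-⊎ X Y f = ∼-trans
    (∑.sum-cong-≋ λ i → lemma (Fin.splitAt X.size i))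
    (sum-⊎ X.size [ f ∘ inj₁ ∘ Inverse.from X.enumeration , f ∘ inj₂ ∘ Inverse.from Y.enumeration ]′)
    where
    module X = FiniteSet X
    module Y = FiniteSet Y
    lemma : ∀ s → f (Inverse.from (X.enumeration ⊎-↔ Y.enumeration) s) ≋
            [ f ∘ inj₁ ∘ Inverse.from X.enumeration , f ∘ inj₂ ∘ Inverse.from Y.enumeration ]′ s
    lemma (inj₁ i) = ∼-refl
    lemma (inj₂ j) = ∼-refl

  ∑-bijection : ∀ X Y (σ : FiniteSet.Elem Y ↔ FiniteSet.Elem X) f →
                ∑ τ X f ≋ ∑ τ Y (f ∘ Inverse.to σ)
  ∑-bijection X Y σ f = ∼-trans (∑.sum-permute _ ρ) (∑.sum-cong-≋
    {x = f ∘ Inverse.from X.enumeration ∘ Inverse.to ρ} {f ∘ Inverse.to σ ∘ Inverse.from Y.enumeration}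
    λ i → π.reflexive (cong f (Inverse.inverseʳ X.enumeration refl)))
    where
    module X = FiniteSet X
    module Y = FiniteSet Y
    ρ : Fin Y.size ↔ Fin X.size
    ρ = X.enumeration ↔-∘ (σ ↔-∘ ↔-sym Y.enumeration)

  ∑ᴹ : ∀ X → (Maybe (FiniteSet.Elem X) → Expr τ) → Expr τ
  ∑ᴹ X f = f nothing ⊹ ∑ τ X (f ∘ just)

  module _ (X : FiniteSet) where
    open FiniteSet X
    open Summation X

    ∑ᴹ-cong : ∀ f g → (∀ A → f A ≋ g A) → ∑ᴹ X f ≋ ∑ᴹ X g
    ∑ᴹ-cong f g f≋g = ⊹-cong (f≋g nothing) (∑-cong (f≋g ∘ just))

    ∑ᴹ-⊹ : ∀ f g → ∑ᴹ X (λ A → f A ⊹ g A) ≋ ∑ᴹ X f ⊹ ∑ᴹ X g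
    ∑ᴹ-⊹ f g = ∼-trans (⊹-cong ∼-refl (∑-⊹ (f ∘ just) (g ∘ just))) (interchange _ _ _ _)

    ∑ᴹ-𝟘 : ∀ f → (∀ A → f A ≋ 𝟘) → ∑ᴹ X f ≋ 𝟘
    ∑ᴹ-𝟘 f f≋𝟘 = 𝟘⊹𝟘≋𝟘 (f≋𝟘 nothing) (∑-𝟘 (f≋𝟘 ∘ just))

    ∑ᴹ-⊖ : ∀ f → ∑ᴹ X (λ A → ⊖ f A) ≋ ⊖ ∑ᴹ X f
    ∑ᴹ-⊖ f = ∼-trans (⊹-cong ∼-refl (∑-⊖ (f ∘ just))) (⁻¹-∙-comm _ _)

    ∑ᴹ-single : ∀ f A → (∀ B → B ≢ A → f B ≋ 𝟘) → ∑ᴹ X f ≋ f A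
    ∑ᴹ-single f nothing  f≋𝟘 =
      ∼-trans (⊹-cong ∼-refl (∑-𝟘 λ A → f≋𝟘 (just A) λ ())) (π.identityʳ _)
    ∑ᴹ-single f (just A) f≋𝟘 = ∼-trans
      (⊹-cong (f≋𝟘 nothing λ ()) (∑-single (f ∘ just) A λ B B≢A →
        f≋𝟘 (just B) (B≢A ∘ Maybe.just-injective)))
      (identityˡ _)

  ∑ᴹ-⊎ : ∀ X Y f g h → f nothing ≋ g nothing ⊹ h nothing →
         (∀ A → f (just (inj₁ A)) ≋ g (just A)) → (∀ B → f (just (inj₂ B)) ≋ h (just B)) →
         ∑ᴹ (X ⊎ᶠ Y) f ≋ ∑ᴹ X g ⊹ ∑ᴹ Y h
  ∑ᴹ-⊎ X Y f g h f₀ f₁ f₂ = ∼-trans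
    (⊹-cong f₀ (∼-trans (∑-⊎ X Y (f ∘ just))
      (⊹-cong (Summation.∑-cong X f₁) (Summation.∑-cong Y f₂))))
    (interchange _ _ _ _)

  module DoubleSum (X : FiniteSet) where
    open FiniteSet X

    S = Maybe Elem

    ∑∑ : (S → S → Expr τ) → Expr τ
    ∑∑ F = ∑ᴹ X λ A → ∑ᴹ X (F A)

    ∑∑-cong : ∀ F G → (∀ A B → F A B ≋ G A B) → ∑∑ F ≋ ∑∑ G
    ∑∑-cong F G F≋G = ∑ᴹ-cong X _ _ λ A → ∑ᴹ-cong X (F A) (G A) (F≋G A)

    ∑∑-⊹ : ∀ F G → ∑∑ (λ A B → F A B ⊹ G A B) ≋ ∑∑ F ⊹ ∑∑ G
    ∑∑-⊹ F G = ∼-trans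
      (∑ᴹ-cong X (λ A → ∑ᴹ X λ B → F A B ⊹ G A B) (λ A → ∑ᴹ X (F A) ⊹ ∑ᴹ X (G A))
        λ A → ∑ᴹ-⊹ X (F A) (G A))
      (∑ᴹ-⊹ X (λ A → ∑ᴹ X (F A)) (λ A → ∑ᴹ X (G A)))

    ∑∑-⊖ : ∀ F → ∑∑ (λ A B → ⊖ F A B) ≋ ⊖ ∑∑ F
    ∑∑-⊖ F = ∼-trans
      (∑ᴹ-cong X (λ A → ∑ᴹ X λ B → ⊖ F A B) (λ A → ⊖ ∑ᴹ X (F A)) λ A → ∑ᴹ-⊖ X (F A))
      (∑ᴹ-⊖ X (λ A → ∑ᴹ X (F A)))

    ∑∑-single : ∀ F A B → (∀ C D → C ≢ A → F C D ≋ 𝟘) → (∀ D → D ≢ B → F A D ≋ 𝟘) →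
                ∑∑ F ≋ F A B
    ∑∑-single F A B F≋𝟘 FA≋𝟘 = ∼-trans
      (∑ᴹ-single X (λ C → ∑ᴹ X (F C)) A λ C C≢A → ∑ᴹ-𝟘 X (F C) λ D → F≋𝟘 C D C≢A)
      (∑ᴹ-single X (F A) B FA≋𝟘)

  module Form (p : Pairing τ) where
    open Pairing p
    open DoubleSum letters hiding (S)

    term : ℤS → ℤS → S → S → Expr τ
    term x y A B = (x A ℤ.* y B) • e A B

    ẽ-cong : ∀ {x x′ y y′} → x ≗ x′ → y ≗ y′ → ẽ x y ≋ ẽ x′ y′
    ẽ-cong {x} {x′} {y} {y′} x≗ y≗ = ∑∑-cong (term x y) (term x′ y′) λ A B →
      •-congˡ (e A B) (cong₂ ℤ._*_ (x≗ A) (y≗ B))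

    ẽ-+ˡ : ∀ x x′ y → ẽ (λ A → x A ℤ.+ x′ A) y ≋ ẽ x y ⊹ ẽ x′ y
    ẽ-+ˡ x x′ y = ∼-trans
      (∑∑-cong (term (λ A → x A ℤ.+ x′ A) y) (λ A B → term x y A B ⊹ term x′ y A B) λ A B → ∼-trans
        (•-congˡ (e A B) (ℤ.*-distribʳ-+ (y B) (x A) (x′ A))) (•-homo-+ (x A ℤ.* y B) _ _))
      (∑∑-⊹ (term x y) (term x′ y))

    ẽ-+ʳ : ∀ x y y′ → ẽ x (λ A → y A ℤ.+ y′ A) ≋ ẽ x y ⊹ ẽ x y′
    ẽ-+ʳ x y y′ = ∼-trans
      (∑∑-cong (term x (λ A → y A ℤ.+ y′ A)) (λ A B → term x y A B ⊹ term x y′ A B) λ A B → ∼-trans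
        (•-congˡ (e A B) (ℤ.*-distribˡ-+ (x A) (y B) (y′ B))) (•-homo-+ (x A ℤ.* y B) _ _))
      (∑∑-⊹ (term x y) (term x y′))

    ẽ-negˡ : ∀ x y → ẽ (λ A → ℤ.- x A) y ≋ ⊖ ẽ x y
    ẽ-negˡ x y = ∼-trans
      (∑∑-cong (term (λ A → ℤ.- x A) y) (λ A B → ⊖ term x y A B) λ A B → ∼-trans
        (•-congˡ (e A B) (sym (ℤ.neg-distribˡ-* (x A) (y B)))) (•-homo-neg (x A ℤ.* y B) _))
      (∑∑-⊖ (term x y))

    ẽ-negʳ : ∀ x y → ẽ x (λ A → ℤ.- y A) ≋ ⊖ ẽ x y
    ẽ-negʳ x y = ∼-trans
      (∑∑-cong (term x (λ A → ℤ.- y A)) (λ A B → ⊖ term x y A B) λ A B → ∼-trans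
        (•-congˡ (e A B) (sym (ℤ.neg-distribʳ-* (x A) (y B)))) (•-homo-neg (x A ℤ.* y B) _))
      (∑∑-⊖ (term x y))

    basis-yes : ∀ A → basis A A ≡ 1ℤ
    basis-yes A = cong (λ b → if b then 1ℤ else 0ℤ) (dec-true (Maybe.≡-dec _≟_ A A) refl)

    basis-no : ∀ A B → A ≢ B → basis A B ≡ 0ℤ
    basis-no A B A≢B = cong (λ b → if b then 1ℤ else 0ℤ) (dec-false (Maybe.≡-dec _≟_ A B) A≢B)

    ẽ-basis : ∀ A B → ẽ (basis A) (basis B) ≋ e A B
    ẽ-basis A B = ∼-trans
      (∑∑-single (term (basis A) (basis B)) A B
        (λ C D C≢A → •-congˡ (e C D) (cong (ℤ._* basis B D) (basis-no A C (C≢A ∘ sym))))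
        (λ D D≢B → •-congˡ (e A D)
          (trans (cong (basis A A ℤ.*_) (basis-no B D (D≢B ∘ sym))) (ℤ.*-zeroʳ (basis A A)))))
      (∼-trans (•-congˡ (e A B) (cong₂ ℤ._*_ (basis-yes A) (basis-yes B))) (1• (e A B)))

  module _ (p q : Pairing τ) (x y : Pairing.ℤS (_⊕_ τ p q)) where
    private
      module p = Pairing p
      module q = Pairing q
      x₁ = x ∘ Maybe.map inj₁
      y₁ = y ∘ Maybe.map inj₁
      x₂ = x ∘ Maybe.map inj₂
      y₂ = y ∘ Maybe.map inj₂
      T = Form.term (_⊕_ τ p q) x y
      T₁ = Form.term p x₁ y₁
      T₂ = Form.term q x₂ y₂

    -- Both restrictions keep the coordinate at `s`. The mixed blocks of the sum vanish, and the
    -- single entry at (s, s) can be shared out because it is the sum of the two corresponding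
    -- entries.
    ẽ-⊕ : Pairing.ẽ (_⊕_ τ p q) x y ≋ p.ẽ x₁ y₁ ⊹ q.ẽ x₂ y₂
    ẽ-⊕ = ∑ᴹ-⊎ p.letters q.letters (λ A → ∑ᴹ (p.letters ⊎ᶠ q.letters) (T A)) (λ A → ∑ᴹ p.letters (T₁ A)) (λ A → ∑ᴹ q.letters (T₂ A))
      (∑ᴹ-⊎ p.letters q.letters (T nothing) (T₁ nothing) (T₂ nothing)
        (•-distrib-⊹ (x nothing ℤ.* y nothing) _ _) (λ _ → ∼-refl) (λ _ → ∼-refl))
      (λ A → ∼-trans
        (∑ᴹ-⊎ p.letters q.letters (T (just (inj₁ A))) (T₁ (just A)) (λ _ → 𝟘)
          (∼-sym (π.identityʳ _)) (λ _ → ∼-refl)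
          (λ B → •-𝟘 (x (just (inj₁ A)) ℤ.* y (just (inj₂ B)))))
        (∼-trans (⊹-cong ∼-refl (∑ᴹ-𝟘 q.letters (λ _ → 𝟘) λ _ → ∼-refl)) (π.identityʳ _)))
      (λ A → ∼-trans
        (∑ᴹ-⊎ p.letters q.letters (T (just (inj₂ A))) (λ _ → 𝟘) (T₂ (just A))
          (∼-sym (identityˡ _))
          (λ B → •-𝟘 (x (just (inj₂ A)) ℤ.* y (just (inj₁ B)))) (λ _ → ∼-refl))
        (∼-trans (⊹-cong (∑ᴹ-𝟘 p.letters (λ _ → 𝟘) λ _ → ∼-refl) ∼-refl) (identityˡ _)))

  ẽ-⁻ : ∀ p x y → Pairing.ẽ (_⁻ᵖ τ p) x y ≋ ⊖ Pairing.ẽ p x y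
  ẽ-⁻ p x y = ∼-trans
    (∑∑-cong (Form.term (_⁻ᵖ τ p) x y) (λ A B → ⊖ Form.term p x y A B)
      λ A B → •-⊖ (x A ℤ.* y B) _)
    (∑∑-⊖ (Form.term p x y))
    where open DoubleSum (Pairing.letters p)

-- Signed matchings

private
  variable
    X Y : Set

-- With `Maybe.≡-dec` as its argument this is definitionally the vector `basis` of a pairing, so
-- that matchings and fillings share their vectors.
δ : DecidableEquality X → X → X → ℤ
δ _≟_ x u = if does (x ≟ u) then 1ℤ else 0ℤ

δ-refl : (_≟_ : DecidableEquality X) → ∀ x → δ _≟_ x x ≡ 1ℤ
δ-refl _≟_ x = cong (λ b → if b then 1ℤ else 0ℤ) (dec-true (x ≟ x) refl)

δ-≢ : (_≟_ : DecidableEquality X) → ∀ {x u} → x ≢ u → δ _≟_ x u ≡ 0ℤ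
δ-≢ _≟_ {x} {u} x≢u = cong (λ b → if b then 1ℤ else 0ℤ) (dec-false (x ≟ u) x≢u)

δ-cong : (_≟_ : DecidableEquality X) (_≟′_ : DecidableEquality Y) → ∀ {x u x′ u′} →
         (x ≡ u → x′ ≡ u′) → (x′ ≡ u′ → x ≡ u) → δ _≟_ x u ≡ δ _≟′_ x′ u′
δ-cong _≟_ _≟′_ {x} {u} to from with x ≟ u
... | yes x≡u = sym (trans (cong (λ v → δ _≟′_ v _) (to x≡u)) (δ-refl _≟′_ _))
... | no  x≢u = sym (δ-≢ _≟′_ (x≢u ∘ from))

record IsSubgroup (G : (X → ℤ) → Set) : Set where
  field
    resp : ∀ {x y} → x ≗ y → G x → G y
    null : G (λ _ → 0ℤ)
    add  : ∀ {x y} → G x → G y → G (λ u → x u ℤ.+ y u)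
    neg  : ∀ {x} → G x → G (λ u → ℤ.- x u)

preimage-subgroup : ∀ {G : (X → ℤ) → Set} → IsSubgroup G → (f : X → Y) →
                    IsSubgroup (λ (y : Y → ℤ) → G (y ∘ f))
preimage-subgroup sub f = record
  { resp = λ eq → resp (λ u → eq (f u)) ; null = null ; add = add ; neg = neg }
  where open IsSubgroup sub

product-subgroup : ∀ {G : (X → ℤ) → Set} {H : (Y → ℤ) → Set} → IsSubgroup G → IsSubgroup H →
                   IsSubgroup (λ (z : X ⊎ Y → ℤ) → G (z ∘ inj₁) × H (z ∘ inj₂))
product-subgroup subG subH = record
  { resp = λ eq (Gz , Hz) → G.resp (λ u → eq (inj₁ u)) Gz , H.resp (λ u → eq (inj₂ u)) Hz
  ; null = G.null , H.null
  ; add  = λ (Gx , Hx) (Gy , Hy) → G.add Gx Gy , H.add Hx Hy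
  ; neg  = λ (Gz , Hz) → G.neg Gz , H.neg Hz
  }
  where
  module G = IsSubgroup subG
  module H = IsSubgroup subH

scale : Sign → ℤ → ℤ
scale Sign.+ k = k
scale Sign.- k = ℤ.- k

scale-subgroup : ∀ {G : (X → ℤ) → Set} → IsSubgroup G → ∀ s {x} → G x → G (scale s ∘ x)
scale-subgroup sub Sign.+ Gx = Gx
scale-subgroup sub Sign.- Gx = IsSubgroup.neg sub Gx

scale-0 : ∀ s → scale s 0ℤ ≡ 0ℤ
scale-0 Sign.+ = refl
scale-0 Sign.- = refl

scale-* : ∀ s t k → scale s (scale t k) ≡ scale (s Sign.* t) k
scale-* Sign.+ t      k = refl
scale-* Sign.- Sign.+ k = refl
scale-* Sign.- Sign.- k = ℤ.neg-involutive k

scale-1≢0 : ∀ s → scale s 1ℤ ≢ 0ℤ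
scale-1≢0 Sign.+ ()
scale-1≢0 Sign.- ()

-- The fillings of a pairing, seen as involutions on its letters: a letter is
-- matched to the other letter of the vector in which it occurs, if there is one.
module Matchings {a} {α : Set a} (τ : α → α) (τ-involutive : Involutive _≡_ τ) where

  act : Sign → α → α
  act Sign.+ c = c
  act Sign.- c = τ c

  act-* : ∀ s t c → act s (act t c) ≡ act (s Sign.* t) c
  act-* Sign.+ t      c = refl
  act-* Sign.- Sign.+ c = refl
  act-* Sign.- Sign.- c = τ-involutive c

  act-flip : ∀ s {b c} → b ≡ act s c → c ≡ act s b
  act-flip Sign.+ refl = refl
  act-flip Sign.- refl = sym (τ-involutive _)

  vec : DecidableEquality X → X → Maybe (Sign × X) → X → ℤ
  vec _≟_ x nothing        u = δ _≟_ x u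
  vec _≟_ x (just (s , y)) u = δ _≟_ x u ℤ.+ scale s (δ _≟_ y u)

  Touches : X → X → Maybe (Sign × X) → Set
  Touches x u r = x ≡ u ⊎ ∃[ s ] r ≡ just (s , u)

  touches : (_≟_ : DecidableEquality X) → ∀ x u r → vec _≟_ x r u ≢ 0ℤ → Touches x u r
  touches _≟_ x u nothing        ≢0 with x ≟ u
  ... | yes x≡u = inj₁ x≡u
  ... | no  x≢u = contradiction refl ≢0
  touches _≟_ x u (just (s , y)) ≢0 with x ≟ u | y ≟ u
  ... | yes x≡u | _        = inj₁ x≡u
  ... | no  x≢u | yes refl = inj₂ (s , refl)
  ... | no  x≢u | no  y≢u  = contradiction (trans (ℤ.+-identityˡ (scale s 0ℤ)) (scale-0 s)) ≢0

  touched : (_≟_ : DecidableEquality X) → ∀ {x u r} → (∀ {s y} → r ≡ just (s , y) → x ≢ y) →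
            Touches x u r → vec _≟_ x r u ≢ 0ℤ
  touched _≟_ {x} {r = nothing} distinct (inj₁ refl) ≡0 rewrite δ-refl _≟_ x = case ≡0 of λ ()
  touched _≟_ {x} {r = just (s , y)} distinct (inj₁ refl) ≡0
    rewrite δ-refl _≟_ x | δ-≢ _≟_ (distinct refl ∘ sym) | scale-0 s = case ≡0 of λ ()
  touched _≟_ {x} {u} distinct (inj₂ (s , refl)) ≡0
    rewrite δ-refl _≟_ u | δ-≢ _≟_ (distinct refl) | ℤ.+-identityˡ (scale s 1ℤ) =
    scale-1≢0 s ≡0

  -- A vector x + s y is stored at both of its letters: at y it appears as y + s x, which is s times
  -- the vector at x. This keeps the conditions symmetric; one representative is selected only when
  -- a filling is built. The sign + stands for the short vectors with equal labels, the sign - for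
  -- those whose labels are exchanged by `τ`.
  record Matching {X : Set} (_≟_ : DecidableEquality X) (label : X → α)
                  (G : (X → ℤ) → Set) : Set a where
    field
      partner    : X → Maybe (Sign × X)
      symmetric  : ∀ {x s y} → partner x ≡ just (s , y) → partner y ≡ just (s , x)
      distinct   : ∀ {x s y} → partner x ≡ just (s , y) → x ≢ y
      compatible : ∀ {x s y} → partner x ≡ just (s , y) → label x ≡ act s (label y)
      member     : ∀ x → G (vec _≟_ x (partner x))

  module _ {_≟_ : DecidableEquality X} {label label′ : X → α} {G H : (X → ℤ) → Set} where

    adapt : label′ ≗ label → (∀ {x} → G x → H x) →
            Matching _≟_ label G → Matching _≟_ label′ H
    adapt label≗ G⊆H m = record
      { Matching m
      ; compatible = λ {x} {s} {y} eq →
          trans (label≗ x) (trans (compatible eq) (cong (act s) (sym (label≗ y))))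
      ; member = λ x → G⊆H (member x)
      }
      where open Matching m

  module _ {_≟_ : DecidableEquality X} {_≟′_ : DecidableEquality Y} {label : X → α}
           {G : (X → ℤ) → Set} (sub : IsSubgroup G) (σ : X ↔ Y) where
    open Inverse σ using (to; from)

    private
      from∘to : ∀ x → from (to x) ≡ x
      from∘to x = Inverse.inverseʳ σ refl
      to∘from : ∀ y → to (from y) ≡ y
      to∘from y = Inverse.inverseˡ σ refl

      move : Maybe (Sign × X) → Maybe (Sign × Y)
      move = Maybe.map (map₂ to)

      move-just : ∀ r {s y} → move r ≡ just (s , y) → r ≡ just (s , from y)
      move-just (just (s , x)) refl = cong (λ x → just (s , x)) (sym (from∘to x))

    transport : Matching _≟_ label G → Matching _≟′_ (label ∘ from) (λ x → G (x ∘ to))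
    transport m = record
      { partner    = λ y → move (partner (from y))
      ; symmetric  = λ {x} {s} eq → trans (cong move (symmetric (move-just _ eq)))
          (cong (λ v → just (s , v)) (to∘from x))
      ; distinct   = λ eq x≡y → distinct (move-just _ eq) (cong from x≡y)
      ; compatible = λ eq → compatible (move-just _ eq)
      ; member     = λ y → IsSubgroup.resp sub (vec-move y (partner (from y))) (member (from y))
      }
      where
      open Matching m
      δ-move : ∀ y u → δ _≟_ (from y) u ≡ δ _≟′_ y (to u)
      δ-move y u = δ-cong _≟_ _≟′_
        (λ { refl → sym (to∘from y) }) (λ { refl → from∘to u })
      vec-move : ∀ y r → vec _≟_ (from y) r ≗ vec _≟′_ y (move r) ∘ to
      vec-move y nothing        u = δ-move y u
      vec-move y (just (s , x)) u = cong₂ (λ k l → k ℤ.+ scale s l) (δ-move y u)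
        (trans (cong (λ x → δ _≟_ x u) (sym (from∘to x))) (δ-move (to x) u))

  module _ {_≟₁_ : DecidableEquality X} {_≟₂_ : DecidableEquality Y}
           {label₁ : X → α} {label₂ : Y → α}
           {G : (X → ℤ) → Set} {H : (Y → ℤ) → Set}
           (subG : IsSubgroup G) (subH : IsSubgroup H) where

    private
      in₁ : Maybe (Sign × X) → Maybe (Sign × (X ⊎ Y))
      in₁ = Maybe.map (map₂ inj₁)
      in₂ : Maybe (Sign × Y) → Maybe (Sign × (X ⊎ Y))
      in₂ = Maybe.map (map₂ inj₂)

      in₁-just : ∀ r {s z} → in₁ r ≡ just (s , z) → ∃[ x ] (r ≡ just (s , x) × z ≡ inj₁ x)
      in₁-just (just (s , x)) refl = x , refl , refl
      in₂-just : ∀ r {s z} → in₂ r ≡ just (s , z) → ∃[ x ] (r ≡ just (s , x) × z ≡ inj₂ x)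
      in₂-just (just (s , x)) refl = x , refl , refl

    disjointUnion : Matching _≟₁_ label₁ G → Matching _≟₂_ label₂ H →
      Matching (Sum.≡-dec _≟₁_ _≟₂_) [ label₁ , label₂ ]′ (λ x → G (x ∘ inj₁) × H (x ∘ inj₂))
    disjointUnion m₁ m₂ = record
      { partner    = partner
      ; symmetric  = λ {x} → symmetric x
      ; distinct   = λ {x} → distinct x
      ; compatible = λ {x} → compatible x
      ; member     = member
      }
      where
      module m₁ = Matching m₁
      module m₂ = Matching m₂
      partner : X ⊎ Y → Maybe (Sign × (X ⊎ Y))
      partner (inj₁ x) = in₁ (m₁.partner x)
      partner (inj₂ y) = in₂ (m₂.partner y)
      symmetric : ∀ x {s y} → partner x ≡ just (s , y) → partner y ≡ just (s , x)
      symmetric (inj₁ x) eq with in₁-just (m₁.partner x) eq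
      ... | y , eq′ , refl = cong in₁ (m₁.symmetric eq′)
      symmetric (inj₂ x) eq with in₂-just (m₂.partner x) eq
      ... | y , eq′ , refl = cong in₂ (m₂.symmetric eq′)
      distinct : ∀ x {s y} → partner x ≡ just (s , y) → x ≢ y
      distinct (inj₁ x) eq refl with in₁-just (m₁.partner x) eq
      ... | y , eq′ , refl = m₁.distinct eq′ refl
      distinct (inj₂ x) eq refl with in₂-just (m₂.partner x) eq
      ... | y , eq′ , refl = m₂.distinct eq′ refl
      compatible : ∀ x {s y} → partner x ≡ just (s , y) →
                   [ label₁ , label₂ ]′ x ≡ act s ([ label₁ , label₂ ]′ y)
      compatible (inj₁ x) eq with in₁-just (m₁.partner x) eq
      ... | y , eq′ , refl = m₁.compatible eq′
      compatible (inj₂ x) eq with in₂-just (m₂.partner x) eq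
      ... | y , eq′ , refl = m₂.compatible eq′
      _≟_ = Sum.≡-dec _≟₁_ _≟₂_
      vec-11 : ∀ x r → vec _≟₁_ x r ≗ vec _≟_ (inj₁ x) (in₁ r) ∘ inj₁
      vec-11 x nothing        u = refl
      vec-11 x (just (s , y)) u = refl
      vec-12 : ∀ x r u → 0ℤ ≡ vec _≟_ (inj₁ x) (in₁ r) (inj₂ u)
      vec-12 x nothing        u = refl
      vec-12 x (just (s , y)) u = sym (trans (ℤ.+-identityˡ _) (scale-0 s))
      vec-22 : ∀ x r → vec _≟₂_ x r ≗ vec _≟_ (inj₂ x) (in₂ r) ∘ inj₂
      vec-22 x nothing        u = refl
      vec-22 x (just (s , y)) u = refl
      vec-21 : ∀ x r u → 0ℤ ≡ vec _≟_ (inj₂ x) (in₂ r) (inj₁ u)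
      vec-21 x nothing        u = refl
      vec-21 x (just (s , y)) u = sym (trans (ℤ.+-identityˡ _) (scale-0 s))
      member : ∀ x → G (vec _≟_ x (partner x) ∘ inj₁) × H (vec _≟_ x (partner x) ∘ inj₂)
      member (inj₁ x) = IsSubgroup.resp subG (vec-11 x (m₁.partner x)) (m₁.member x) ,
                        IsSubgroup.resp subH (vec-12 x (m₁.partner x)) (IsSubgroup.null subH)
      member (inj₂ x) = IsSubgroup.resp subG (vec-21 x (m₂.partner x)) (IsSubgroup.null subG) ,
                        IsSubgroup.resp subH (vec-22 x (m₂.partner x)) (m₂.member x)

  -- The vectors on Y obtained by identifying the two additional coordinates.
  Glued : ((Maybe (Maybe Y) → ℤ) → Set) → (Y → ℤ) → Set
  Glued G y = ∃[ x ] G x × x nothing ≡ x (just nothing) × x ∘ just ∘ just ≗ y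

  Glued-subgroup : ∀ {G : (Maybe (Maybe Y) → ℤ) → Set} → IsSubgroup G → IsSubgroup (Glued G)
  Glued-subgroup sub = record
    { resp = λ eq (x , Gx , glue , x≗) → x , Gx , glue , λ u → trans (x≗ u) (eq u)
    ; null = _ , null , refl , λ _ → refl
    ; add  = λ (_ , Gx , gluex , x≗) (_ , Gy , gluey , y≗) →
               _ , add Gx Gy , cong₂ ℤ._+_ gluex gluey , λ u → cong₂ ℤ._+_ (x≗ u) (y≗ u)
    ; neg  = λ (_ , Gx , gluex , x≗) → _ , neg Gx , cong ℤ.-_ gluex , λ u → cong ℤ.-_ (x≗ u)
    }
    where open IsSubgroup sub

  module _ {_≟_ : DecidableEquality Y} {label : Maybe (Maybe Y) → α}
           {G : (Maybe (Maybe Y) → ℤ) → Set} (sub : IsSubgroup G)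
           (label≡ : label nothing ≡ label (just nothing)) where
    private
      L = Maybe (Maybe Y)
      _≟ᴸ_ = Maybe.≡-dec (Maybe.≡-dec _≟_)
      pattern z₀ = nothing
      pattern z₁ = just nothing
      pattern old y = just (just y)

    -- If y and y′ are matched to the two glued coordinates, they become partners.
    eliminate : Matching _≟ᴸ_ label G → Matching _≟_ (λ y → label (old y)) (Glued G)
    eliminate m = record
      { partner    = λ y → route (partner (old y))
      ; symmetric  = λ {y} eq → symmetric′ (partner (old y)) refl eq
      ; distinct   = λ {y} eq → distinct′ (partner (old y)) refl eq
      ; compatible = λ {y} eq → compatible′ (partner (old y)) refl eq
      ; member     = λ y → member′ (partner (old y)) refl
      }
      where
      open Matching m
      via : Sign → Maybe (Sign × L) → Maybe (Sign × Y)
      via s (just (t , old y)) = just (s Sign.* t , y)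
      -- The other glued coordinate is unmatched, so no new partner arises. The remaining
      -- possibilities, a partner among the glued coordinates themselves, are refuted in `member′`.
      via s _                  = nothing
      route : Maybe (Sign × L) → Maybe (Sign × Y)
      route nothing            = nothing
      route (just (s , old y)) = just (s , y)
      route (just (s , z₀))    = via s (partner z₁)
      route (just (s , z₁))    = via s (partner z₀)

      via-just : ∀ s r {t y} → via s r ≡ just (t , y) →
                 ∃[ t′ ] (r ≡ just (t′ , old y) × t ≡ s Sign.* t′)
      via-just s (just (t′ , old y)) refl = t′ , refl , refl

      symmetric′ : ∀ {y} r → partner (old y) ≡ r → ∀ {s y′} → route r ≡ just (s , y′) →
                   route (partner (old y′)) ≡ just (s , y)
      symmetric′ (just (s , old y)) eq refl = cong route (symmetric eq)
      symmetric′ (just (s , z₀)) eq eq′ with via-just s (partner z₁) eq′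
      ... | t , eq₁ , refl = trans (cong route (symmetric eq₁))
        (trans (cong (via t) (symmetric eq)) (cong (λ s → just (s , _)) (Sign.*-comm t s)))
      symmetric′ (just (s , z₁)) eq eq′ with via-just s (partner z₀) eq′
      ... | t , eq₁ , refl = trans (cong route (symmetric eq₁))
        (trans (cong (via t) (symmetric eq)) (cong (λ s → just (s , _)) (Sign.*-comm t s)))

      distinct′ : ∀ {y} r → partner (old y) ≡ r → ∀ {s y′} → route r ≡ just (s , y′) → y ≢ y′
      distinct′ (just (s , old y)) eq refl refl = distinct eq refl
      distinct′ (just (s , z₀)) eq eq′ refl with via-just s (partner z₁) eq′
      ... | t , eq₁ , refl = case trans (sym eq) (symmetric eq₁) of λ ()
      distinct′ (just (s , z₁)) eq eq′ refl with via-just s (partner z₀) eq′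
      ... | t , eq₁ , refl = case trans (sym eq) (symmetric eq₁) of λ ()

      compatible′ : ∀ {y} r → partner (old y) ≡ r → ∀ {s y′} → route r ≡ just (s , y′) →
                    label (old y) ≡ act s (label (old y′))
      compatible′ (just (s , old y)) eq refl = compatible eq
      compatible′ (just (s , z₀)) eq eq′ with via-just s (partner z₁) eq′
      ... | t , eq₁ , refl = trans (compatible eq) (trans
        (cong (act s) (trans label≡ (compatible eq₁))) (act-* s t _))
      compatible′ (just (s , z₁)) eq eq′ with via-just s (partner z₀) eq′
      ... | t , eq₁ , refl = trans (compatible eq) (trans
        (cong (act s) (trans (sym label≡) (compatible eq₁))) (act-* s t _))

      member-at : ∀ x {r} → partner x ≡ r → G (vec _≟ᴸ_ x r)
      member-at x eq = subst (λ r → G (vec _≟ᴸ_ x r)) eq (member x)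

      open IsSubgroup sub

      -- Used with s the coefficient of one glued coordinate in the first vector. In the second
      -- vector the other glued coordinate has coefficient 1, so after scaling both coordinates of
      -- the sum are s, as `Glued` demands.
      sum-at : ∀ {x x′ r r′} s → partner x ≡ r → partner x′ ≡ r′ →
               G (λ u → vec _≟ᴸ_ x r u ℤ.+ scale s (vec _≟ᴸ_ x′ r′ u))
      sum-at s eq eq′ = add (member-at _ eq) (scale-subgroup sub s (member-at _ eq′))

      simplify₁ : ∀ s k → k ℤ.+ scale s 0ℤ ℤ.+ scale s 0ℤ ≡ k
      simplify₁ s k rewrite scale-0 s = trans (ℤ.+-identityʳ _) (ℤ.+-identityʳ k)

      simplify₂ : ∀ s t k l →
        k ℤ.+ scale s 0ℤ ℤ.+ scale s (0ℤ ℤ.+ scale t l) ≡ k ℤ.+ scale (s Sign.* t) l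
      simplify₂ s t k l rewrite scale-0 s | ℤ.+-identityʳ k | ℤ.+-identityˡ (scale t l) =
        cong (λ l → k ℤ.+ l) (scale-* s t l)

      glue₁ : ∀ s → 0ℤ ℤ.+ scale s 1ℤ ℤ.+ scale s 0ℤ ≡ 0ℤ ℤ.+ scale s 0ℤ ℤ.+ scale s 1ℤ
      glue₁ Sign.+ = refl
      glue₁ Sign.- = refl

      glue₂ : ∀ s t → 0ℤ ℤ.+ scale s 1ℤ ℤ.+ scale s (0ℤ ℤ.+ scale t 0ℤ) ≡
                      0ℤ ℤ.+ scale s 0ℤ ℤ.+ scale s (1ℤ ℤ.+ scale t 0ℤ)
      glue₂ s t rewrite scale-0 t = glue₁ s

      member′ : ∀ {y} r → partner (old y) ≡ r → Glued G (vec _≟_ y (route r))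
      member′ nothing            eq = _ , member-at _ eq , refl , λ _ → refl
      member′ (just (s , old y)) eq = _ , member-at _ eq , refl , λ _ → refl
      member′ (just (s , z₀)) eq with partner z₁ in eq₁
      ... | nothing          = _ , sum-at s eq eq₁ , glue₁ s , λ u → simplify₁ s _
      ... | just (t , old y) = _ , sum-at s eq eq₁ , glue₂ s t , λ u → simplify₂ s t (δ _≟_ _ u) (δ _≟_ y u)
      ... | just (t , z₀)    = case trans (sym (symmetric eq₁)) (symmetric eq) of λ ()
      ... | just (t , z₁)    = contradiction refl (distinct eq₁)
      member′ (just (s , z₁)) eq with partner z₀ in eq₁
      ... | nothing          = _ , sum-at s eq eq₁ , sym (glue₁ s) , λ u → simplify₁ s _
      ... | just (t , old y) = _ , sum-at s eq eq₁ , sym (glue₂ s t) , λ u → simplify₂ s t (δ _≟_ _ u) (δ _≟_ y u)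
      ... | just (t , z₀)    = contradiction refl (distinct eq₁)
      ... | just (t , z₁)    = case trans (sym (symmetric eq₁)) (symmetric eq) of λ ()

  private
    Twice : Set → ℕ → Set
    Twice X n = X ⊎ (Fin n ⊎ Fin n)

    peel : ∀ X n → Twice X (suc n) ↔ Maybe (Maybe (Twice X n))
    peel X n = mk↔ₛ′ to from to∘from from∘to
      where
      to : Twice X (suc n) → Maybe (Maybe (Twice X n))
      to (inj₁ x)              = just (just (inj₁ x))
      to (inj₂ (inj₁ zero))    = nothing
      to (inj₂ (inj₂ zero))    = just nothing
      to (inj₂ (inj₁ (suc i))) = just (just (inj₂ (inj₁ i)))
      to (inj₂ (inj₂ (suc i))) = just (just (inj₂ (inj₂ i)))
      from : Maybe (Maybe (Twice X n)) → Twice X (suc n)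
      from nothing                       = inj₂ (inj₁ zero)
      from (just nothing)                = inj₂ (inj₂ zero)
      from (just (just (inj₁ x)))        = inj₁ x
      from (just (just (inj₂ (inj₁ i)))) = inj₂ (inj₁ (suc i))
      from (just (just (inj₂ (inj₂ i)))) = inj₂ (inj₂ (suc i))
      to∘from : ∀ x → to (from x) ≡ x
      to∘from nothing                       = refl
      to∘from (just nothing)                = refl
      to∘from (just (just (inj₁ x)))        = refl
      to∘from (just (just (inj₂ (inj₁ i)))) = refl
      to∘from (just (just (inj₂ (inj₂ i)))) = refl
      from∘to : ∀ x → from (to x) ≡ x
      from∘to (inj₁ x)              = refl
      from∘to (inj₂ (inj₁ zero))    = refl
      from∘to (inj₂ (inj₂ zero))    = refl
      from∘to (inj₂ (inj₁ (suc i))) = refl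
      from∘to (inj₂ (inj₂ (suc i))) = refl

    peel₀ : ∀ X → Twice X 0 ↔ X
    peel₀ X = mk↔ₛ′ (λ { (inj₁ x) → x ; (inj₂ (inj₁ ())) ; (inj₂ (inj₂ ())) }) inj₁ (λ _ → refl)
                    (λ { (inj₁ x) → refl ; (inj₂ (inj₁ ())) ; (inj₂ (inj₂ ())) })

  -- Induction on the number of glued pairs; each round peels one coordinate off either block. The
  -- nested conditions left by successive gluings are flattened into a single vector with equal
  -- values on the two blocks. `transport` also exchanges decision procedures, which is why the two
  -- given here may be arbitrary.
  eliminateAll : ∀ n {_≟_ : DecidableEquality X} {_≟′_ : DecidableEquality (X ⊎ (Fin n ⊎ Fin n))}
    {label : X ⊎ (Fin n ⊎ Fin n) → α} {G : (X ⊎ (Fin n ⊎ Fin n) → ℤ) → Set} → IsSubgroup G →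
    (∀ i → label (inj₂ (inj₁ i)) ≡ label (inj₂ (inj₂ i))) → Matching _≟′_ label G →
    Matching _≟_ (label ∘ inj₁)
      (λ y → ∃[ x ] G x × (∀ i → x (inj₂ (inj₁ i)) ≡ x (inj₂ (inj₂ i))) × x ∘ inj₁ ≗ y)
  eliminateAll {X = X} zero {_≟_ = _≟_} {label = label} {G} sub label≡ m =
    adapt (λ _ → refl) (λ Gx → _ , Gx , (λ ()) , λ _ → refl)
      (transport {_≟′_ = _≟_} sub (peel₀ X) m)
  eliminateAll {X = X} (suc n) {_≟_} {label = label} {G} sub label≡ m =
    adapt (λ _ → refl)
      (λ { (x , (x′ , Gx′ , glue , x′≗x) , glues , x≗y) →
        _ , Gx′ ,
        (λ { zero    → glue
           ; (suc i) → trans (x′≗x _) (trans (glues i) (sym (x′≗x _))) }) ,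
        λ u → trans (x′≗x _) (x≗y u) })
      (eliminateAll n {_≟′_ = ≟ₙ} (Glued-subgroup sub′) (λ i → label≡ (suc i))
        (eliminate {_≟_ = ≟ₙ} sub′ (label≡ zero) (transport sub (peel X n) m)))
    where
    ≟ₙ : DecidableEquality (X ⊎ (Fin n ⊎ Fin n))
    ≟ₙ = Sum.≡-dec _≟_ (Sum.≡-dec Fin._≟_ Fin._≟_)
    sub′ = preimage-subgroup sub (Inverse.to (peel X n))

-- Bordisms of pairings

extend : (X → ℤ) → Maybe X → ℤ
extend x nothing  = 0ℤ
extend x (just u) = x u

extend-subgroup : {L : (Maybe X → ℤ) → Set} → IsSubgroup L → IsSubgroup (L ∘ extend)
extend-subgroup sub = record
  { resp = λ eq → resp λ { nothing → refl ; (just u) → eq u }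
  ; null = resp (λ { nothing → refl ; (just u) → refl }) null
  ; add  = λ Lx Ly → resp (λ { nothing → refl ; (just u) → refl }) (add Lx Ly)
  ; neg  = λ Lx → resp (λ { nothing → refl ; (just u) → refl }) (neg Lx)
  }
  where open IsSubgroup sub

enumerateSubset : ∀ {n} (P : Fin n → Set) → (∀ i → Dec (P i)) →
  ∃[ k ] Σ[ f ∈ (Fin k → Fin n) ]
    Injective _≡_ _≡_ f × (∀ i → P (f i)) × (∀ j → P j → ∃[ i ] f i ≡ j)
enumerateSubset {zero}  P P? = 0 , (λ ()) , (λ { {()} }) , (λ ()) , λ ()
enumerateSubset {suc n} P P? with P? zero | enumerateSubset (P ∘ suc) (P? ∘ suc)
... | no ¬p | k , f , inj , Pf , surj =
  k , suc ∘ f , inj ∘ Fin.suc-injective , Pf ,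
  λ { zero p → contradiction p ¬p ; (suc j) p → map₂ (cong suc) (surj j p) }
... | yes p | k , f , inj , Pf , surj = suc k , f′ , inj′ , Pf′ , surj′
  where
  f′ : Fin (suc k) → Fin (suc n)
  f′ zero    = zero
  f′ (suc i) = suc (f i)
  inj′ : Injective _≡_ _≡_ f′
  inj′ {zero}  {zero}  eq = refl
  inj′ {suc i} {suc j} eq = cong suc (inj (Fin.suc-injective eq))
  Pf′ : ∀ i → P (f′ i)
  Pf′ zero    = p
  Pf′ (suc i) = Pf i
  surj′ : ∀ j → P j → ∃[ i ] f′ i ≡ j
  surj′ zero    p = zero , refl
  surj′ (suc j) p = let i , eq = surj j p in suc i , cong suc eq

module Bordisms {a} {α : Set a} (τ : α → α) (τ-involutive : Involutive _≡_ τ) where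
  open Coefficients τ
  open Matchings τ τ-involutive

  open import Relation.Binary.Reasoning.Setoid π.setoid

  module Pair (p q : Pairing τ) where
    private
      module p = Pairing p
      module q = Pairing q
    open Alphabet (p.S° ⊎ᵃ q.S°) public

    _≟ᴹ_ : DecidableEquality (Maybe Letter)
    _≟ᴹ_ = Maybe.≡-dec _≟_

  module _ (p q : Pairing τ) where
    private
      module p = Pairing p
      module q = Pairing q
    open Pair p q

    -- A matching of the letters of p ⊕ q⁻ whose vectors lie in a subgroup on
    -- which the forms of p and q agree.
    record Bordism : Set (sucℓ 0ℓ ⊔ a) where
      field
        L        : (Maybe Letter → ℤ) → Set
        subgroup : IsSubgroup L
        base     : L (δ _≟ᴹ_ nothing)
        agree    : ∀ {x y} → L x → L y →
                   p.ẽ (x ∘ Maybe.map inj₁) (y ∘ Maybe.map inj₁) ≋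
                   q.ẽ (x ∘ Maybe.map inj₂) (y ∘ Maybe.map inj₂)
        matching : Matching _≟_ ∣_∣ (L ∘ extend)

  module _ {p q : Pairing τ} (b : Bordism p q) where
    private
      module p = Pairing p
      module q = Pairing q
    open Bordism b
    open Matching matching
    open Pair p q

    private
      p⊕q⁻ = _⊕_ τ p (_⁻ᵖ τ q)
      module p⊕q⁻ = Pairing p⊕q⁻
      open p⊕q⁻ using (Short; single; plus; minus; Filling)

      index : Letter → Fin size
      index = Inverse.to enumeration

      letter : Fin size → Letter
      letter = Inverse.from enumeration

      letter-index : ∀ A → letter (index A) ≡ A
      letter-index A = Inverse.inverseʳ enumeration refl

      index-letter : ∀ i → index (letter i) ≡ i
      index-letter i = Inverse.inverseˡ enumeration refl

      index-injective : ∀ {A B} → index A ≡ index B → A ≡ B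
      index-injective eq = trans (sym (letter-index _)) (trans (cong letter eq) (letter-index _))

      -- Of two matched letters the one with the smaller index represents their vector; an unmatched
      -- letter represents its own. The partner is a separate argument so that it can be replaced
      -- along an equation.
      data Chosen (A : Letter) : Maybe (Sign × Letter) → Set where
        alone : Chosen A nothing
        first : ∀ {s B} → index A Fin.< index B → Chosen A (just (s , B))

      chosen? : ∀ A r → Dec (Chosen A r)
      chosen? A nothing = yes alone
      chosen? A (just (s , B)) with index A Fin.<? index B
      ... | yes A<B = yes (first A<B)
      ... | no  A≮B = no λ { (first A<B) → A≮B A<B }

      isChosen : Letter → Set
      isChosen A = Chosen A (partner A)

      vector : Letter → Maybe Letter → ℤ
      vector A = extend (vec _≟_ A (partner A))

      short : ∀ A r → partner A ≡ r → Short (extend (vec _≟_ A r))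
      short A nothing           eq = single A λ { nothing → refl ; (just u) → refl }
      short A (just (Sign.+ , B)) eq = plus A B (distinct eq) (compatible eq)
        λ { nothing → refl ; (just u) → refl }
      short A (just (Sign.- , B)) eq = minus A B (distinct eq) (compatible eq)
        λ { nothing → refl ; (just u) → refl }

      choose : ∀ B r → partner B ≡ r → ∃[ A ] isChosen A × Touches A B (partner A)
      choose B nothing        eq = B , subst (Chosen B) (sym eq) alone , inj₁ refl
      choose B (just (s , C)) eq with index B Fin.<? index C
      ... | yes B<C = B , subst (Chosen B) (sym eq) (first B<C) , inj₁ refl
      ... | no  B≮C = C , subst (Chosen C) (sym (symmetric eq)) (first C<B) , inj₂ (s , symmetric eq)
        where C<B = Fin.≤∧≢⇒< (ℕ.≮⇒≥ B≮C) (distinct eq ∘ sym ∘ index-injective)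

      first-or-alone : ∀ {A s B} → Chosen A (just (s , B)) → index A Fin.< index B
      first-or-alone (first A<B) = A<B

      chosen-unique : ∀ {A A′ B} → isChosen A → isChosen A′ →
                      Touches A B (partner A) → Touches A′ B (partner A′) → A ≡ A′
      chosen-unique c c′ (inj₁ refl)     (inj₁ refl)      = refl
      chosen-unique {A′ = A′} c c′ (inj₁ refl) (inj₂ (s , eq)) = contradiction
        (first-or-alone (subst (Chosen A′) eq c′))
        (Fin.<-asym (first-or-alone (subst (Chosen _) (symmetric eq) c)))
      chosen-unique {A} c c′ (inj₂ (s , eq)) (inj₁ refl) = contradiction
        (first-or-alone (subst (Chosen A) eq c))
        (Fin.<-asym (first-or-alone (subst (Chosen _) (symmetric eq) c′)))
      chosen-unique c c′ (inj₂ (s , eq)) (inj₂ (s′ , eq′)) =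
        cong proj₂ (Maybe.just-injective (trans (sym (symmetric eq)) (symmetric eq′)))

    -- On `L` the form of p ⊕ q⁻ is the difference of two equal values, so all vectors of the
    -- matching annihilate each other and `s`. Taking the chosen letters only makes every letter
    -- occur in exactly one vector.
    hyperbolic : Cobordantᵖ τ p q
    hyperbolic with enumerateSubset (isChosen ∘ letter) (λ i → chosen? (letter i) (partner (letter i)))
    ... | k , f , inj , chosen , surj = filling , annihilating
      where
      v : Fin (suc k) → Maybe Letter → ℤ
      v zero    = p⊕q⁻.basis nothing
      v (suc i) = vector (letter (f i))

      v∈L : ∀ i → L (v i)
      v∈L zero    = base
      v∈L (suc i) = member (letter (f i))

      covers : ∀ B → ∃! _≡_ λ i → v i (just B) ≢ 0ℤ
      covers B with choose B (partner B) refl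
      ... | A , cA , A∋B with surj (index A) (subst isChosen (sym (letter-index A)) cA)
      ... | i , eq = suc i , nonzero , unique
        where
        A≡ : letter (f i) ≡ A
        A≡ = trans (cong letter eq) (letter-index A)
        nonzero : v (suc i) (just B) ≢ 0ℤ
        nonzero = subst (λ A → vector A (just B) ≢ 0ℤ) (sym A≡) (touched _≟_ distinct A∋B)
        unique : ∀ {j} → v j (just B) ≢ 0ℤ → suc i ≡ j
        unique {zero}  ≢0 = contradiction refl ≢0
        unique {suc j} ≢0 = cong suc (inj (trans eq (trans
          (cong index (chosen-unique cA (chosen j) A∋B
            (touches _≟_ (letter (f j)) B (partner (letter (f j))) ≢0)))
          (index-letter (f j)))))

      filling : Filling
      filling = record
        { size     = suc k
        ; vector   = v
        ; i₀       = zero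
        ; vector-s = λ _ → refl
        ; short    = λ { zero ≢0 → contradiction refl ≢0
                       ; (suc i) _ → short (letter (f i)) (partner (letter (f i))) refl }
        ; covers   = covers
        }

      annihilating : p⊕q⁻.Annihilating filling
      annihilating i j = begin
        p⊕q⁻.ẽ (v i) (v j)                                 ≈⟨ ẽ-⊕ p (_⁻ᵖ τ q) (v i) (v j) ⟩
        p.ẽ (v i ∘ Maybe.map inj₁) (v j ∘ Maybe.map inj₁) ⊹
        Pairing.ẽ (_⁻ᵖ τ q) (v i ∘ Maybe.map inj₂) (v j ∘ Maybe.map inj₂)
          ≈⟨ ⊹-cong (agree (v∈L i) (v∈L j)) (ẽ-⁻ q (v i ∘ Maybe.map inj₂) (v j ∘ Maybe.map inj₂)) ⟩
        q.ẽ (v i ∘ Maybe.map inj₂) (v j ∘ Maybe.map inj₂) ⊹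
        ⊖ q.ẽ (v i ∘ Maybe.map inj₂) (v j ∘ Maybe.map inj₂)  ≈⟨ π.inverseʳ _ ⟩
        𝟘 ∎

  module _ {p q : Pairing τ} where
    private
      module p = Pairing p
      module q = Pairing q

    -- The subgroup is the graph of σ: the vectors whose restrictions to p and q correspond to each
    -- other. It contains `s` and all A + σ A, and the two forms agree on it by reindexing the
    -- double sum.
    isometry : (σ : p.Elem° ↔ q.Elem°) → (∀ A → q.∣ Inverse.to σ A ∣ ≡ p.∣ A ∣) →
               (∀ A B → p.e A B ≋ q.e (Maybe.map (Inverse.to σ) A) (Maybe.map (Inverse.to σ) B)) →
               Bordism p q
    isometry σ preserves e≋ = record
      { L        = λ x → x ∘ Maybe.map inj₁ ≗ x ∘ Maybe.map inj₂ ∘ Maybe.map to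
      ; subgroup = record
        { resp = λ x≗y x∈L u → trans (sym (x≗y _)) (trans (x∈L u) (x≗y _))
        ; null = λ _ → refl
        ; add  = λ x∈L y∈L u → cong₂ ℤ._+_ (x∈L u) (y∈L u)
        ; neg  = λ x∈L u → cong ℤ.-_ (x∈L u)
        }
      ; base     = λ { nothing → refl ; (just _) → refl }
      ; agree    = λ {x} {y} →
          ẽ-reindex (x ∘ Maybe.map inj₁) (y ∘ Maybe.map inj₁) (x ∘ Maybe.map inj₂) (y ∘ Maybe.map inj₂)
      ; matching = record
        { partner    = partner
        ; symmetric  = λ {x} → symmetric x
        ; distinct   = λ {x} → distinct x
        ; compatible = λ {x} → compatible x
        ; member     = member
        }
      }
      where
      open Inverse σ using (to; from)
      open Pair p q
      from∘to : ∀ A → from (to A) ≡ A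
      from∘to A = Inverse.inverseʳ σ refl
      to∘from : ∀ B → to (from B) ≡ B
      to∘from B = Inverse.inverseˡ σ refl

      reindex : ∀ f → ∑ᴹ q.letters f ≋ ∑ᴹ p.letters (f ∘ Maybe.map to)
      reindex f = ⊹-cong ∼-refl (∑-bijection q.letters p.letters σ (f ∘ just))

      ẽ-reindex : ∀ x y x′ y′ → x ≗ x′ ∘ Maybe.map to → y ≗ y′ ∘ Maybe.map to →
                  p.ẽ x y ≋ q.ẽ x′ y′
      ẽ-reindex x y x′ y′ x≗ y≗ = ∼-sym (∼-trans
        (reindex λ A → ∑ᴹ q.letters λ B → (x′ A ℤ.* y′ B) • q.e A B)
        (∑ᴹ-cong p.letters
          (λ A → ∑ᴹ q.letters λ B → (x′ (Maybe.map to A) ℤ.* y′ B) • q.e (Maybe.map to A) B)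
          (λ A → ∑ᴹ p.letters (λ B → (x A ℤ.* y B) • p.e A B))
          λ A → ∼-trans
            (reindex λ B → (x′ (Maybe.map to A) ℤ.* y′ B) • q.e (Maybe.map to A) B)
            (∑ᴹ-cong p.letters
              (λ B → (x′ (Maybe.map to A) ℤ.* y′ (Maybe.map to B)) • q.e (Maybe.map to A) (Maybe.map to B))
              (λ B → (x A ℤ.* y B) • p.e A B)
              λ B → ∼-trans
                (•-congˡ _ (cong₂ ℤ._*_ (sym (x≗ A)) (sym (y≗ B))))
                (•-cong (x A ℤ.* y B) (∼-sym (e≋ A B))))))

      partner : Letter → Maybe (Sign × Letter)
      partner (inj₁ A) = just (Sign.+ , inj₂ (to A))
      partner (inj₂ B) = just (Sign.+ , inj₁ (from B))
      symmetric : ∀ x {s y} → partner x ≡ just (s , y) → partner y ≡ just (s , x)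
      symmetric (inj₁ A) refl = cong (λ A → just (Sign.+ , inj₁ A)) (from∘to A)
      symmetric (inj₂ B) refl = cong (λ B → just (Sign.+ , inj₂ B)) (to∘from B)
      distinct : ∀ x {s y} → partner x ≡ just (s , y) → x ≢ y
      distinct (inj₁ A) refl ()
      distinct (inj₂ B) refl ()
      compatible : ∀ x {s y} → partner x ≡ just (s , y) → ∣ x ∣ ≡ act s ∣ y ∣
      compatible (inj₁ A) refl = sym (preserves A)
      compatible (inj₂ B) refl = trans (cong q.∣_∣ (sym (to∘from B))) (preserves (from B))
      member : ∀ x u → extend (vec _≟_ x (partner x)) (Maybe.map inj₁ u) ≡
                       extend (vec _≟_ x (partner x)) (Maybe.map inj₂ (Maybe.map to u))
      member x nothing = refl
      member (inj₁ A) (just C)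
        rewrite δ-≢ _≟_ {inj₂ (to A)} {inj₁ C} (λ ()) | δ-≢ _≟_ {inj₁ A} {inj₂ (to C)} (λ ()) =
        trans (ℤ.+-identityʳ _) (trans
          (δ-cong _≟_ _≟_ {inj₁ A} {inj₁ C} {inj₂ (to A)} {inj₂ (to C)} (λ { refl → refl })
            (λ eq → cong inj₁ (trans (sym (from∘to A)) (trans (cong from (Sum.inj₂-injective eq)) (from∘to C)))))
          (sym (ℤ.+-identityˡ _)))
      member (inj₂ B) (just C)
        rewrite δ-≢ _≟_ {inj₂ B} {inj₁ C} (λ ()) | δ-≢ _≟_ {inj₁ (from B)} {inj₂ (to C)} (λ ()) =
        trans (ℤ.+-identityˡ _) (trans
          (δ-cong _≟_ _≟_ {inj₁ (from B)} {inj₁ C} {inj₂ B} {inj₂ (to C)}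
            (λ { refl → cong inj₂ (sym (to∘from B)) }) (λ { refl → cong inj₁ (from∘to C) }))
          (sym (ℤ.+-identityʳ _)))

    bordism-sym : Bordism p q → Bordism q p
    bordism-sym b = record
      { L        = λ x → L (x ∘ Maybe.map swap)
      ; subgroup = preimage-subgroup subgroup (Maybe.map swap)
      ; base     = resp (λ { nothing → refl ; (just _) → refl }) base
      ; agree    = λ {x} {y} x∈L y∈L → ∼-sym (∼-trans
          (Form.ẽ-cong p (swap₁ x) (swap₁ y)) (∼-trans (agree x∈L y∈L)
          (Form.ẽ-cong q (swap₂ x) (swap₂ y))))
      ; matching = adapt
          (λ { (inj₁ _) → refl ; (inj₂ _) → refl })
          (resp λ { nothing → refl ; (just _) → refl })
          (transport (extend-subgroup subgroup) swap↔ matching)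
      }
      where
      open Bordism b
      open IsSubgroup subgroup
      swap↔ : (p.Elem° ⊎ q.Elem°) ↔ (q.Elem° ⊎ p.Elem°)
      swap↔ = mk↔ₛ′ swap swap Sum.swap-involutive Sum.swap-involutive
      swap₁ : ∀ x → x ∘ Maybe.map inj₂ ≗ x ∘ Maybe.map swap ∘ Maybe.map inj₁
      swap₁ x nothing  = refl
      swap₁ x (just _) = refl
      swap₂ : ∀ x → x ∘ Maybe.map swap ∘ Maybe.map inj₂ ≗ x ∘ Maybe.map inj₁
      swap₂ x nothing  = refl
      swap₂ x (just _) = refl

  module _ {p q r : Pairing τ} where
    private
      module p = Pairing p
      module q = Pairing q
      module r = Pairing r

    -- The vectors of the composite are the sums of vectors of the two matchings
    -- in which the letters of q cancel, whence the elimination.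
    bordism-trans : Bordism p q → Bordism q r → Bordism p r
    bordism-trans b₁ b₂ = record
      { L        = L
      ; subgroup = record
        { resp = λ eq (x₁ , x₂ , x₁∈ , x₂∈ , mid , out₁ , out₂) → x₁ , x₂ , x₁∈ , x₂∈ , mid ,
                   (λ u → trans (out₁ u) (eq _)) , (λ u → trans (out₂ u) (eq _))
        ; null = _ , _ , B₁.null , B₂.null , (λ _ → refl) , (λ _ → refl) , (λ _ → refl)
        ; add  = λ (x₁ , x₂ , x₁∈ , x₂∈ , mid , out₁ , out₂) (y₁ , y₂ , y₁∈ , y₂∈ , mid′ , out₁′ , out₂′) →
                   _ , _ , B₁.add x₁∈ y₁∈ , B₂.add x₂∈ y₂∈ ,
                   (λ u → cong₂ ℤ._+_ (mid u) (mid′ u)) ,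
                   (λ u → cong₂ ℤ._+_ (out₁ u) (out₁′ u)) , (λ u → cong₂ ℤ._+_ (out₂ u) (out₂′ u))
        ; neg  = λ (x₁ , x₂ , x₁∈ , x₂∈ , mid , out₁ , out₂) →
                   _ , _ , B₁.neg x₁∈ , B₂.neg x₂∈ ,
                   (λ u → cong ℤ.-_ (mid u)) , (λ u → cong ℤ.-_ (out₁ u)) , (λ u → cong ℤ.-_ (out₂ u))
        }
      ; base     = _ , _ , B₁.base , B₂.base ,
          (λ { nothing → refl ; (just _) → refl }) , (λ { nothing → refl ; (just _) → refl }) ,
          (λ { nothing → refl ; (just _) → refl })
      ; agree    = λ {x} {y} (x₁ , x₂ , x₁∈ , x₂∈ , mid , out₁ , out₂)
                             (y₁ , y₂ , y₁∈ , y₂∈ , mid′ , out₁′ , out₂′) → begin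
          p.ẽ (x ∘ Maybe.map inj₁) (y ∘ Maybe.map inj₁)    ≈⟨ Form.ẽ-cong p out₁ out₁′ ⟨
          p.ẽ (x₁ ∘ Maybe.map inj₁) (y₁ ∘ Maybe.map inj₁)  ≈⟨ B₁.agree x₁∈ y₁∈ ⟩
          q.ẽ (x₁ ∘ Maybe.map inj₂) (y₁ ∘ Maybe.map inj₂)  ≈⟨ Form.ẽ-cong q mid mid′ ⟩
          q.ẽ (x₂ ∘ Maybe.map inj₁) (y₂ ∘ Maybe.map inj₁)  ≈⟨ B₂.agree x₂∈ y₂∈ ⟩
          r.ẽ (x₂ ∘ Maybe.map inj₂) (y₂ ∘ Maybe.map inj₂)  ≈⟨ Form.ẽ-cong r out₂ out₂′ ⟩
          r.ẽ (x ∘ Maybe.map inj₂) (y ∘ Maybe.map inj₂)    ∎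
      ; matching = adapt
          (λ { (inj₁ _) → refl ; (inj₂ _) → refl })
          (λ { (x , (x₁∈ , x₂∈) , mid , out) → _ , _ , x₁∈ , x₂∈ ,
            (λ { nothing → refl ; (just B) → mid (Inverse.to Q.enumeration B) }) ,
            (λ { nothing → refl ; (just A) → out (inj₁ A) }) ,
            (λ { nothing → refl ; (just C) → out (inj₂ C) }) })
          (eliminateAll Q.size {_≟_ = PR._≟_} {Sum.≡-dec PR._≟_ (Sum.≡-dec Fin._≟_ Fin._≟_)}
            (preimage-subgroup both (Inverse.to σ)) (λ _ → refl)
            (transport both σ (disjointUnion E₁ E₂ B₁.matching B₂.matching)))
      }
      where
      module B₁ where
        open Bordism b₁ public
        open IsSubgroup subgroup public
      module B₂ where
        open Bordism b₂ public
        open IsSubgroup subgroup public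
      E₁ = extend-subgroup B₁.subgroup
      E₂ = extend-subgroup B₂.subgroup
      both = product-subgroup E₁ E₂
      module PR = Pair p r
      module Q = FiniteSet q.letters
      L : (Maybe PR.Letter → ℤ) → Set
      L y = ∃[ x₁ ] ∃[ x₂ ] B₁.L x₁ × B₂.L x₂ × x₁ ∘ Maybe.map inj₂ ≗ x₂ ∘ Maybe.map inj₁ ×
              x₁ ∘ Maybe.map inj₁ ≗ y ∘ Maybe.map inj₁ × x₂ ∘ Maybe.map inj₂ ≗ y ∘ Maybe.map inj₂
      Q↔ = Q.enumeration
      -- The two copies of a letter of q receive the same number. Gluing equal numbers thus says
      -- that the two vectors agree on q, and the labels to be glued coincide by computation.
      σ : ((p.Elem° ⊎ q.Elem°) ⊎ (q.Elem° ⊎ r.Elem°)) ↔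
          ((p.Elem° ⊎ r.Elem°) ⊎ (Fin Q.size ⊎ Fin Q.size))
      σ = mk↔ₛ′ to from to∘from from∘to
        where
        to : _ → _
        to (inj₁ (inj₁ A)) = inj₁ (inj₁ A)
        to (inj₁ (inj₂ B)) = inj₂ (inj₁ (Inverse.to Q↔ B))
        to (inj₂ (inj₁ B)) = inj₂ (inj₂ (Inverse.to Q↔ B))
        to (inj₂ (inj₂ C)) = inj₁ (inj₂ C)
        from : _ → _
        from (inj₁ (inj₁ A)) = inj₁ (inj₁ A)
        from (inj₁ (inj₂ C)) = inj₂ (inj₂ C)
        from (inj₂ (inj₁ i)) = inj₁ (inj₂ (Inverse.from Q↔ i))
        from (inj₂ (inj₂ i)) = inj₂ (inj₁ (Inverse.from Q↔ i))
        to∘from : ∀ x → to (from x) ≡ x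
        to∘from (inj₁ (inj₁ A)) = refl
        to∘from (inj₁ (inj₂ C)) = refl
        to∘from (inj₂ (inj₁ i)) = cong (inj₂ ∘ inj₁) (Inverse.inverseˡ Q↔ refl)
        to∘from (inj₂ (inj₂ i)) = cong (inj₂ ∘ inj₂) (Inverse.inverseˡ Q↔ refl)
        from∘to : ∀ x → from (to x) ≡ x
        from∘to (inj₁ (inj₁ A)) = refl
        from∘to (inj₁ (inj₂ B)) = cong (inj₁ ∘ inj₂) (Inverse.inverseʳ Q↔ refl)
        from∘to (inj₂ (inj₁ B)) = cong (inj₂ ∘ inj₁) (Inverse.inverseʳ Q↔ refl)
        from∘to (inj₂ (inj₂ C)) = refl

-- Combinatorics of words

-- 2 if exactly one of the occurrences of a letter comes before, and 0 otherwise.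
value : ℕ → ℤ
value 1 = ℤ.+ 2
value _ = 0ℤ

module Words {X : Set} (_≟_ : DecidableEquality X) where

  ind : X → X → ℕ
  ind A C = if does (A ≟ C) then 1 else 0

  ind-refl : ∀ A → ind A A ≡ 1
  ind-refl A = cong (λ b → if b then 1 else 0) (dec-true (A ≟ A) refl)

  ind-≢ : ∀ {A C} → A ≢ C → ind A C ≡ 0
  ind-≢ {A} {C} A≢C = cong (λ b → if b then 1 else 0) (dec-false (A ≟ C) A≢C)

  occ : X → List X → ℕ
  occ A []      = 0
  occ A (C ∷ w) = ind A C + occ A w

  -- The position of the occurrence of D number k, counted from 0.
  pos : X → ℕ → List X → ℕ
  pos D k       []      = 0
  pos D zero    (C ∷ w) = if does (D ≟ C) then 0 else suc (pos D zero w)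
  pos D (suc k) (C ∷ w) = suc (if does (D ≟ C) then pos D k w else pos D (suc k) w)

  -- The number of letters A before the occurrence of D number k.
  before : X → X → ℕ → List X → ℕ
  before A D k       []      = 0
  before A D zero    (C ∷ w) = if does (D ≟ C) then 0 else ind A C + before A D zero w
  before A D (suc k) (C ∷ w) = ind A C + (if does (D ≟ C) then before A D k w else before A D (suc k) w)

  -- The function h_A at occurrence k of D. If A occurs twice, a position different from both of its
  -- ends lies inside its arc exactly if one letter A precedes it.
  level : X → X → ℕ → List X → ℤ
  level A D k w = if does (A ≟ D) then 1ℤ else value (before A D k w)

  level-≢ : ∀ {A D} k w → A ≢ D → level A D k w ≡ value (before A D k w)
  level-≢ {A} {D} k w A≢D =
    cong (λ b → if b then 1ℤ else value (before A D k w)) (dec-false (A ≟ D) A≢D)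

  level-refl : ∀ D k w → level D D k w ≡ 1ℤ
  level-refl D k w =
    cong (λ b → if b then 1ℤ else value (before D D k w)) (dec-true (D ≟ D) refl)

  before-hit₀ : ∀ A D w → before A D 0 (D ∷ w) ≡ 0
  before-hit₀ A D w =
    cong (λ b → if b then 0 else ind A D + before A D 0 w) (dec-true (D ≟ D) refl)

  before-hit : ∀ A D k w → before A D (suc k) (D ∷ w) ≡ ind A D + before A D k w
  before-hit A D k w =
    cong (λ b → ind A D + (if b then before A D k w else before A D (suc k) w)) (dec-true (D ≟ D) refl)

  before-miss : ∀ A {D C} k w → D ≢ C → before A D k (C ∷ w) ≡ ind A C + before A D k w
  before-miss A {D} {C} zero    w D≢C =
    cong (λ b → if b then 0 else ind A C + before A D 0 w) (dec-false (D ≟ C) D≢C)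
  before-miss A {D} {C} (suc k) w D≢C =
    cong (λ b → ind A C + (if b then before A D k w else before A D (suc k) w)) (dec-false (D ≟ C) D≢C)

  occ-++ : ∀ A u v → occ A (u ++ v) ≡ occ A u + occ A v
  occ-++ A []      v = refl
  occ-++ A (C ∷ u) v = trans (cong (ind A C +_) (occ-++ A u v)) (sym (ℕ.+-assoc (ind A C) _ _))

  occ-reverse : ∀ A w → occ A (reverse w) ≡ occ A w
  occ-reverse A []      = refl
  occ-reverse A (C ∷ w) = begin
    occ A (reverse (C ∷ w))                  ≡⟨ cong (occ A) (unfold-reverse C w) ⟩
    occ A (reverse w ++ C ∷ [])              ≡⟨ occ-++ A (reverse w) (C ∷ []) ⟩
    occ A (reverse w) + (ind A C + 0)        ≡⟨ cong₂ _+_ (occ-reverse A w) (ℕ.+-identityʳ _) ⟩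
    occ A w + ind A C                        ≡⟨ ℕ.+-comm (occ A w) _ ⟩
    ind A C + occ A w                        ∎
    where open ≡-Reasoning

  occ≡occurrences : ∀ A w → occ A w ≡ length (filter (A ≟_) w)
  occ≡occurrences A []      = refl
  occ≡occurrences A (C ∷ w) with A ≟ C
  ... | yes _ = cong suc (occ≡occurrences A w)
  ... | no  _ = occ≡occurrences A w

  before-≤ : ∀ A D k w → before A D k w ≤ occ A w
  before-≤ A D k       []      = z≤n
  before-≤ A D zero    (C ∷ w) with does (D ≟ C)
  ... | true  = z≤n
  ... | false = ℕ.+-monoʳ-≤ (ind A C) (before-≤ A D 0 w)
  before-≤ A D (suc k) (C ∷ w) with does (D ≟ C)
  ... | true  = ℕ.+-monoʳ-≤ (ind A C) (before-≤ A D k w)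
  ... | false = ℕ.+-monoʳ-≤ (ind A C) (before-≤ A D (suc k) w)

  before-∉ : ∀ {A} D k w → occ A w ≡ 0 → before A D k w ≡ 0
  before-∉ {A} D k w A∉ = ℕ.n≤0⇒n≡0 (subst (before A D k w ≤_) A∉ (before-≤ A D k w))

  before-++ˡ : ∀ A D k u v → k < occ D u → before A D k (u ++ v) ≡ before A D k u
  before-++ˡ A D zero    (C ∷ u) v k< with D ≟ C
  ... | yes _ = refl
  ... | no  _ = cong (ind A C +_) (before-++ˡ A D 0 u v k<)
  before-++ˡ A D (suc k) (C ∷ u) v k< with D ≟ C
  ... | yes _ = cong (ind A C +_) (before-++ˡ A D k u v (ℕ.s≤s⁻¹ k<))
  ... | no  _ = cong (ind A C +_) (before-++ˡ A D (suc k) u v k<)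

  before-++ʳ : ∀ A D k u v → before A D (occ D u + k) (u ++ v) ≡ occ A u + before A D k v
  before-++ʳ A D k []      v = refl
  before-++ʳ A D k (C ∷ u) v with D ≟ C
  ... | yes refl = begin
    before A D (suc (occ D u + k)) (D ∷ u ++ v)         ≡⟨ before-hit A D (occ D u + k) (u ++ v) ⟩
    ind A D + before A D (occ D u + k) (u ++ v)         ≡⟨ cong (ind A D +_) (before-++ʳ A D k u v) ⟩
    ind A D + (occ A u + before A D k v)                ≡⟨ ℕ.+-assoc (ind A D) _ _ ⟨
    ind A D + occ A u + before A D k v                  ∎
    where open ≡-Reasoning
  ... | no  D≢C = begin
    before A D (occ D u + k) (C ∷ u ++ v)               ≡⟨ before-miss A (occ D u + k) (u ++ v) D≢C ⟩
    ind A C + before A D (occ D u + k) (u ++ v)         ≡⟨ cong (ind A C +_) (before-++ʳ A D k u v) ⟩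
    ind A C + (occ A u + before A D k v)                ≡⟨ ℕ.+-assoc (ind A C) _ _ ⟨
    ind A C + occ A u + before A D k v                  ∎
    where open ≡-Reasoning

  before-self : ∀ D k w → k < occ D w → before D D k w ≡ k
  before-self D zero    (C ∷ w) k< with D ≟ C
  ... | yes _ = refl
  ... | no  _ = before-self D 0 w k<
  before-self D (suc k) (C ∷ w) k< with D ≟ C
  ... | yes _ = cong suc (before-self D k w (ℕ.s≤s⁻¹ k<))
  ... | no  _ = before-self D (suc k) w k<

  private
    rearrange : ∀ a b c d → a + (b + c) + d ≡ b + (a + c + d)
    rearrange = ℕ-Solver.solve-∀

  -- Occurrence m of D in the reversed word is occurrence l in w. The letters A in front of it in
  -- the reversed word are those behind it in w; together with those in front of it in w, and with
  -- the occurrence itself if A = D, they are all letters A.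
  before-reverse : ∀ A D l m w → suc (l + m) ≡ occ D w →
                   before A D m (reverse w) + before A D l w + ind A D ≡ occ A w
  before-reverse A D l m (C ∷ w) eq rewrite unfold-reverse C w with D ≟ C
  before-reverse A D zero m (D ∷ w) eq | yes refl = begin
    before A D m (reverse w ++ D ∷ []) + before A D 0 (D ∷ w) + ind A D
      ≡⟨ cong₂ (λ k l → before A D k (reverse w ++ D ∷ []) + l + ind A D) m≡ (before-hit₀ A D w) ⟩
    before A D (occ D (reverse w) + 0) (reverse w ++ D ∷ []) + 0 + ind A D
      ≡⟨ cong (λ k → k + 0 + ind A D) (before-++ʳ A D 0 (reverse w) (D ∷ [])) ⟩
    occ A (reverse w) + before A D 0 (D ∷ []) + 0 + ind A D
      ≡⟨ cong₂ (λ k l → k + l + 0 + ind A D) (occ-reverse A w) (before-hit₀ A D []) ⟩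
    occ A w + 0 + 0 + ind A D
      ≡⟨ cong (_+ ind A D) (trans (ℕ.+-identityʳ _) (ℕ.+-identityʳ _)) ⟩
    occ A w + ind A D
      ≡⟨ ℕ.+-comm (occ A w) _ ⟩
    ind A D + occ A w ∎
    where
    open ≡-Reasoning
    m≡ : m ≡ occ D (reverse w) + 0
    m≡ = trans (ℕ.suc-injective eq) (trans (sym (occ-reverse D w)) (sym (ℕ.+-identityʳ _)))
  before-reverse A D (suc l) m (D ∷ w) eq | yes refl = begin
    before A D m (reverse w ++ D ∷ []) + before A D (suc l) (D ∷ w) + ind A D
      ≡⟨ cong₂ (λ k n → k + n + ind A D) (before-++ˡ A D m (reverse w) _ m<) (before-hit A D l w) ⟩
    before A D m (reverse w) + (ind A D + before A D l w) + ind A D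
      ≡⟨ rearrange (before A D m (reverse w)) (ind A D) _ _ ⟩
    ind A D + (before A D m (reverse w) + before A D l w + ind A D)
      ≡⟨ cong (ind A D +_) (before-reverse A D l m w (ℕ.suc-injective eq)) ⟩
    ind A D + occ A w ∎
    where
    open ≡-Reasoning
    m< : m < occ D (reverse w)
    m< = subst (m <_) (trans (ℕ.suc-injective eq) (sym (occ-reverse D w))) (s≤s (ℕ.m≤n+m m l))
  before-reverse A D l m (C ∷ w) eq | no D≢C = begin
    before A D m (reverse w ++ C ∷ []) + before A D l (C ∷ w) + ind A D
      ≡⟨ cong₂ (λ k n → k + n + ind A D) (before-++ˡ A D m (reverse w) _ m<) (before-miss A l w D≢C) ⟩
    before A D m (reverse w) + (ind A C + before A D l w) + ind A D
      ≡⟨ rearrange (before A D m (reverse w)) (ind A C) _ _ ⟩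
    ind A C + (before A D m (reverse w) + before A D l w + ind A D)
      ≡⟨ cong (ind A C +_) (before-reverse A D l m w eq) ⟩
    ind A C + occ A w ∎
    where
    open ≡-Reasoning
    m< : m < occ D (reverse w)
    m< = subst (m <_) (trans eq (sym (occ-reverse D w))) (s≤s (ℕ.m≤n+m m l))

  -- Counts are additive under concatenation and easily reversed, unlike comparisons of positions.
  -- With the converse `before-pos` this translates the inequalities in the definition of e_w into
  -- counts.
  pos-before : ∀ A m D k w → pos A m w < pos D k w → m < before A D k w
  pos-before A m       D zero    (C ∷ w) lt with D ≟ C
  pos-before A m       D zero    (C ∷ w) () | yes _
  pos-before A zero    D zero    (C ∷ w) lt | no _ with A ≟ C
  ... | yes _ = s≤s z≤n
  ... | no  _ = pos-before A 0 D 0 w (ℕ.s≤s⁻¹ lt)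
  pos-before A (suc m) D zero    (C ∷ w) lt | no _ with A ≟ C
  ... | yes _ = s≤s (pos-before A m D 0 w (ℕ.s≤s⁻¹ lt))
  ... | no  _ = pos-before A (suc m) D 0 w (ℕ.s≤s⁻¹ lt)
  pos-before A zero    D (suc k) (C ∷ w) lt with A ≟ C | D ≟ C
  ... | yes _ | _     = s≤s z≤n
  ... | no  _ | yes _ = pos-before A 0 D k w (ℕ.s≤s⁻¹ lt)
  ... | no  _ | no  _ = pos-before A 0 D (suc k) w (ℕ.s≤s⁻¹ lt)
  pos-before A (suc m) D (suc k) (C ∷ w) lt with A ≟ C | D ≟ C
  ... | yes _ | yes _ = s≤s (pos-before A m D k w (ℕ.s≤s⁻¹ lt))
  ... | yes _ | no  _ = s≤s (pos-before A m D (suc k) w (ℕ.s≤s⁻¹ lt))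
  ... | no  _ | yes _ = pos-before A (suc m) D k w (ℕ.s≤s⁻¹ lt)
  ... | no  _ | no  _ = pos-before A (suc m) D (suc k) w (ℕ.s≤s⁻¹ lt)

  before-pos : ∀ A m D k w → m < before A D k w → pos A m w < pos D k w
  before-pos A m       D zero    (C ∷ w) lt with D ≟ C
  before-pos A m       D zero    (C ∷ w) () | yes _
  before-pos A zero    D zero    (C ∷ w) lt | no _ with A ≟ C
  ... | yes _ = s≤s z≤n
  ... | no  _ = s≤s (before-pos A 0 D 0 w lt)
  before-pos A (suc m) D zero    (C ∷ w) lt | no _ with A ≟ C
  ... | yes _ = s≤s (before-pos A m D 0 w (ℕ.s≤s⁻¹ lt))
  ... | no  _ = s≤s (before-pos A (suc m) D 0 w lt)
  before-pos A zero    D (suc k) (C ∷ w) lt with A ≟ C | D ≟ C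
  ... | yes _ | _     = s≤s z≤n
  ... | no  _ | yes _ = s≤s (before-pos A 0 D k w lt)
  ... | no  _ | no  _ = s≤s (before-pos A 0 D (suc k) w lt)
  before-pos A (suc m) D (suc k) (C ∷ w) lt with A ≟ C | D ≟ C
  ... | yes _ | yes _ = s≤s (before-pos A m D k w (ℕ.s≤s⁻¹ lt))
  ... | yes _ | no  _ = s≤s (before-pos A m D (suc k) w (ℕ.s≤s⁻¹ lt))
  ... | no  _ | yes _ = s≤s (before-pos A (suc m) D k w lt)
  ... | no  _ | no  _ = s≤s (before-pos A (suc m) D (suc k) w lt)

  pos-injective : ∀ A m D k w → m < occ A w → k < occ D w → pos A m w ≡ pos D k w → A ≡ D
  pos-injective A zero    D zero    (C ∷ w) m< k< eq with A ≟ C | D ≟ C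
  ... | yes A≡C | yes D≡C = trans A≡C (sym D≡C)
  ... | no  _   | no  _   = pos-injective A 0 D 0 w m< k< (ℕ.suc-injective eq)
  pos-injective A zero    D (suc k) (C ∷ w) m< k< eq with A ≟ C | D ≟ C
  ... | no  _   | yes _   = pos-injective A 0 D k w m< (ℕ.s≤s⁻¹ k<) (ℕ.suc-injective eq)
  ... | no  _   | no  _   = pos-injective A 0 D (suc k) w m< k< (ℕ.suc-injective eq)
  pos-injective A (suc m) D zero    (C ∷ w) m< k< eq with A ≟ C | D ≟ C
  ... | yes _   | no  _   = pos-injective A m D 0 w (ℕ.s≤s⁻¹ m<) k< (ℕ.suc-injective eq)
  ... | no  _   | no  _   = pos-injective A (suc m) D 0 w m< k< (ℕ.suc-injective eq)
  pos-injective A (suc m) D (suc k) (C ∷ w) m< k< eq with A ≟ C | D ≟ C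
  ... | yes A≡C | yes D≡C = trans A≡C (sym D≡C)
  ... | yes _   | no  _   = pos-injective A m D (suc k) w (ℕ.s≤s⁻¹ m<) k< (ℕ.suc-injective eq)
  ... | no  _   | yes _   = pos-injective A (suc m) D k w m< (ℕ.s≤s⁻¹ k<) (ℕ.suc-injective eq)
  ... | no  _   | no  _   = pos-injective A (suc m) D (suc k) w m< k< (ℕ.suc-injective eq)

module _ {X Y : Set} (_≟_ : DecidableEquality X) (_≟′_ : DecidableEquality Y)
         {f : X → Y} (f-injective : Injective _≡_ _≡_ f) where
  private
    module X = Words _≟_
    module Y = Words _≟′_

  does-map : ∀ A C → does (f A ≟′ f C) ≡ does (A ≟ C)
  does-map A C with A ≟ C
  ... | yes A≡C = dec-true (f A ≟′ f C) (cong f A≡C)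
  ... | no  A≢C = dec-false (f A ≟′ f C) (A≢C ∘ f-injective)

  ind-map : ∀ A C → Y.ind (f A) (f C) ≡ X.ind A C
  ind-map A C = cong (λ b → if b then 1 else 0) (does-map A C)

  occ-map : ∀ A w → Y.occ (f A) (map f w) ≡ X.occ A w
  occ-map A []      = refl
  occ-map A (C ∷ w) = cong₂ _+_ (ind-map A C) (occ-map A w)

  before-map : ∀ A D k w → Y.before (f A) (f D) k (map f w) ≡ X.before A D k w
  before-map A D k       []      = refl
  before-map A D zero    (C ∷ w) rewrite does-map D C with does (D ≟ C)
  ... | true  = refl
  ... | false = cong₂ _+_ (ind-map A C) (before-map A D 0 w)
  before-map A D (suc k) (C ∷ w) rewrite does-map D C with does (D ≟ C)
  ... | true  = cong₂ _+_ (ind-map A C) (before-map A D k w)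
  ... | false = cong₂ _+_ (ind-map A C) (before-map A D (suc k) w)

  level-map : ∀ A D k w → Y.level (f A) (f D) k (map f w) ≡ X.level A D k w
  level-map A D k w = cong₂ (λ b v → if b then 1ℤ else value v) (does-map A D) (before-map A D k w)

module _ {X Y : Set} (_≟′_ : DecidableEquality Y) {f : X → Y} where
  open Words _≟′_

  occ-map-∉ : ∀ {C} → (∀ A → C ≢ f A) → ∀ w → occ C (map f w) ≡ 0
  occ-map-∉ C∉ []      = refl
  occ-map-∉ C∉ (A ∷ w) = cong₂ _+_ (ind-≢ (C∉ A)) (occ-map-∉ C∉ w)

-- The form of a nanoword

module Positions (X : FiniteSet) where
  open FiniteSet X
  open Words _≟_ public

  firstPos≡pos : ∀ A w → firstPos A w ≡ pos A 0 w
  firstPos≡pos A []      = refl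
  firstPos≡pos A (B ∷ w) = cong (λ k → if does (A ≟ B) then 0 else suc k) (firstPos≡pos A w)

  secondPos≡pos : ∀ A w → secondPos A w ≡ pos A 1 w
  secondPos≡pos A []      = refl
  secondPos≡pos A (B ∷ w) = cong₂ (λ k l → suc (if does (A ≟ B) then k else l))
    (firstPos≡pos A w) (secondPos≡pos A w)

module Interlacing where

  inside? : ∀ a a′ t → Dec (a < t × t < a′)
  inside? a a′ t = (a ℕ.<? t) ×-dec (t ℕ.<? a′)

  inside : ℕ → ℕ → ℕ → ℤ
  inside a a′ t = if does (inside? a a′ t) then 1ℤ else 0ℤ

  interlaced? : ∀ a a′ b b′ → Dec (a < b × b < a′ × a′ < b′)
  interlaced? a a′ b b′ = a ℕ.<? b ×-dec b ℕ.<? a′ ×-dec a′ ℕ.<? b′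

  inside-yes : ∀ {a a′ t} → a < t → t < a′ → inside a a′ t ≡ 1ℤ
  inside-yes {a} {a′} {t} a<t t<a′ =
    cong (λ b → if b then 1ℤ else 0ℤ) (dec-true (inside? a a′ t) (a<t , t<a′))

  inside-no : ∀ {a a′ t} → ¬ (a < t × t < a′) → inside a a′ t ≡ 0ℤ
  inside-no {a} {a′} {t} ¬p = cong (λ b → if b then 1ℤ else 0ℤ) (dec-false (inside? a a′ t) ¬p)

  inside-≤ : ∀ {a a′ t} → t ≤ a → inside a a′ t ≡ 0ℤ
  inside-≤ {a} {a′} t≤a = inside-no {a} {a′} λ (a<t , _) → ℕ.<⇒≱ a<t t≤a

  inside-≥ : ∀ {a a′ t} → a′ ≤ t → inside a a′ t ≡ 0ℤ
  inside-≥ {a} {a′} a′≤t = inside-no {a} {a′} λ (_ , t<a′) → ℕ.<⇒≱ t<a′ a′≤t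

  sign-yes : ∀ {P Q : Set} (p? : Dec P) (q? : Dec Q) → P → sign p? q? ≡ 1ℤ
  sign-yes (yes _) q? p = refl
  sign-yes (no ¬p) q? p = contradiction p ¬p

  sign-no : ∀ {P Q : Set} (p? : Dec P) (q? : Dec Q) → ¬ P → Q → sign p? q? ≡ -1ℤ
  sign-no (yes p) q?      ¬p q = contradiction p ¬p
  sign-no (no _)  (yes _) ¬p q = refl
  sign-no (no _)  (no ¬q) ¬p q = contradiction q ¬q

  sign-none : ∀ {P Q : Set} (p? : Dec P) (q? : Dec Q) → ¬ P → ¬ Q → sign p? q? ≡ 0ℤ
  sign-none (yes p) q?      ¬p ¬q = contradiction p ¬p
  sign-none (no _)  (yes q) ¬p ¬q = contradiction q ¬q
  sign-none (no _)  (no _)  ¬p ¬q = refl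

  -- Two arcs with four distinct ends have six relative positions. They are interlaced exactly if
  -- one end of the second lies inside the first and the other does not, and then the sign tells
  -- which end it is; the same can be read off with the roles of the arcs exchanged.
  sign-inside : ∀ {a a′ b b′} → a < a′ → b < b′ → a ≢ b → a′ ≢ b → a ≢ b′ → a′ ≢ b′ →
    let s = sign (interlaced? a a′ b b′) (interlaced? b b′ a a′) in
    s ≡ inside a a′ b ℤ.- inside a a′ b′ × s ≡ inside b b′ a′ ℤ.- inside b b′ a
  sign-inside {a} {a′} {b} {b′} a<a′ b<b′ a≢b a′≢b a≢b′ a′≢b′ with ℕ.<-cmp a b
  ... | Tri.tri≈ _ a≡b _ = contradiction a≡b a≢b
  ... | Tri.tri< a<b _ b≮a with ℕ.<-cmp b a′
  ...   | Tri.tri≈ _ b≡a′ _ = contradiction (sym b≡a′) a′≢b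
  ...   | Tri.tri> _ _ a′<b
    rewrite sign-none (interlaced? a a′ b b′) (interlaced? b b′ a a′)
              (λ (_ , b<a′ , _) → ℕ.<-asym b<a′ a′<b) (λ (b<a , _) → b≮a b<a)
          | inside-≥ {a} {a′} {b} (ℕ.<⇒≤ a′<b) | inside-≥ {a} {a′} {b′} (ℕ.<⇒≤ (ℕ.<-trans a′<b b<b′))
          | inside-≤ {b} {b′} {a} (ℕ.<⇒≤ a<b) | inside-≤ {b} {b′} {a′} (ℕ.<⇒≤ a′<b) = refl , refl
  ...   | Tri.tri< b<a′ _ _ with ℕ.<-cmp a′ b′
  ...     | Tri.tri≈ _ a′≡b′ _ = contradiction a′≡b′ a′≢b′
  ...     | Tri.tri< a′<b′ _ _
    rewrite sign-yes (interlaced? a a′ b b′) (interlaced? b b′ a a′) (a<b , b<a′ , a′<b′)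
          | inside-yes {a} {a′} {b} a<b b<a′ | inside-≥ {a} {a′} {b′} (ℕ.<⇒≤ a′<b′)
          | inside-≤ {b} {b′} {a} (ℕ.<⇒≤ a<b) | inside-yes {b} {b′} {a′} b<a′ a′<b′ = refl , refl
  ...     | Tri.tri> a′≮b′ _ b′<a′
    rewrite sign-none (interlaced? a a′ b b′) (interlaced? b b′ a a′)
              (λ (_ , _ , a′<b′) → a′≮b′ a′<b′) (λ (b<a , _) → b≮a b<a)
          | inside-yes {a} {a′} {b} a<b b<a′ | inside-yes {a} {a′} {b′} (ℕ.<-trans a<b b<b′) b′<a′
          | inside-≤ {b} {b′} {a} (ℕ.<⇒≤ a<b) | inside-≥ {b} {b′} {a′} (ℕ.<⇒≤ b′<a′) = refl , refl
  sign-inside {a} {a′} {b} {b′} a<a′ b<b′ a≢b a′≢b a≢b′ a′≢b′ | Tri.tri> a≮b _ b<a with ℕ.<-cmp a b′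
  ...   | Tri.tri≈ _ a≡b′ _ = contradiction a≡b′ a≢b′
  ...   | Tri.tri> _ _ b′<a
    rewrite sign-none (interlaced? a a′ b b′) (interlaced? b b′ a a′)
              (λ (a<b , _) → a≮b a<b) (λ (_ , a<b′ , _) → ℕ.<-asym a<b′ b′<a)
          | inside-≤ {a} {a′} {b} (ℕ.<⇒≤ b<a) | inside-≤ {a} {a′} {b′} (ℕ.<⇒≤ b′<a)
          | inside-≥ {b} {b′} {a} (ℕ.<⇒≤ b′<a) | inside-≥ {b} {b′} {a′} (ℕ.<⇒≤ (ℕ.<-trans b′<a a<a′)) = refl , refl
  ...   | Tri.tri< a<b′ _ _ with ℕ.<-cmp a′ b′
  ...     | Tri.tri≈ _ a′≡b′ _ = contradiction a′≡b′ a′≢b′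
  ...     | Tri.tri> _ _ b′<a′
    rewrite sign-no (interlaced? a a′ b b′) (interlaced? b b′ a a′) (λ (a<b , _) → a≮b a<b) (b<a , a<b′ , b′<a′)
          | inside-≤ {a} {a′} {b} (ℕ.<⇒≤ b<a) | inside-yes {a} {a′} {b′} a<b′ b′<a′
          | inside-yes {b} {b′} {a} b<a a<b′ | inside-≥ {b} {b′} {a′} (ℕ.<⇒≤ b′<a′) = refl , refl
  ...     | Tri.tri< a′<b′ _ b′≮a′
    rewrite sign-none (interlaced? a a′ b b′) (interlaced? b b′ a a′)
              (λ (a<b , _) → a≮b a<b) (λ (_ , _ , b′<a′) → b′≮a′ b′<a′)
          | inside-≤ {a} {a′} {b} (ℕ.<⇒≤ b<a) | inside-≥ {a} {a′} {b′} (ℕ.<⇒≤ a′<b′)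
          | inside-yes {b} {b′} {a} b<a a<b′ | inside-yes {b} {b′} {a′} (ℕ.<-trans b<a a<a′) a′<b′ = refl , refl

-- The determinant of the values of two functions at the two occurrences of one letter, that is, a
-- coefficient of the formula for e_w before halving.
det : (ℕ → ℤ) → (ℕ → ℤ) → ℤ
det X Y = X 0 ℤ.* Y 1 ℤ.- X 1 ℤ.* Y 0

double-injective : ∀ {k l} → k ℤ.+ k ≡ l ℤ.+ l → k ≡ l
double-injective {k} {l} eq = ℤ.*-cancelˡ-≡ (ℤ.+ 2) k l (trans (double k) (trans eq (sym (double l))))
  where
  double : ∀ k → ℤ.+ 2 ℤ.* k ≡ k ℤ.+ k
  double = solve-∀

module Combinations {a} {α : Set a} (τ : α → α) (𝒜 : Alphabet α) where
  open Coefficients τ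
  open Alphabet 𝒜
  open Summation letters

  Φ : (Letter → ℤ) → Expr τ
  Φ F = ∑ τ letters λ D → F D • gen ∣ D ∣

  Φ-cong : ∀ {F G} → F ≗ G → Φ F ≋ Φ G
  Φ-cong F≗G = ∑-cong λ D → •-congˡ (gen ∣ D ∣) (F≗G D)

  Φ-+ : ∀ F G → Φ (λ D → F D ℤ.+ G D) ≋ Φ F ⊹ Φ G
  Φ-+ F G = ∼-trans (∑-cong λ D → •-homo-+ (F D) (G D) (gen ∣ D ∣)) (∑-⊹ (λ D → F D • gen ∣ D ∣) (λ D → G D • gen ∣ D ∣))

  Φ-neg : ∀ F → Φ (λ D → ℤ.- F D) ≋ ⊖ Φ F
  Φ-neg F = ∼-trans (∑-cong λ D → •-homo-neg (F D) (gen ∣ D ∣)) (∑-⊖ (λ D → F D • gen ∣ D ∣))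

  Φ-0 : ∀ {F} → (∀ D → F D ≡ 0ℤ) → Φ F ≋ 𝟘
  Φ-0 F≡0 = ∑-𝟘 λ D → •-congˡ (gen ∣ D ∣) (F≡0 D)

  Φ-δ : ∀ A k → Φ (λ D → δ _≟_ A D ℤ.* k) ≋ k • gen ∣ A ∣
  Φ-δ A k = ∼-trans
    (∑-single (λ D → (δ _≟_ A D ℤ.* k) • gen ∣ D ∣) A λ B B≢A → •-congˡ (gen ∣ B ∣) (cong (ℤ._* k) (δ-≢ _≟_ (B≢A ∘ sym))))
    (•-congˡ (gen ∣ A ∣) (trans (cong (ℤ._* k) (δ-refl _≟_ A)) (ℤ.*-identityˡ k)))

module NanowordForm {a} {α : Set a} (τ : α → α) (w : Nanoword α) where
  open Coefficients τ
  open Nanoword w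
  open Combinations τ alphabet public
  open Positions letters
  open Interlacing
  open Summation letters

  private
    P : Letter → ℕ → ℕ
    P A k = pos A k word

    i≡ : ∀ A → i A ≡ P A 0
    i≡ A = firstPos≡pos A word
    j≡ : ∀ A → j A ≡ P A 1
    j≡ A = secondPos≡pos A word

  occ≡2 : ∀ A → occ A word ≡ 2
  occ≡2 A = trans (occ≡occurrences A word) (twice A)

  occurs : ∀ A {k} → k < 2 → k < occ A word
  occurs A k<2 = subst (_ <_) (sym (occ≡2 A)) k<2

  private
    c : Letter → ℕ → ℤ
    c A = inside (i A) (j A)

    0<2 = s≤s {n = 1} z≤n
    1<2 = s≤s (s≤s {n = 0} z≤n)

    i<j : ∀ A → i A < j A
    i<j A = subst₂ _<_ (sym (i≡ A)) (sym (j≡ A))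
      (before-pos A 0 A 1 word (subst (0 <_) (sym (before-self A 1 word (occurs A 1<2))) (s≤s z≤n)))

    P-≢ : ∀ {A B k l} → k < 2 → l < 2 → A ≢ B → P A k ≢ P B l
    P-≢ k< l< A≢B eq = A≢B (pos-injective _ _ _ _ word (occurs _ k<) (occurs _ l<) eq)

    n-inside : ∀ {A B} → A ≢ B → n A B ≡ c A (i B) ℤ.- c A (j B) × n A B ≡ c B (j A) ℤ.- c B (i A)
    n-inside {A} {B} A≢B = sign-inside (i<j A) (i<j B)
      (λ eq → P-≢ 0<2 0<2 A≢B (trans (sym (i≡ A)) (trans eq (i≡ B))))
      (λ eq → P-≢ 1<2 0<2 A≢B (trans (sym (j≡ A)) (trans eq (i≡ B))))
      (λ eq → P-≢ 0<2 1<2 A≢B (trans (sym (i≡ A)) (trans eq (j≡ B))))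
      (λ eq → P-≢ 1<2 1<2 A≢B (trans (sym (j≡ A)) (trans eq (j≡ B))))

    n-diag : ∀ A → n A A ≡ 0ℤ
    n-diag A = sign-none (pattern? A A) (pattern? A A) (λ (lt , _) → ℕ.<-irrefl refl lt) (λ (lt , _) → ℕ.<-irrefl refl lt)

    -- None, one or two letters A in front of a position put it before, inside or behind the arc of
    -- A. At the two ends of the arc the indicator `c` vanishes and the summand `δ` supplies the
    -- value 1.
    level-inside : ∀ A D k → k < 2 → level A D k word ≡ δ _≟_ A D ℤ.+ (c A (P D k) ℤ.+ c A (P D k))
    level-inside A D k k<2 = case (A ≟ D)
      where
      at : ∀ {x} → c A (P D k) ≡ x → A ≢ D → value (before A D k word) ≡ x ℤ.+ x →
           level A D k word ≡ δ _≟_ A D ℤ.+ (c A (P D k) ℤ.+ c A (P D k))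
      at refl A≢D eq = trans (level-≢ k word A≢D) (trans eq
        (sym (trans (cong (ℤ._+ (c A (P D k) ℤ.+ c A (P D k))) (δ-≢ _≟_ A≢D)) (ℤ.+-identityˡ _))))
      by : A ≢ D → ∀ b → b ≡ before A D k word →
           level A D k word ≡ δ _≟_ A D ℤ.+ (c A (P D k) ℤ.+ c A (P D k))
      by A≢D 0 eq = at (inside-no {i A} {j A} λ (i<P , _) → contradiction
        (subst (0 <_) (sym eq) (pos-before A 0 D k word (subst (_< P D k) (i≡ A) i<P))) λ ()) A≢D (cong value (sym eq))
      by A≢D 1 eq = at (inside-yes {i A} {j A}
        (subst (_< P D k) (sym (i≡ A)) (before-pos A 0 D k word (subst (0 <_) eq (s≤s z≤n))))
        (subst (P D k <_) (sym (j≡ A)) (ℕ.≤∧≢⇒<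
          (ℕ.≮⇒≥ λ lt → contradiction (subst (1 <_) (sym eq) (pos-before A 1 D k word lt)) λ { (s≤s ()) })
          (P-≢ k<2 1<2 (A≢D ∘ sym))))) A≢D (cong value (sym eq))
      by A≢D (suc (suc b)) eq = at (inside-≥ {i A} {j A} (ℕ.<⇒≤
        (subst (_< P D k) (sym (j≡ A)) (before-pos A 1 D k word (subst (1 <_) eq (s≤s (s≤s z≤n))))))) A≢D
        (cong value (sym eq))
      self : ∀ k → k < 2 → c A (P A k) ≡ 0ℤ
      self zero          _ = inside-≤ {i A} {j A} (ℕ.≤-reflexive (sym (i≡ A)))
      self (suc zero)    _ = inside-≥ {i A} {j A} (ℕ.≤-reflexive (j≡ A))
      self (suc (suc k)) (s≤s (s≤s ()))
      case : Dec (A ≡ D) → _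
      case (no A≢D)   = by A≢D _ refl
      case (yes refl) = trans (level-refl A k word) (sym (cong₂ (λ x y → x ℤ.+ (y ℤ.+ y)) (δ-refl _≟_ A) (self k k<2)))

  -- Twice the indicator function of the arc from the first to the second
  -- occurrence of A, with half the value at its ends, evaluated at the
  -- occurrences of D.
  h : Maybe Letter → Letter → ℕ → ℤ
  h nothing  D k = 1ℤ
  h (just A) D k = level A D k word

  -- An integral witness of x = ½ ∑ det(X D, Y D) |D|. The halves `N` belong to the data, since x is
  -- not determined by its double in `π`.
  record Represents (x : Expr τ) (X Y : Letter → ℕ → ℤ) : Set a where
    constructor represents
    field
      N       : Letter → ℤ
      doubled : ∀ D → N D ℤ.+ N D ≡ det (X D) (Y D)
      equal   : x ≋ Φ N

  private
    h₀ : ∀ A D → level A D 0 word ≡ δ _≟_ A D ℤ.+ (c A (i D) ℤ.+ c A (i D))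
    h₀ A D = subst (λ t → level A D 0 word ≡ δ _≟_ A D ℤ.+ (c A t ℤ.+ c A t)) (sym (i≡ D)) (level-inside A D 0 0<2)

    h₁ : ∀ A D → level A D 1 word ≡ δ _≟_ A D ℤ.+ (c A (j D) ℤ.+ c A (j D))
    h₁ A D = subst (λ t → level A D 1 word ≡ δ _≟_ A D ℤ.+ (c A t ℤ.+ c A t)) (sym (j≡ D)) (level-inside A D 1 1<2)

    if-∧ : ∀ b b′ x → (if b ∧ b′ then x else 𝟘) ≋
           ((if b then 1ℤ else 0ℤ) ℤ.* (if b′ then 1ℤ else 0ℤ)) • x
    if-∧ false b′    x = ∼-refl
    if-∧ true  false x = ∼-refl
    if-∧ true  true  x = ∼-sym (1• x)

    ∘ʷ-Φ : ∀ A B → _∘ʷ_ τ w A B ≋ Φ (λ D → c A (i D) ℤ.* c B (j D))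
    ∘ʷ-Φ A B = ∑-cong λ D →
      if-∧ (does (inside? (i A) (j A) (i D))) (does (inside? (i B) (j B) (j D))) (gen ∣ D ∣)

    n-h : ∀ A D → n A D ≡ c A (i D) ℤ.- c A (j D)
    n-h A D = case (A ≟ D)
      where
      case : Dec (A ≡ D) → _
      case (no A≢D) = proj₁ (n-inside A≢D)
      case (yes refl) = trans (n-diag A) (sym (cong₂ ℤ._-_
        (inside-≤ {i A} {j A} {i A} ℕ.≤-refl) (inside-≥ {i A} {j A} {j A} ℕ.≤-refl)))

    half₁ : ∀ δ a₀ a₁ → (a₀ ℤ.- a₁) ℤ.+ (a₀ ℤ.- a₁) ≡ (δ ℤ.+ (a₀ ℤ.+ a₀)) ℤ.* 1ℤ ℤ.- (δ ℤ.+ (a₁ ℤ.+ a₁)) ℤ.* 1ℤ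
    half₁ = solve-∀

    half₂ : ∀ δ a₀ a₁ → ℤ.- (a₀ ℤ.- a₁) ℤ.+ ℤ.- (a₀ ℤ.- a₁) ≡
            1ℤ ℤ.* (δ ℤ.+ (a₁ ℤ.+ a₁)) ℤ.- 1ℤ ℤ.* (δ ℤ.+ (a₀ ℤ.+ a₀))
    half₂ = solve-∀

    -- The determinant of the functions δ + 2c. The product of the two deltas cancels, and
    -- everything that remains is even: 4 times the determinant of the indicators, and twice the
    -- terms with a single delta.
    half₃ : ∀ α β a₀ a₁ b₀ b₁ →
      let u = a₀ ℤ.* b₁
          v = b₀ ℤ.* a₁
          N = ((u ℤ.- v) ℤ.+ (u ℤ.- v)) ℤ.+ (α ℤ.* (b₁ ℤ.- b₀) ℤ.+ β ℤ.* (a₀ ℤ.- a₁)) in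
      N ℤ.+ N ≡ (α ℤ.+ (a₀ ℤ.+ a₀)) ℤ.* (β ℤ.+ (b₁ ℤ.+ b₁)) ℤ.- (α ℤ.+ (a₁ ℤ.+ a₁)) ℤ.* (β ℤ.+ (b₀ ℤ.+ b₀))
    half₃ = solve-∀

    δ-replace : ∀ A D {k l} → (A ≡ D → k ≡ l) → δ _≟_ A D ℤ.* k ≡ δ _≟_ A D ℤ.* l
    δ-replace A D {k} {l} k≡l = case (A ≟ D)
      where
      case : Dec (A ≡ D) → _
      case (yes A≡D) = cong (λ k → δ _≟_ A D ℤ.* k) (k≡l A≡D)
      case (no  A≢D) = trans (cong (ℤ._* k) (δ-≢ _≟_ A≢D)) (sym (cong (ℤ._* l) (δ-≢ _≟_ A≢D)))

  -- For two letters, the terms |D| of e_w come from twice the difference of `∘ʷ`, and additionally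
  -- from n(A, B)(|A| + |B|) if D is A or B. By `n-inside`, n(A, B) has two expressions, by the ends
  -- of A in the arc of B and by the ends of B in the arc of A. The first is used at D = A and the
  -- second at D = B, which produces the mixed terms of `half₃`.
  e-represents : ∀ x y → Represents (eʷ τ w x y) (h x) (h y)
  e-represents nothing  nothing  = represents (λ _ → 0ℤ) (λ _ → refl) (∼-sym (Φ-0 λ _ → refl))
  e-represents (just A) nothing  = represents (n A)
    (λ D → trans (cong (λ k → k ℤ.+ k) (n-h A D)) (trans (half₁ (δ _≟_ A D) (c A (i D)) (c A (j D)))
      (sym (cong₂ (λ x y → x ℤ.* 1ℤ ℤ.- y ℤ.* 1ℤ) (h₀ A D) (h₁ A D)))))
    ∼-refl
  e-represents nothing  (just A) = represents (λ D → ℤ.- n A D)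
    (λ D → trans (cong (λ k → ℤ.- k ℤ.+ ℤ.- k) (n-h A D)) (trans (half₂ (δ _≟_ A D) (c A (i D)) (c A (j D)))
      (sym (cong₂ (λ x y → 1ℤ ℤ.* x ℤ.- 1ℤ ℤ.* y) (h₁ A D) (h₀ A D)))))
    (∼-sym (Φ-neg (n A)))
  e-represents (just A) (just B) = represents N N≡ e≋
    where
    u v m N : Letter → ℤ
    u D = c A (i D) ℤ.* c B (j D)
    v D = c B (i D) ℤ.* c A (j D)
    m D = u D ℤ.- v D
    N D = (m D ℤ.+ m D) ℤ.+ (δ _≟_ A D ℤ.* n A B ℤ.+ δ _≟_ B D ℤ.* n A B)
    n-A : ∀ D → A ≡ D → n A B ≡ c B (j D) ℤ.- c B (i D)
    n-A D refl = case (A ≟ B)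
      where
      case : Dec (A ≡ B) → _
      case (no A≢B)   = proj₂ (n-inside A≢B)
      case (yes refl) = trans (n-diag A) (sym (cong₂ ℤ._-_
        (inside-≥ {i A} {j A} {j A} ℕ.≤-refl) (inside-≤ {i A} {j A} {i A} ℕ.≤-refl)))
    n-B : ∀ D → B ≡ D → n A B ≡ c A (i D) ℤ.- c A (j D)
    n-B D refl = n-h A B
    N≡ : ∀ D → N D ℤ.+ N D ≡ det (h (just A) D) (h (just B) D)
    N≡ D = begin
      N D ℤ.+ N D
        ≡⟨ cong₂ (λ x y → ((m D ℤ.+ m D) ℤ.+ (x ℤ.+ y)) ℤ.+ ((m D ℤ.+ m D) ℤ.+ (x ℤ.+ y)))
             (δ-replace A D (n-A D)) (δ-replace B D (n-B D)) ⟩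
      _ ≡⟨ half₃ (δ _≟_ A D) (δ _≟_ B D) (c A (i D)) (c A (j D)) (c B (i D)) (c B (j D)) ⟩
      _ ≡⟨ cong₂ ℤ._-_ (cong₂ ℤ._*_ (h₀ A D) (h₁ B D)) (cong₂ ℤ._*_ (h₁ A D) (h₀ B D)) ⟨
      det (h (just A) D) (h (just B) D) ∎
      where open ≡-Reasoning
    open import Relation.Binary.Reasoning.Setoid π.setoid
    Φm : Φ m ≋ _∘ʷ_ τ w A B ⊹ ⊖ _∘ʷ_ τ w B A
    Φm = ∼-trans (Φ-+ u (λ D → ℤ.- v D))
      (∼-sym (⊹-cong (∘ʷ-Φ A B) (∼-trans (⊖-cong (∘ʷ-Φ B A)) (∼-sym (Φ-neg v)))))
    e≋ : eʷ τ w (just A) (just B) ≋ Φ N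
    e≋ = ∼-sym (begin
      Φ N
        ≈⟨ Φ-+ (λ D → m D ℤ.+ m D) (λ D → δ _≟_ A D ℤ.* n A B ℤ.+ δ _≟_ B D ℤ.* n A B) ⟩
      Φ (λ D → m D ℤ.+ m D) ⊹ Φ (λ D → δ _≟_ A D ℤ.* n A B ℤ.+ δ _≟_ B D ℤ.* n A B)
        ≈⟨ ⊹-cong (Φ-+ m m) (Φ-+ (λ D → δ _≟_ A D ℤ.* n A B) (λ D → δ _≟_ B D ℤ.* n A B)) ⟩
      (Φ m ⊹ Φ m) ⊹ (Φ (λ D → δ _≟_ A D ℤ.* n A B) ⊹ Φ (λ D → δ _≟_ B D ℤ.* n A B))
        ≈⟨ ⊹-cong (⊹-cong Φm (∼-trans Φm (∼-sym (π.identityʳ _)))) (⊹-cong (Φ-δ A (n A B)) (Φ-δ B (n A B))) ⟩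
      (ℤ.+ 2) • (_∘ʷ_ τ w A B ⊹ ⊖ _∘ʷ_ τ w B A) ⊹ (n A B • gen ∣ A ∣ ⊹ n A B • gen ∣ B ∣)
        ≈⟨ ⊹-cong ∼-refl (•-distrib-⊹ (n A B) _ _) ⟨
      eʷ τ w (just A) (just B) ∎)

  -- X is the linear extension of h at the vector x.
  data Profile : (Maybe Letter → ℤ) → (Letter → ℕ → ℤ) → Set where
    basis : ∀ A → Profile (δ (Maybe.≡-dec _≟_) A) (h A)
    add   : ∀ {x y X Y} → Profile x X → Profile y Y →
            Profile (λ A → x A ℤ.+ y A) (λ D k → X D k ℤ.+ Y D k)
    neg   : ∀ {x X} → Profile x X → Profile (λ A → ℤ.- x A) (λ D k → ℤ.- X D k)
    resp  : ∀ {x y X} → x ≗ y → Profile x X → Profile y X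

  null-profile : ∀ {x} → (∀ A → 0ℤ ≡ x A) → Profile x (λ _ _ → 0ℤ)
  null-profile 0≡x = resp (λ A → trans (ℤ.+-inverseʳ (δ (Maybe.≡-dec _≟_) nothing A)) (0≡x A))
    (add (basis nothing) (neg (basis nothing)))

  scale-profile : ∀ s {x X} → Profile x X → Profile (scale s ∘ x) (λ D k → scale s (X D k))
  scale-profile Sign.+ p = p
  scale-profile Sign.- p = neg p

  private
    open Pairing (pairing τ w) using (ẽ)
    open Form (pairing τ w)

    rep-+ : ∀ {x y X X′ Y} → Represents x X Y → Represents y X′ Y →
            Represents (x ⊹ y) (λ D k → X D k ℤ.+ X′ D k) Y
    rep-+ {X = X} {X′} {Y} (represents M M≡ x≋) (represents N N≡ y≋) = represents (λ D → M D ℤ.+ N D)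
      (λ D → trans (regroup (M D) (N D)) (trans (cong₂ ℤ._+_ (M≡ D) (N≡ D))
        (expand (X D 0) (X D 1) (X′ D 0) (X′ D 1) (Y D 0) (Y D 1))))
      (∼-trans (⊹-cong x≋ y≋) (∼-sym (Φ-+ M N)))
      where
      regroup : ∀ m n → (m ℤ.+ n) ℤ.+ (m ℤ.+ n) ≡ (m ℤ.+ m) ℤ.+ (n ℤ.+ n)
      regroup = solve-∀
      expand : ∀ x₀ x₁ x₀′ x₁′ y₀ y₁ → (x₀ ℤ.* y₁ ℤ.- x₁ ℤ.* y₀) ℤ.+ (x₀′ ℤ.* y₁ ℤ.- x₁′ ℤ.* y₀) ≡
               (x₀ ℤ.+ x₀′) ℤ.* y₁ ℤ.- (x₁ ℤ.+ x₁′) ℤ.* y₀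
      expand = solve-∀

    rep-neg : ∀ {x X Y} → Represents x X Y → Represents (⊖ x) (λ D k → ℤ.- X D k) Y
    rep-neg {X = X} {Y} (represents M M≡ x≋) = represents (λ D → ℤ.- M D)
      (λ D → trans (sym (ℤ.neg-distrib-+ (M D) (M D))) (trans (cong ℤ.-_ (M≡ D))
        (expand (X D 0) (X D 1) (Y D 0) (Y D 1))))
      (∼-trans (⊖-cong x≋) (∼-sym (Φ-neg M)))
      where
      expand : ∀ x₀ x₁ y₀ y₁ → ℤ.- (x₀ ℤ.* y₁ ℤ.- x₁ ℤ.* y₀) ≡ ℤ.- x₀ ℤ.* y₁ ℤ.- ℤ.- x₁ ℤ.* y₀
      expand = solve-∀

    -- The determinant changes its sign when its arguments are exchanged. Hence additivity on the
    -- right follows from additivity on the left by flipping before and after.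
    rep-flip : ∀ {x X Y} → Represents x X Y → Represents (⊖ x) Y X
    rep-flip {X = X} {Y} (represents M M≡ x≋) = represents (λ D → ℤ.- M D)
      (λ D → trans (sym (ℤ.neg-distrib-+ (M D) (M D))) (trans (cong ℤ.-_ (M≡ D))
        (expand (X D 0) (X D 1) (Y D 0) (Y D 1))))
      (∼-trans (⊖-cong x≋) (∼-sym (Φ-neg M)))
      where
      expand : ∀ x₀ x₁ y₀ y₁ → ℤ.- (x₀ ℤ.* y₁ ℤ.- x₁ ℤ.* y₀) ≡ y₀ ℤ.* x₁ ℤ.- y₁ ℤ.* x₀
      expand = solve-∀

    rep-≋ : ∀ {x y X Y} → x ≋ y → Represents x X Y → Represents y X Y
    rep-≋ x≋y (represents M M≡ x≋) = represents M M≡ (∼-trans (∼-sym x≋y) x≋)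

    rep-+ʳ : ∀ {x y X Y Y′} → Represents x X Y → Represents y X Y′ →
             Represents (x ⊹ y) X (λ D k → Y D k ℤ.+ Y′ D k)
    rep-+ʳ r r′ = rep-≋ (∼-trans (⊖-cong (⁻¹-∙-comm _ _)) (⁻¹-involutive _))
      (rep-flip (rep-+ (rep-flip r) (rep-flip r′)))

    rep-negʳ : ∀ {x X Y} → Represents x X Y → Represents (⊖ x) X (λ D k → ℤ.- Y D k)
    rep-negʳ r = rep-≋ (⊖-cong (⁻¹-involutive _)) (rep-flip (rep-neg (rep-flip r)))

    ẽ-represents′ : ∀ A {y Y} → Profile y Y → Represents (ẽ (δ (Maybe.≡-dec _≟_) A) y) (h A) Y
    ẽ-represents′ A (basis B)         = rep-≋ (∼-sym (ẽ-basis A B)) (e-represents A B)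
    ẽ-represents′ A (add {x} {y} p q) =
      rep-≋ (∼-sym (ẽ-+ʳ (δ (Maybe.≡-dec _≟_) A) x y)) (rep-+ʳ (ẽ-represents′ A p) (ẽ-represents′ A q))
    ẽ-represents′ A (neg {x} p)       =
      rep-≋ (∼-sym (ẽ-negʳ (δ (Maybe.≡-dec _≟_) A) x)) (rep-negʳ (ẽ-represents′ A p))
    ẽ-represents′ A (resp {x} {y} x≗y p)  = rep-≋
      (ẽ-cong {δ (Maybe.≡-dec _≟_) A} {y = x} {y} (λ _ → refl) x≗y) (ẽ-represents′ A p)

  ẽ-represents : ∀ {x X y Y} → Profile x X → Profile y Y → Represents (ẽ x y) X Y
  ẽ-represents         (basis A)          q = ẽ-represents′ A q
  ẽ-represents {y = z} (add {x} {y} p p′) q =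
    rep-≋ (∼-sym (ẽ-+ˡ x y z)) (rep-+ (ẽ-represents p q) (ẽ-represents p′ q))
  ẽ-represents {y = z} (neg {x} p)        q = rep-≋ (∼-sym (ẽ-negˡ x z)) (rep-neg (ẽ-represents p q))
  ẽ-represents {y = z} (resp {x} {y} x≗y p)   q =
    rep-≋ (ẽ-cong {x} {y} {z} {z} x≗y (λ _ → refl)) (ẽ-represents p q)

-- Isomorphisms, opposites and products

det-cong : ∀ {X X′ Y Y′} → (∀ k → k < 2 → X k ≡ X′ k) → (∀ k → k < 2 → Y k ≡ Y′ k) →
           det X Y ≡ det X′ Y′
det-cong X≡ Y≡ = cong₂ ℤ._-_
  (cong₂ ℤ._*_ (X≡ 0 (s≤s z≤n)) (Y≡ 1 (s≤s (s≤s z≤n))))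
  (cong₂ ℤ._*_ (X≡ 1 (s≤s (s≤s z≤n))) (Y≡ 0 (s≤s z≤n)))

det-reverse : ∀ X Y → det (λ k → X (1 ℕ.∸ k)) (λ k → Y (1 ℕ.∸ k)) ≡ ℤ.- det X Y
det-reverse X Y = lemma (X 0) (X 1) (Y 0) (Y 1)
  where
  lemma : ∀ x₀ x₁ y₀ y₁ → x₁ ℤ.* y₀ ℤ.- x₀ ℤ.* y₁ ≡ ℤ.- (x₀ ℤ.* y₁ ℤ.- x₁ ℤ.* y₀)
  lemma = solve-∀

-- Read from the other end of the word, the count b of a letter that occurs twice becomes 2 - b.
-- Being equal to 1 is not affected, so an arc is the same read backwards.
value-reflect : ∀ b b′ → b′ + b ≡ 2 → value b′ ≡ value b
value-reflect 0 b′ eq = cong value (trans (sym (ℕ.+-identityʳ b′)) eq)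
value-reflect 1 b′ eq = cong value (ℕ.+-cancelʳ-≡ 1 b′ 1 eq)
value-reflect 2 b′ eq = cong value (ℕ.+-cancelʳ-≡ 2 b′ 0 eq)
value-reflect (suc (suc (suc b))) b′ eq =
  contradiction (trans (sym (ℕ.+-suc b′ (2 + b))) eq) λ eq′ →
    ℕ.1+n≰n (ℕ.≤-trans (ℕ.m≤n+m 3 (b + b′)) (ℕ.≤-reflexive (trans (lemma b b′) eq)))
  where
  lemma : ∀ b b′ → b + b′ + 3 ≡ b′ + suc (suc (suc b))
  lemma = ℕ-Solver.solve-∀

module _ {X : Set} (_≟_ : DecidableEquality X) where
  open Words _≟_

  level-reverse : ∀ A D k w → occ A w ≡ 2 → occ D w ≡ 2 → k < 2 →
                  level A D k (reverse w) ≡ level A D (1 ℕ.∸ k) w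
  level-reverse A D k w A∈ D∈ k<2 with A ≟ D
  ... | yes _   = refl
  ... | no  A≢D = value-reflect (before A D (1 ℕ.∸ k) w) (before A D k (reverse w)) (begin
    before A D k (reverse w) + before A D (1 ℕ.∸ k) w
      ≡⟨ ℕ.+-identityʳ _ ⟨
    before A D k (reverse w) + before A D (1 ℕ.∸ k) w + 0
      ≡⟨ cong (before A D k (reverse w) + before A D (1 ℕ.∸ k) w +_) (ind-≢ A≢D) ⟨
    before A D k (reverse w) + before A D (1 ℕ.∸ k) w + ind A D
      ≡⟨ before-reverse A D (1 ℕ.∸ k) k w (trans (cong suc (ℕ.m∸n+n≡m (ℕ.s≤s⁻¹ k<2))) (sym D∈)) ⟩
    occ A w
      ≡⟨ A∈ ⟩
    2 ∎)
    where open ≡-Reasoning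

  before-prefix : ∀ F D u {r r′} → (∀ k → before F D k r ≡ before F D k r′) →
                  ∀ k → before F D k (u ++ r) ≡ before F D k (u ++ r′)
  before-prefix F D []      eq k       = eq k
  before-prefix F D (C ∷ u) eq zero    with does (D ≟ C)
  ... | true  = refl
  ... | false = cong (ind F C +_) (before-prefix F D u eq 0)
  before-prefix F D (C ∷ u) eq (suc k) with does (D ≟ C)
  ... | true  = cong (ind F C +_) (before-prefix F D u eq k)
  ... | false = cong (ind F C +_) (before-prefix F D u eq (suc k))

  before-swap : ∀ F {D A B r r′} → D ≢ A → D ≢ B → (∀ k → before F D k r ≡ before F D k r′) →
                ∀ k → before F D k (A ∷ B ∷ r) ≡ before F D k (B ∷ A ∷ r′)
  before-swap F {D} {A} {B} {r} {r′} D≢A D≢B eq k = begin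
    before F D k (A ∷ B ∷ r)                ≡⟨ before-miss F k (B ∷ r) D≢A ⟩
    ind F A + before F D k (B ∷ r)          ≡⟨ cong (ind F A +_) (before-miss F k r D≢B) ⟩
    ind F A + (ind F B + before F D k r)    ≡⟨ cong (λ b → ind F A + (ind F B + b)) (eq k) ⟩
    ind F A + (ind F B + before F D k r′)   ≡⟨ ℕ.+-assoc (ind F A) _ _ ⟨
    ind F A + ind F B + before F D k r′     ≡⟨ cong (_+ before F D k r′) (ℕ.+-comm (ind F A) _) ⟩
    ind F B + ind F A + before F D k r′     ≡⟨ ℕ.+-assoc (ind F B) _ _ ⟩
    ind F B + (ind F A + before F D k r′)   ≡⟨ cong (ind F B +_) (before-miss F k r′ D≢A) ⟨
    ind F B + before F D k (A ∷ r′)         ≡⟨ before-miss F k (A ∷ r′) D≢B ⟨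
    before F D k (B ∷ A ∷ r′)               ∎
    where open ≡-Reasoning

  before-skip : ∀ F {D u} k v → occ D u ≡ 0 → before F D k (u ++ v) ≡ occ F u + before F D k v
  before-skip F {D} {u} k v D∉ =
    trans (cong (λ m → before F D (m + k) (u ++ v)) (sym D∉)) (before-++ʳ F D k u v)

module _ {a} {α : Set a} (τ : α → α) (τ-involutive : Involutive _≡_ τ) where
  open Coefficients τ
  open Bordisms τ τ-involutive

  isomorphism-bordism : ∀ {w w′} → Isomorphism τ w w′ → Bordism (pairing τ w) (pairing τ w′)
  isomorphism-bordism {w} {w′} iso = isometry f preserves e≋
    where
    open Isomorphism iso
    module w = Nanoword w
    module w′ = Nanoword w′
    module F = NanowordForm τ w
    module F′ = NanowordForm τ w′
    open Inverse f using (to; from)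
    to-injective : Injective _≡_ _≡_ to
    to-injective eq = trans (sym (Inverse.inverseʳ f refl)) (trans (cong from eq) (Inverse.inverseʳ f refl))
    h≡ : ∀ x D k → F′.h (Maybe.map to x) (to D) k ≡ F.h x D k
    h≡ nothing  D k = refl
    h≡ (just A) D k = trans (cong (Words.level w′._≟_ (to A) (to D) k) word≡)
                            (level-map w._≟_ w′._≟_ to-injective A D k w.word)
    e≋ : ∀ x y → eʷ τ w x y ≋ eʷ τ w′ (Maybe.map to x) (Maybe.map to y)
    e≋ x y with F.e-represents x y | F′.e-represents (Maybe.map to x) (Maybe.map to y)
    ... | F.represents N N≡ x≋ | F′.represents N′ N′≡ x′≋ = ∼-trans x≋ (∼-sym (∼-trans x′≋ (∼-trans
      (∑-bijection w′.letters w.letters f (λ D → N′ D • gen w′.∣ D ∣))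
      (Summation.∑-cong w.letters {λ D → N′ (to D) • gen w′.∣ to D ∣} {λ D → N D • gen w.∣ D ∣} λ D →
        π.reflexive (cong₂ (λ k c → k • gen c) {N′ (to D)} {N D} (double-injective (trans (N′≡ (to D)) (trans
          (det-cong (λ k _ → h≡ x D k) (λ k _ → h≡ y D k)) (sym (N≡ D)))))
        (preserves D))))))

  -- Reversal keeps all arcs and exchanges the two occurrences of every letter D, so each
  -- determinant changes its sign.
  reverse-bordism : ∀ w → Bordism (pairing τ (w ⁻ʷ)) (_⁻ᵖ τ (pairing τ w))
  reverse-bordism w = isometry (↔-id _) (λ _ → refl) e≋
    where
    open Nanoword w
    module F = NanowordForm τ w
    module F⁻ = NanowordForm τ (w ⁻ʷ)
    h≡ : ∀ x D k → k < 2 → F⁻.h x D k ≡ F.h x D (1 ℕ.∸ k)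
    h≡ nothing  D k k<2 = refl
    h≡ (just A) D k k<2 = level-reverse _≟_ A D k word (F.occ≡2 A) (F.occ≡2 D) k<2
    e≋ : ∀ x y → eʷ τ (w ⁻ʷ) x y ≋ ⊖ eʷ τ w (Maybe.map id x) (Maybe.map id y)
    e≋ x y rewrite Maybe.map-id x | Maybe.map-id y with F.e-represents x y | F⁻.e-represents x y
    ... | F.represents N N≡ x≋ | F⁻.represents N′ N′≡ x′≋ = ∼-trans x′≋ (∼-trans
      (F.Φ-cong {F = N′} {G = λ D → ℤ.- N D} λ D → double-injective (trans (N′≡ D) (trans
        (det-cong (h≡ x D) (h≡ y D)) (trans (det-reverse (F.h x D) (F.h y D))
        (trans (cong ℤ.-_ (sym (N≡ D))) (ℤ.neg-distrib-+ (N D) (N D)))))))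
      (∼-trans (F.Φ-neg N) (⊖-cong (∼-sym x≋))))

  module _ (v w : Nanoword α) where
    private
      module v = Nanoword v
      module w = Nanoword w
      module F = NanowordForm τ (v ·ʷ w)
      open Nanoword (v ·ʷ w) using (Letter; letters; word; _≟_)
      open Words _≟_

      -- A pairing extended by 0 to a further element, which stands for the
      -- letters of the other factor.
      module Extended (u : Nanoword α) where
        open NanowordForm τ u public
        Arg = Maybe (Maybe (Nanoword.Letter u))
        e⁺ : Arg → Arg → Expr τ
        e⁺ (just x) (just y) = eʷ τ u x y
        e⁺ (just x) nothing  = 𝟘
        e⁺ nothing  y        = 𝟘
        h⁺ : Arg → Nanoword.Letter u → ℕ → ℤ
        h⁺ nothing  D k = 0ℤ
        h⁺ (just x) D k = h x D k
        represents⁺ : ∀ x y → Represents (e⁺ x y) (h⁺ x) (h⁺ y)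
        represents⁺ (just x) (just y) = e-represents x y
        represents⁺ (just x) nothing  = represents (λ _ → 0ℤ)
          (λ D → sym (cong₂ ℤ._-_ (ℤ.*-zeroʳ (h x D 0)) (ℤ.*-zeroʳ (h x D 1)))) (∼-sym (Φ-0 λ _ → refl))
        represents⁺ nothing  y        = represents (λ _ → 0ℤ) (λ D → refl) (∼-sym (Φ-0 λ _ → refl))

      module V = Extended v
      module W = Extended w

      r₁ : Maybe Letter → V.Arg
      r₁ nothing         = just nothing
      r₁ (just (inj₁ A)) = just (just A)
      r₁ (just (inj₂ B)) = nothing
      r₂ : Maybe Letter → W.Arg
      r₂ nothing         = just nothing
      r₂ (just (inj₁ A)) = nothing
      r₂ (just (inj₂ B)) = just (just B)

      v∙ w∙ : List Letter
      v∙ = map inj₁ v.word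
      w∙ = map inj₂ w.word

      occ₁ : ∀ A → occ (inj₁ A) v∙ ≡ 2
      occ₁ A = trans (occ-map v._≟_ _≟_ Sum.inj₁-injective A v.word) (V.occ≡2 A)
      occ₂ : ∀ B → occ (inj₂ B) w∙ ≡ 2
      occ₂ B = trans (occ-map w._≟_ _≟_ Sum.inj₂-injective B w.word) (W.occ≡2 B)
      occ₁₂ : ∀ A → occ (inj₁ A) w∙ ≡ 0
      occ₁₂ A = occ-map-∉ _≟_ (λ _ ()) w.word
      occ₂₁ : ∀ B → occ (inj₂ B) v∙ ≡ 0
      occ₂₁ B = occ-map-∉ _≟_ (λ _ ()) v.word

      before₁ : ∀ A D k → k < 2 → before A (inj₁ D) k word ≡ before A (inj₁ D) k v∙
      before₁ A D k k<2 = before-++ˡ A (inj₁ D) k v∙ w∙ (subst (k <_) (sym (occ₁ D)) k<2)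

      before₂ : ∀ A D k → before A (inj₂ D) k word ≡ occ A v∙ + before A (inj₂ D) k w∙
      before₂ A D k = before-skip _≟_ A {u = v∙} k w∙ (occ₂₁ D)

      level-before : ∀ A D k {u u′} → before A D k u ≡ before A D k u′ → level A D k u ≡ level A D k u′
      level-before A D k eq = cong (λ b → if does (A ≟ D) then 1ℤ else value b) eq

      -- Seen from one factor, an arc of the other one is entirely ahead or entirely behind: the
      -- count is 0 here and 2 in `h₂`, and `value` vanishes at both. This is why the mixed blocks
      -- of the form are 0.
      h₁ : ∀ x D k → k < 2 → F.h x (inj₁ D) k ≡ V.h⁺ (r₁ x) D k
      h₁ nothing         D k k<2 = refl
      h₁ (just (inj₁ A)) D k k<2 = trans
        (level-before (inj₁ A) (inj₁ D) k {word} {v∙} (before₁ (inj₁ A) D k k<2))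
        (level-map v._≟_ _≟_ Sum.inj₁-injective A D k v.word)
      h₁ (just (inj₂ B)) D k k<2 = trans (level-≢ k word λ ()) (cong value
        (trans (before₁ (inj₂ B) D k k<2) (before-∉ (inj₁ D) k v∙ (occ₂₁ B))))

      h₂ : ∀ x D k → k < 2 → F.h x (inj₂ D) k ≡ W.h⁺ (r₂ x) D k
      h₂ nothing         D k k<2 = refl
      h₂ (just (inj₁ A)) D k k<2 = trans (level-≢ k word λ ()) (cong value
        (trans (before₂ (inj₁ A) D k) (cong₂ _+_ (occ₁ A) (before-∉ (inj₂ D) k w∙ (occ₁₂ A)))))
      h₂ (just (inj₂ B)) D k k<2 = trans
        (level-before (inj₂ B) (inj₂ D) k {word} {w∙} (trans (before₂ (inj₂ B) D k)
          (cong (_+ before (inj₂ B) (inj₂ D) k w∙) (occ₂₁ B))))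
        (level-map w._≟_ _≟_ Sum.inj₂-injective B D k w.word)

      e⊕ : ∀ x y → V.e⁺ (r₁ x) (r₁ y) ⊹ W.e⁺ (r₂ x) (r₂ y) ≋
           Pairing.e (_⊕_ τ (pairing τ v) (pairing τ w))
             (Maybe.map id x) (Maybe.map id y)
      e⊕ nothing         nothing         = ∼-refl
      e⊕ nothing         (just (inj₁ B)) = π.identityʳ _
      e⊕ nothing         (just (inj₂ B)) = identityˡ _
      e⊕ (just (inj₁ A)) nothing         = π.identityʳ _
      e⊕ (just (inj₂ A)) nothing         = identityˡ _
      e⊕ (just (inj₁ A)) (just (inj₁ B)) = π.identityʳ _
      e⊕ (just (inj₁ A)) (just (inj₂ B)) = identityˡ _
      e⊕ (just (inj₂ A)) (just (inj₁ B)) = identityˡ _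
      e⊕ (just (inj₂ A)) (just (inj₂ B)) = identityˡ _

      e≋ : ∀ x y → eʷ τ (v ·ʷ w) x y ≋ V.e⁺ (r₁ x) (r₁ y) ⊹ W.e⁺ (r₂ x) (r₂ y)
      e≋ x y with F.e-represents x y | V.represents⁺ (r₁ x) (r₁ y) | W.represents⁺ (r₂ x) (r₂ y)
      ... | F.represents N N≡ N≋ | V.represents N₁ N₁≡ N₁≋ | W.represents N₂ N₂≡ N₂≋ =
        ∼-trans N≋ (∼-trans (∑-⊎ v.letters w.letters (λ D → N D • gen (Nanoword.∣_∣ (v ·ʷ w) D))) (⊹-cong
          (∼-trans (V.Φ-cong {N ∘ inj₁} {N₁} λ D → double-injective (trans (N≡ (inj₁ D))
            (trans (det-cong (h₁ x D) (h₁ y D)) (sym (N₁≡ D))))) (∼-sym N₁≋))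
          (∼-trans (W.Φ-cong {N ∘ inj₂} {N₂} λ D → double-injective (trans (N≡ (inj₂ D))
            (trans (det-cong (h₂ x D) (h₂ y D)) (sym (N₂≡ D))))) (∼-sym N₂≋))))

    product-bordism : Bordism (pairing τ (v ·ʷ w)) (_⊕_ τ (pairing τ v) (pairing τ w))
    product-bordism = isometry (↔-id _) (λ _ → refl) (λ x y → ∼-trans (e≋ x y) (e⊕ x y))

-- The third homotopy move

module ThirdMove {X : Set} (_≟_ : DecidableEquality X) (A B C : X) (x y z t : List X)
                 (A≢B : A ≢ B) (A≢C : A ≢ C) (B≢C : B ≢ C) where
  open Words _≟_

  w₁ w₂ : List X
  w₁ = x ++ A ∷ B ∷ y ++ A ∷ C ∷ z ++ B ∷ C ∷ t
  w₂ = x ++ B ∷ A ∷ y ++ C ∷ A ∷ z ++ C ∷ B ∷ t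

  corner : Fin 3 → X
  corner 0F = A
  corner 1F = B
  corner 2F = C

  corner-injective : Injective _≡_ _≡_ corner
  corner-injective {0F} {0F} _  = refl
  corner-injective {0F} {1F} eq = contradiction eq A≢B
  corner-injective {0F} {2F} eq = contradiction eq A≢C
  corner-injective {1F} {0F} eq = contradiction (sym eq) A≢B
  corner-injective {1F} {1F} _  = refl
  corner-injective {1F} {2F} eq = contradiction eq B≢C
  corner-injective {2F} {0F} eq = contradiction (sym eq) A≢C
  corner-injective {2F} {1F} eq = contradiction (sym eq) B≢C
  corner-injective {2F} {2F} _  = refl

  corner-ind : ∀ c d → ind (corner c) (corner d) ≡ Words.ind Fin._≟_ c d
  corner-ind = ind-map Fin._≟_ _≟_ corner-injective

  -- An element of S is one of A, B, C, or another letter, given by its numbers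
  -- of occurrences in x, y and z, or s.
  data Kind : Set where
    base  : Kind
    other : ℕ → ℕ → ℕ → Kind
    at    : Fin 3 → Kind

  same : Kind → Fin 3 → Bool
  same base          c = true
  same (other _ _ _) c = false
  same (at d)        c = does (d Fin.≟ c)

  occˣ occʸ occᶻ : Kind → ℕ
  occˣ base          = 0
  occˣ (other X Y Z) = X
  occˣ (at _)        = 0
  occʸ base          = 0
  occʸ (other X Y Z) = Y
  occʸ (at _)        = 0
  occᶻ base          = 0
  occᶻ (other X Y Z) = Z
  occᶻ (at _)        = 0

  -- The numbers of letters F before the occurrences of A, B and C, where X, Y, Z
  -- letters F lie in x, y, z and a, b, c tell whether F is A, B, C.
  count₁ count₂ : (X Y Z a b c : ℕ) → Fin 3 → ℕ → ℕ
  count₁ X Y Z a b c 0F 0 = X + 0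
  count₁ X Y Z a b c 0F _ = X + (a + (b + (Y + 0)))
  count₁ X Y Z a b c 1F 0 = X + (a + 0)
  count₁ X Y Z a b c 1F _ = X + (a + (b + (Y + (a + (c + (Z + 0))))))
  count₁ X Y Z a b c 2F 0 = X + (a + (b + (Y + (a + 0))))
  count₁ X Y Z a b c 2F _ = X + (a + (b + (Y + (a + (c + (Z + (b + 0)))))))
  count₂ X Y Z a b c 0F 0 = X + (b + 0)
  count₂ X Y Z a b c 0F _ = X + (b + (a + (Y + (c + 0))))
  count₂ X Y Z a b c 1F 0 = X + 0
  count₂ X Y Z a b c 1F _ = X + (b + (a + (Y + (c + (a + (Z + (c + 0)))))))
  count₂ X Y Z a b c 2F 0 = X + (b + (a + (Y + 0)))
  count₂ X Y Z a b c 2F _ = X + (b + (a + (Y + (c + (a + (Z + 0))))))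

  indᴷ : Kind → Fin 3 → ℕ
  indᴷ κ c = if same κ c then 1 else 0

  table : ((X Y Z a b c : ℕ) → Fin 3 → ℕ → ℕ) → Kind → Fin 3 → ℕ → ℤ
  table count κ c k = if same κ c then 1ℤ else
    value (count (occˣ κ) (occʸ κ) (occᶻ κ) (indᴷ κ 0F) (indᴷ κ 1F) (indᴷ κ 2F) c k)

  table₁ table₂ : Kind → Fin 3 → ℕ → ℤ
  table₁ = table count₁
  table₂ = table count₂

  total : (Fin 3 → ℕ → ℤ) → (Fin 3 → ℕ → ℤ) → ℤ
  total X Y = det (X 0F) (Y 0F) ℤ.+ (det (X 1F) (Y 1F) ℤ.+ det (X 2F) (Y 2F))

  -- If neither or both of the two elements are among A, B, C, or one of them is `s`, the two sides
  -- agree by computation. In the mixed cases P, Q and R are the values of the other letter after x,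
  -- after xy and after xyz. They are not affected by the three swaps: A takes the values P and Q, B
  -- takes P and R, C takes Q and R, so that only the levels of the corner vary.
  table-total : ∀ κ κ′ → total (table₁ κ) (table₁ κ′) ≡ total (table₂ κ) (table₂ κ′)
  table-total base          base          = refl
  table-total base          (other _ _ _) = refl
  table-total base          (at 0F)       = refl
  table-total base          (at 1F)       = refl
  table-total base          (at 2F)       = refl
  table-total (other _ _ _) base          = refl
  table-total (at 0F)       base          = refl
  table-total (at 1F)       base          = refl
  table-total (at 2F)       base          = refl
  table-total (other _ _ _) (other _ _ _) = refl
  table-total (other X Y Z) (at 0F) =
    lemma (value (X + 0)) (value (X + (Y + 0))) (value (X + (Y + (Z + 0))))
    where
    lemma : ∀ P Q R →
      (P ℤ.* 1ℤ ℤ.- Q ℤ.* 1ℤ) ℤ.+ ((P ℤ.* 0ℤ ℤ.- R ℤ.* (ℤ.+ 2)) ℤ.+ (Q ℤ.* 0ℤ ℤ.- R ℤ.* 0ℤ)) ≡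
      (P ℤ.* 1ℤ ℤ.- Q ℤ.* 1ℤ) ℤ.+ ((P ℤ.* 0ℤ ℤ.- R ℤ.* 0ℤ) ℤ.+ (Q ℤ.* 0ℤ ℤ.- R ℤ.* (ℤ.+ 2)))
    lemma = solve-∀
  table-total (other X Y Z) (at 1F) =
    lemma (value (X + 0)) (value (X + (Y + 0))) (value (X + (Y + (Z + 0))))
    where
    lemma : ∀ P Q R →
      (P ℤ.* (ℤ.+ 2) ℤ.- Q ℤ.* 0ℤ) ℤ.+ ((P ℤ.* 1ℤ ℤ.- R ℤ.* 1ℤ) ℤ.+ (Q ℤ.* 0ℤ ℤ.- R ℤ.* (ℤ.+ 2))) ≡
      (P ℤ.* (ℤ.+ 2) ℤ.- Q ℤ.* (ℤ.+ 2)) ℤ.+ ((P ℤ.* 1ℤ ℤ.- R ℤ.* 1ℤ) ℤ.+ (Q ℤ.* (ℤ.+ 2) ℤ.- R ℤ.* (ℤ.+ 2)))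
    lemma = solve-∀
  table-total (other X Y Z) (at 2F) =
    lemma (value (X + 0)) (value (X + (Y + 0))) (value (X + (Y + (Z + 0))))
    where
    lemma : ∀ P Q R →
      (P ℤ.* 0ℤ ℤ.- Q ℤ.* 0ℤ) ℤ.+ ((P ℤ.* (ℤ.+ 2) ℤ.- R ℤ.* 0ℤ) ℤ.+ (Q ℤ.* 1ℤ ℤ.- R ℤ.* 1ℤ)) ≡
      (P ℤ.* (ℤ.+ 2) ℤ.- Q ℤ.* 0ℤ) ℤ.+ ((P ℤ.* 0ℤ ℤ.- R ℤ.* 0ℤ) ℤ.+ (Q ℤ.* 1ℤ ℤ.- R ℤ.* 1ℤ))
    lemma = solve-∀
  table-total (at 0F) (other X Y Z) =
    lemma (value (X + 0)) (value (X + (Y + 0))) (value (X + (Y + (Z + 0))))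
    where
    lemma : ∀ P Q R →
      (1ℤ ℤ.* Q ℤ.- 1ℤ ℤ.* P) ℤ.+ (((ℤ.+ 2) ℤ.* R ℤ.- 0ℤ ℤ.* P) ℤ.+ (0ℤ ℤ.* R ℤ.- 0ℤ ℤ.* Q)) ≡
      (1ℤ ℤ.* Q ℤ.- 1ℤ ℤ.* P) ℤ.+ ((0ℤ ℤ.* R ℤ.- 0ℤ ℤ.* P) ℤ.+ ((ℤ.+ 2) ℤ.* R ℤ.- 0ℤ ℤ.* Q))
    lemma = solve-∀
  table-total (at 1F) (other X Y Z) =
    lemma (value (X + 0)) (value (X + (Y + 0))) (value (X + (Y + (Z + 0))))
    where
    lemma : ∀ P Q R →
      (0ℤ ℤ.* Q ℤ.- (ℤ.+ 2) ℤ.* P) ℤ.+ ((1ℤ ℤ.* R ℤ.- 1ℤ ℤ.* P) ℤ.+ ((ℤ.+ 2) ℤ.* R ℤ.- 0ℤ ℤ.* Q)) ≡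
      ((ℤ.+ 2) ℤ.* Q ℤ.- (ℤ.+ 2) ℤ.* P) ℤ.+ ((1ℤ ℤ.* R ℤ.- 1ℤ ℤ.* P) ℤ.+ ((ℤ.+ 2) ℤ.* R ℤ.- (ℤ.+ 2) ℤ.* Q))
    lemma = solve-∀
  table-total (at 2F) (other X Y Z) =
    lemma (value (X + 0)) (value (X + (Y + 0))) (value (X + (Y + (Z + 0))))
    where
    lemma : ∀ P Q R →
      (0ℤ ℤ.* Q ℤ.- 0ℤ ℤ.* P) ℤ.+ ((0ℤ ℤ.* R ℤ.- (ℤ.+ 2) ℤ.* P) ℤ.+ (1ℤ ℤ.* R ℤ.- 1ℤ ℤ.* Q)) ≡
      (0ℤ ℤ.* Q ℤ.- (ℤ.+ 2) ℤ.* P) ℤ.+ ((0ℤ ℤ.* R ℤ.- 0ℤ ℤ.* P) ℤ.+ (1ℤ ℤ.* R ℤ.- 1ℤ ℤ.* Q))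
    lemma = solve-∀
  table-total (at 0F) (at 0F) = refl
  table-total (at 0F) (at 1F) = refl
  table-total (at 0F) (at 2F) = refl
  table-total (at 1F) (at 0F) = refl
  table-total (at 1F) (at 1F) = refl
  table-total (at 1F) (at 2F) = refl
  table-total (at 2F) (at 0F) = refl
  table-total (at 2F) (at 1F) = refl
  table-total (at 2F) (at 2F) = refl

  module _ (occ≡2 : ∀ c → occ (corner c) w₁ ≡ 2) where
    private
      occ-sum : (X Y Z T a b c : ℕ) → ℕ
      occ-sum X Y Z T a b c = X + (a + (b + (Y + (a + (c + (Z + (b + (c + T))))))))

      occ-w₁ : ∀ F → occ F w₁ ≡
               occ-sum (occ F x) (occ F y) (occ F z) (occ F t) (ind F A) (ind F B) (ind F C)
      occ-w₁ F = trans (occ-++ F x _) (cong (λ k → occ F x + (ind F A + (ind F B + k)))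
        (trans (occ-++ F y _) (cong (λ k → occ F y + (ind F A + (ind F C + k))) (occ-++ F z _))))

      occ-corner : ∀ (c : Fin 3) X Y Z T → X + (Y + (Z + T)) + 2 ≡
        occ-sum X Y Z T (Words.ind Fin._≟_ c 0F) (Words.ind Fin._≟_ c 1F) (Words.ind Fin._≟_ c 2F)
      occ-corner 0F = lemma
        where
        lemma : ∀ X Y Z T → X + (Y + (Z + T)) + 2 ≡ X + (1 + (0 + (Y + (1 + (0 + (Z + (0 + (0 + T))))))))
        lemma = ℕ-Solver.solve-∀
      occ-corner 1F = lemma
        where
        lemma : ∀ X Y Z T → X + (Y + (Z + T)) + 2 ≡ X + (0 + (1 + (Y + (0 + (0 + (Z + (1 + (0 + T))))))))
        lemma = ℕ-Solver.solve-∀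
      occ-corner 2F = lemma
        where
        lemma : ∀ X Y Z T → X + (Y + (Z + T)) + 2 ≡ X + (0 + (0 + (Y + (0 + (1 + (Z + (0 + (1 + T))))))))
        lemma = ℕ-Solver.solve-∀

      Absent : X → Set
      Absent F = occ F x ≡ 0 × occ F y ≡ 0 × occ F z ≡ 0

      -- Both occurrences of the corner are displayed in `w₁`, and there are no more than two.
      absent : ∀ c → Absent (corner c)
      absent c = ℕ.m+n≡0⇒m≡0 (occ F x) all , ℕ.m+n≡0⇒m≡0 (occ F y) rest ,
                 ℕ.m+n≡0⇒m≡0 (occ F z) (ℕ.m+n≡0⇒n≡0 (occ F y) rest)
        where
        F = corner c
        inds : occ F w₁ ≡ occ-sum (occ F x) (occ F y) (occ F z) (occ F t)
                 (Words.ind Fin._≟_ c 0F) (Words.ind Fin._≟_ c 1F) (Words.ind Fin._≟_ c 2F)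
        inds rewrite sym (corner-ind c 0F) | sym (corner-ind c 1F) | sym (corner-ind c 2F) = occ-w₁ F
        all : occ F x + (occ F y + (occ F z + occ F t)) ≡ 0
        all = ℕ.+-cancelʳ-≡ 2 (occ F x + (occ F y + (occ F z + occ F t))) 0 (trans (occ-corner c (occ F x) (occ F y) (occ F z) (occ F t))
                (trans (sym inds) (occ≡2 c)))
        rest = ℕ.m+n≡0⇒n≡0 (occ F x) all

      module _ (F : X) where
        -- A record instead of a bare equation, so that words and counts are inferred while a
        -- derivation walks along the word letter by letter.
        record Before (D : X) (k : ℕ) (w : List X) (m : ℕ) : Set where
          constructor ⟨_⟩
          field count≡ : before F D k w ≡ m

        x∌ : ∀ c {k v m} → Before (corner c) k v m → Before (corner c) k (x ++ v) (occ F x + m)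
        x∌ c {k} {v} ⟨ refl ⟩ = ⟨ before-skip _≟_ F {u = x} k v (proj₁ (absent c)) ⟩
        y∌ : ∀ c {k v m} → Before (corner c) k v m → Before (corner c) k (y ++ v) (occ F y + m)
        y∌ c {k} {v} ⟨ refl ⟩ = ⟨ before-skip _≟_ F {u = y} k v (proj₁ (proj₂ (absent c))) ⟩
        z∌ : ∀ c {k v m} → Before (corner c) k v m → Before (corner c) k (z ++ v) (occ F z + m)
        z∌ c {k} {v} ⟨ refl ⟩ = ⟨ before-skip _≟_ F {u = z} k v (proj₂ (proj₂ (absent c))) ⟩

        miss : ∀ {D E k v m} → D ≢ E → Before D k v m → Before D k (E ∷ v) (ind F E + m)
        miss {k = k} {v} D≢E ⟨ refl ⟩ = ⟨ before-miss F k v D≢E ⟩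

        hit : ∀ {D k v m} → Before D k v m → Before D (suc k) (D ∷ v) (ind F D + m)
        hit {D} {k} {v} ⟨ refl ⟩ = ⟨ before-hit F D k v ⟩

        stop : ∀ {D v} → Before D 0 (D ∷ v) 0
        stop {D} {v} = ⟨ before-hit₀ F D v ⟩

        B≢A = A≢B ∘ sym
        C≢A = A≢C ∘ sym
        C≢B = B≢C ∘ sym

        count-w : ((X Y Z a b c : ℕ) → Fin 3 → ℕ → ℕ) → Fin 3 → ℕ → ℕ
        count-w count = count (occ F x) (occ F y) (occ F z) (ind F A) (ind F B) (ind F C)

        before-w₁ : ∀ c k → k < 2 → Before (corner c) k w₁ (count-w count₁ c k)
        before-w₁ 0F 0 _ = x∌ 0F stop
        before-w₁ 0F 1 _ = x∌ 0F (hit (miss A≢B (y∌ 0F stop)))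
        before-w₁ 1F 0 _ = x∌ 1F (miss B≢A stop)
        before-w₁ 1F 1 _ = x∌ 1F (miss B≢A (hit (y∌ 1F (miss B≢A (miss B≢C (z∌ 1F stop))))))
        before-w₁ 2F 0 _ = x∌ 2F (miss C≢A (miss C≢B (y∌ 2F (miss C≢A stop))))
        before-w₁ 2F 1 _ = x∌ 2F (miss C≢A (miss C≢B (y∌ 2F (miss C≢A (hit (z∌ 2F (miss C≢B stop)))))))
        before-w₁ _ (suc (suc _)) (s≤s (s≤s ()))

        before-w₂ : ∀ c k → k < 2 → Before (corner c) k w₂ (count-w count₂ c k)
        before-w₂ 0F 0 _ = x∌ 0F (miss A≢B stop)
        before-w₂ 0F 1 _ = x∌ 0F (miss A≢B (hit (y∌ 0F (miss A≢C stop))))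
        before-w₂ 1F 0 _ = x∌ 1F stop
        before-w₂ 1F 1 _ = x∌ 1F (hit (miss B≢A (y∌ 1F (miss B≢C (miss B≢A (z∌ 1F (miss B≢C stop)))))))
        before-w₂ 2F 0 _ = x∌ 2F (miss C≢B (miss C≢A (y∌ 2F stop)))
        before-w₂ 2F 1 _ = x∌ 2F (miss C≢B (miss C≢A (y∌ 2F (hit (miss C≢A (z∌ 2F stop))))))
        before-w₂ _ (suc (suc _)) (s≤s (s≤s ()))

      record HasKind (F : X) (κ : Kind) : Set where
        field
          ˣ≡ : occ F x ≡ occˣ κ
          ʸ≡ : occ F y ≡ occʸ κ
          ᶻ≡ : occ F z ≡ occᶻ κ
          same≡ : ∀ c → does (F ≟ corner c) ≡ same κ c

        count≡ : ∀ count c k → count-w F count c k ≡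
                 count (occˣ κ) (occʸ κ) (occᶻ κ) (indᴷ κ 0F) (indᴷ κ 1F) (indᴷ κ 2F) c k
        count≡ count c k rewrite ˣ≡ | ʸ≡ | ᶻ≡ | same≡ 0F | same≡ 1F | same≡ 2F = refl

      at-corner : ∀ d → HasKind (corner d) (at d)
      at-corner d = record
        { ˣ≡ = proj₁ (absent d) ; ʸ≡ = proj₁ (proj₂ (absent d)) ; ᶻ≡ = proj₂ (proj₂ (absent d))
        ; same≡ = does-map Fin._≟_ _≟_ corner-injective d }

      kind : ∀ F → ∃ (HasKind F)
      kind F with F ≟ A | F ≟ B | F ≟ C
      ... | yes refl | _        | _        = _ , at-corner 0F
      ... | no _     | yes refl | _        = _ , at-corner 1F
      ... | no _     | no _     | yes refl = _ , at-corner 2F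
      ... | no F≢A   | no F≢B   | no F≢C   = other (occ F x) (occ F y) (occ F z) , record
        { ˣ≡ = refl ; ʸ≡ = refl ; ᶻ≡ = refl
        ; same≡ = λ { 0F → dec-false (F ≟ A) F≢A ; 1F → dec-false (F ≟ B) F≢B ; 2F → dec-false (F ≟ C) F≢C } }

    levels : ∀ F → ∃[ κ ] (∀ c k → k < 2 → level F (corner c) k w₁ ≡ table₁ κ c k) ×
                          (∀ c k → k < 2 → level F (corner c) k w₂ ≡ table₂ κ c k)
    levels F with kind F
    ... | κ , F∈κ = κ ,
      (λ c k k<2 → cong₂ (λ b v → if b then 1ℤ else value v) (same≡ c)
        (trans (Before.count≡ (before-w₁ F c k k<2)) (count≡ count₁ c k))) ,
      (λ c k k<2 → cong₂ (λ b v → if b then 1ℤ else value v) (same≡ c)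
        (trans (Before.count≡ (before-w₂ F c k k<2)) (count≡ count₂ c k)))
      where open HasKind F∈κ

  -- The move swaps neighbours, and an occurrence of any further letter D has both or neither of two
  -- neighbours in front of it.
  level-elsewhere : ∀ F {D} k → (∀ c → D ≢ corner c) → level F D k w₁ ≡ level F D k w₂
  level-elsewhere F {D} k D≢ = cong (λ b → if does (F ≟ D) then 1ℤ else value b)
    (before-prefix _≟_ F D x (before-swap _≟_ F (D≢ 0F) (D≢ 1F)
      (before-prefix _≟_ F D y (before-swap _≟_ F (D≢ 0F) (D≢ 2F)
        (before-prefix _≟_ F D z (before-swap _≟_ F (D≢ 1F) (D≢ 2F) λ _ → refl))))) k)

module _ {a} {α : Set a} (τ : α → α) (τ-involutive : Involutive _≡_ τ) where
  open Coefficients τ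
  open Bordisms τ τ-involutive

  third-move-bordism : ∀ {𝒜 w w′ twice twice′} → Move₃ τ 𝒜 w w′ →
    Bordism (pairing τ (record { alphabet = 𝒜 ; word = w  ; twice = twice }))
            (pairing τ (record { alphabet = 𝒜 ; word = w′ ; twice = twice′ }))
  third-move-bordism {𝒜} {twice = tw} {tw′} record
    { A = A ; B = B ; C = C ; x = x ; y = y ; z = z ; t = t ; A≢B = A≢B ; A≢C = A≢C ; B≢C = B≢C
    ; ∣A∣≡∣B∣ = ∣A∣≡∣B∣ ; ∣B∣≡∣C∣ = ∣B∣≡∣C∣ ; word≡ = refl ; word′≡ = refl } =
    isometry (↔-id _) (λ _ → refl) e≋
    where
    open Alphabet 𝒜
    open Combinations τ 𝒜
    open ThirdMove _≟_ A B C x y z t A≢B A≢C B≢C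
    W₁ W₂ : Nanoword α
    W₁ = record { alphabet = 𝒜 ; word = w₁ ; twice = tw }
    W₂ = record { alphabet = 𝒜 ; word = w₂ ; twice = tw′ }
    module F₁ = NanowordForm τ W₁
    module F₂ = NanowordForm τ W₂

    h-levels : ∀ F → ∃[ κ ] (∀ c k → k < 2 → F₁.h F (corner c) k ≡ table₁ κ c k) ×
                            (∀ c k → k < 2 → F₂.h F (corner c) k ≡ table₂ κ c k)
    h-levels (just F) = levels (λ c → F₁.occ≡2 (corner c)) F
    h-levels nothing  = base , (λ _ _ _ → refl) , (λ _ _ _ → refl)

    h-elsewhere : ∀ F D → (∀ c → D ≢ corner c) → ∀ k → k < 2 → F₁.h F D k ≡ F₂.h F D k
    h-elsewhere nothing  D D≢ k _ = refl
    h-elsewhere (just F) D D≢ k _ = level-elsewhere F k D≢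

    -- The difference of the two forms is concentrated on A, B and C, whose
    -- projections to α coincide.
    concentrated : ∀ M → (∀ D → (∀ c → D ≢ corner c) → M D ≡ 0ℤ) →
                   M A ℤ.+ (M B ℤ.+ M C) ≡ 0ℤ → Φ M ≋ 𝟘
    concentrated M M≡0 sum≡0 = begin
      Φ M
        ≈⟨ Φ-cong decompose ⟩
      Φ (λ D → part A D ℤ.+ (part B D ℤ.+ part C D))
        ≈⟨ ∼-trans (Φ-+ (part A) (λ D → part B D ℤ.+ part C D)) (⊹-cong ∼-refl (Φ-+ (part B) (part C))) ⟩
      Φ (part A) ⊹ (Φ (part B) ⊹ Φ (part C))
        ≈⟨ ⊹-cong (Φ-δ A (M A)) (⊹-cong (Φ-δ B (M B)) (Φ-δ C (M C))) ⟩
      M A • gen ∣ A ∣ ⊹ (M B • gen ∣ B ∣ ⊹ M C • gen ∣ C ∣)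
        ≡⟨ cong₂ (λ b c → M A • gen b ⊹ (M B • gen ∣ B ∣ ⊹ M C • gen c)) ∣A∣≡∣B∣ (sym ∣B∣≡∣C∣) ⟩
      M A • gen ∣ B ∣ ⊹ (M B • gen ∣ B ∣ ⊹ M C • gen ∣ B ∣)
        ≈⟨ ∼-trans (•-homo-+ (M A) _ _) (⊹-cong ∼-refl (•-homo-+ (M B) _ _)) ⟨
      (M A ℤ.+ (M B ℤ.+ M C)) • gen ∣ B ∣
        ≡⟨ cong (_• gen ∣ B ∣) sum≡0 ⟩
      𝟘 ∎
      where
      open import Relation.Binary.Reasoning.Setoid π.setoid
      part : Letter → Letter → ℤ
      part E D = δ _≟_ E D ℤ.* M E
      off : ∀ {E D} → E ≢ D → part E D ≡ 0ℤ
      off {E} E≢D = cong (ℤ._* M E) (δ-≢ _≟_ E≢D)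
      on : ∀ E → part E E ≡ M E
      on E = trans (cong (ℤ._* M E) (δ-refl _≟_ E)) (ℤ.*-identityˡ (M E))
      decompose : ∀ D → M D ≡ part A D ℤ.+ (part B D ℤ.+ part C D)
      decompose D = cases (D ≟ A) (D ≟ B) (D ≟ C)
        where
        three : ∀ {p q r p′ q′ r′} → p ≡ p′ → q ≡ q′ → r ≡ r′ → p′ ℤ.+ (q′ ℤ.+ r′) ≡ p ℤ.+ (q ℤ.+ r)
        three refl refl refl = refl
        cases : Dec (D ≡ A) → Dec (D ≡ B) → Dec (D ≡ C) → M D ≡ part A D ℤ.+ (part B D ℤ.+ part C D)
        cases (yes refl) _ _ = trans (sym (ℤ.+-identityʳ (M A)))
          (three (on A) (off (A≢B ∘ sym)) (off (A≢C ∘ sym)))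
        cases (no _) (yes refl) _ = trans (sym (trans (ℤ.+-identityˡ _) (ℤ.+-identityʳ (M B))))
          (three (off A≢B) (on B) (off (B≢C ∘ sym)))
        cases (no _) (no _) (yes refl) = trans (sym (trans (ℤ.+-identityˡ _) (ℤ.+-identityˡ (M C))))
          (three (off A≢C) (off B≢C) (on C))
        cases (no D≢A) (no D≢B) (no D≢C) = trans (M≡0 D λ { 0F → D≢A ; 1F → D≢B ; 2F → D≢C })
          (three (off (D≢A ∘ sym)) (off (D≢B ∘ sym)) (off (D≢C ∘ sym)))

    total-N : ∀ (N : Letter → ℤ) {X Y : Letter → ℕ → ℤ} {X′ Y′ : Fin 3 → ℕ → ℤ} →
              (∀ D → N D ℤ.+ N D ≡ det (X D) (Y D)) →
              (∀ c k → k < 2 → X (corner c) k ≡ X′ c k) → (∀ c k → k < 2 → Y (corner c) k ≡ Y′ c k) →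
              (N A ℤ.+ (N B ℤ.+ N C)) ℤ.+ (N A ℤ.+ (N B ℤ.+ N C)) ≡ total X′ Y′
    total-N N {X} {Y} {X′} {Y′} N≡ X≡ Y≡ = trans (regroup (N A) (N B) (N C)) (cong₂ ℤ._+_ (corner≡ 0F) (cong₂ ℤ._+_ (corner≡ 1F) (corner≡ 2F)))
      where
      corner≡ : ∀ c → N (corner c) ℤ.+ N (corner c) ≡ det (X′ c) (Y′ c)
      corner≡ c = trans (N≡ (corner c)) (det-cong (X≡ c) (Y≡ c))
      regroup : ∀ a b c → (a ℤ.+ (b ℤ.+ c)) ℤ.+ (a ℤ.+ (b ℤ.+ c)) ≡ (a ℤ.+ a) ℤ.+ ((b ℤ.+ b) ℤ.+ (c ℤ.+ c))
      regroup = solve-∀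

    e≋ : ∀ F G → eʷ τ W₁ F G ≋ eʷ τ W₂ (Maybe.map id F) (Maybe.map id G)
    e≋ F G rewrite Maybe.map-id F | Maybe.map-id G
      with F₁.e-represents F G | F₂.e-represents F G | h-levels F | h-levels G
    ... | F₁.represents N₁ N₁≡ e₁≋ | F₂.represents N₂ N₂≡ e₂≋ | κ , F₁≡ , F₂≡ | κ′ , G₁≡ , G₂≡ =
      ∼-trans e₁≋ (∼-trans (x∙y⁻¹≈ε⇒x≈y _ _ (∼-trans
        (∼-sym (∼-trans (Φ-+ N₁ (λ D → ℤ.- N₂ D)) (⊹-cong ∼-refl (Φ-neg N₂))))
        (concentrated (λ D → N₁ D ℤ.- N₂ D)
          (λ D D≢ → ℤ.i≡j⇒i-j≡0 (double-injective {N₁ D} {N₂ D} (trans (N₁≡ D)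
            (trans (det-cong (h-elsewhere F D D≢) (h-elsewhere G D D≢)) (sym (N₂≡ D))))))
          (trans (regroup (N₁ A) (N₁ B) (N₁ C) (N₂ A) (N₂ B) (N₂ C))
            (ℤ.i≡j⇒i-j≡0 (double-injective {N₁ A ℤ.+ (N₁ B ℤ.+ N₁ C)} {N₂ A ℤ.+ (N₂ B ℤ.+ N₂ C)}
              (trans (total-N N₁ {F₁.h F} {F₁.h G} {table₁ κ} {table₁ κ′} N₁≡ F₁≡ G₁≡) (trans (table-total κ κ′) (sym (total-N N₂ {F₂.h F} {F₂.h G} {table₂ κ} {table₂ κ′} N₂≡ F₂≡ G₂≡))))))))))
        (∼-sym e₂≋))
      where
      regroup : ∀ a b c a′ b′ c′ → (a ℤ.- a′) ℤ.+ ((b ℤ.- b′) ℤ.+ (c ℤ.- c′)) ≡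
                (a ℤ.+ (b ℤ.+ c)) ℤ.- (a′ ℤ.+ (b′ ℤ.+ c′))
      regroup = solve-∀

-- Surgeries

++-injectiveˡ : ∀ {X : Set} (xs ys : List X) {us vs} → length xs ≡ length ys →
                xs ++ us ≡ ys ++ vs → xs ≡ ys
++-injectiveˡ []       []       _   _  = refl
++-injectiveˡ (x ∷ xs) (y ∷ ys) len eq =
  cong₂ _∷_ (∷-injectiveˡ eq) (++-injectiveˡ xs ys (ℕ.suc-injective len) (∷-injectiveʳ eq))

module _ {a} {α : Set a} (τ : α → α) (X : FiniteSet) where
  open Coefficients τ
  open FiniteSet X
  open Summation X

  -- Substituting ι only shows that the double of the sum vanishes, which is too weak in the
  -- presence of 2-torsion. The letters are therefore split by comparing the indices of B and ι B:
  -- the part with the smaller B cancels the part with the smaller ι B, and the fixed letters vanish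
  -- by assumption.
  ∑-antisymmetric : ∀ (ι : Elem → Elem) f → (∀ B → ι (ι B) ≡ B) → (∀ B → f (ι B) ≋ ⊖ f B) →
                    (∀ B → ι B ≡ B → f B ≋ 𝟘) → ∑ᶠ f ≋ 𝟘
  ∑-antisymmetric ι f ιι f-anti f-fixed = begin
    ∑ᶠ f                     ≈⟨ ∑-cong split ⟩
    ∑ᶠ (λ B → f⁺ B ⊹ f⁻ B)   ≈⟨ ∑-⊹ f⁺ f⁻ ⟩
    ∑ᶠ f⁺ ⊹ ∑ᶠ f⁻            ≈⟨ ⊹-cong ∼-refl (∑-bijection X X (mk↔ₛ′ ι ι ιι ιι) f⁻) ⟩
    ∑ᶠ f⁺ ⊹ ∑ᶠ (f⁻ ∘ ι)      ≈⟨ ⊹-cong ∼-refl (∼-trans (∑-cong flip) (∑-⊖ f⁺)) ⟩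
    ∑ᶠ f⁺ ⊹ ⊖ ∑ᶠ f⁺          ≈⟨ π.inverseʳ _ ⟩
    𝟘                        ∎
    where
    open import Relation.Binary.Reasoning.Setoid π.setoid
    index : Elem → Fin size
    index = Inverse.to enumeration
    index-injective : ∀ {A B} → index A ≡ index B → A ≡ B
    index-injective eq = trans (sym (Inverse.inverseʳ enumeration refl))
      (trans (cong (Inverse.from enumeration) eq) (Inverse.inverseʳ enumeration refl))
    part : Elem → Elem → Expr τ → Expr τ
    part A B x = if does (index A Fin.<? index B) then x else 𝟘
    f⁺ f⁻ : Elem → Expr τ
    f⁺ B = part B (ι B) (f B)
    f⁻ B = part (ι B) B (f B)
    part-yes : ∀ {A B x} → index A Fin.< index B → part A B x ≡ x
    part-yes {x = x} lt = cong (λ b → if b then x else 𝟘) (dec-true (_ Fin.<? _) lt)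
    part-no : ∀ {A B x} → ¬ index A Fin.< index B → part A B x ≡ 𝟘
    part-no {x = x} ≮ = cong (λ b → if b then x else 𝟘) (dec-false (_ Fin.<? _) ≮)
    split : ∀ B → f B ≋ f⁺ B ⊹ f⁻ B
    split B with Fin.<-cmp (index B) (index (ι B))
    ... | Tri.tri< lt _ ≯ = ∼-sym (∼-trans
      (⊹-cong (π.reflexive (part-yes {B} {ι B} lt)) (π.reflexive (part-no {ι B} {B} ≯))) (π.identityʳ _))
    ... | Tri.tri> ≮ _ gt = ∼-sym (∼-trans
      (⊹-cong (π.reflexive (part-no {B} {ι B} ≮)) (π.reflexive (part-yes {ι B} {B} gt))) (identityˡ _))
    ... | Tri.tri≈ ≮ eq ≯ = ∼-trans (f-fixed B (sym (index-injective eq))) (∼-sym (𝟘⊹𝟘≋𝟘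
      (π.reflexive (part-no {B} {ι B} ≮)) (π.reflexive (part-no {ι B} {B} ≯))))
    flip : ∀ B → f⁻ (ι B) ≋ ⊖ f⁺ B
    flip B rewrite ιι B with does (index B Fin.<? index (ι B))
    ... | true  = f-anti B
    ... | false = ∼-sym ε⁻¹≈ε

-- The numbers of occurrences of a letter of an even symmetric nanophrase in a
-- word of the phrase, depending on whether the letter has sign + (ε = 0) or
-- sign - (ε = 1).
data Parity : Sign → ℕ → Set where
  none : ∀ {s} → Parity s 0
  both : Parity Sign.+ 2
  one  : Parity Sign.- 1

module Reflection {Y : Set} (_≟_ : DecidableEquality Y) (ι : Y → Y) (ιι : ∀ B → ι (ι B) ≡ B)
                  (sgn : Y → Sign) where
  open Words _≟_

  ι-injective : Injective _≡_ _≡_ ι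
  ι-injective eq = trans (sym (ιι _)) (trans (cong ι eq) (ιι _))

  record Good (v : List Y) : Set where
    field
      reflected : map ι v ≡ reverse v
      even      : 2 ∣ length v
      parity    : ∀ B → Parity (sgn B) (occ B v)

    occ-ι : ∀ B → occ (ι B) v ≡ occ B v
    occ-ι B = begin
      occ (ι B) v            ≡⟨ occ-reverse (ι B) v ⟨
      occ (ι B) (reverse v)  ≡⟨ cong (occ (ι B)) reflected ⟨
      occ (ι B) (map ι v)    ≡⟨ occ-map _≟_ _≟_ ι-injective B v ⟩
      occ B v                ∎
      where open ≡-Reasoning

    -- The reflection moves what precedes an occurrence of D behind its mirror image, which is an
    -- occurrence of ι D, and renames B to ι B.
    before-ι : ∀ B D l m → suc (l + m) ≡ occ D v →
               before B D l v + before (ι B) (ι D) m v + ind B D ≡ occ B v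
    before-ι B D l m eq = begin
      before B D l v + before (ι B) (ι D) m v + ind B D
        ≡⟨ cong₂ (λ b i → b + before (ι B) (ι D) m v + i)
             (trans (sym (before-map _≟_ _≟_ ι-injective B D l v))
                    (cong (before (ι B) (ι D) l) reflected))
             (sym (ind-map _≟_ _≟_ ι-injective B D)) ⟩
      before (ι B) (ι D) l (reverse v) + before (ι B) (ι D) m v + ind (ι B) (ι D)
        ≡⟨ before-reverse (ι B) (ι D) m l v
             (trans (cong suc (ℕ.+-comm m l)) (trans eq (sym (occ-ι D)))) ⟩
      occ (ι B) v
        ≡⟨ occ-ι B ⟩
      occ B v ∎
      where open ≡-Reasoning

    -- A fixed letter occurs equally often in the two halves of v.
    fixed-occ : ∀ {B} → ι B ≡ B → occ B v ≢ 1
    fixed-occ {B} ιB≡B occ≡1 with even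
    ... | divides n len = contradiction (trans (sym occ≡1) total) (odd (occ B t))
      where
      t d : List Y
      t = take n v
      d = drop n v
      t++d : t ++ d ≡ v
      t++d = take++drop≡id n v
      len-v : length v ≡ n + n
      len-v = trans len (trans (ℕ.*-comm n 2) (cong (n +_) (ℕ.+-identityʳ n)))
      len-t : length t ≡ n
      len-t = trans (length-take n v) (ℕ.m≤n⇒m⊓n≡m (subst (n ≤_) (sym len-v) (ℕ.m≤m+n n n)))
      len-d : length d ≡ n
      len-d = trans (length-drop n v) (trans (cong (ℕ._∸ n) len-v) (ℕ.m+n∸n≡m n n))
      halves : map ι t ≡ reverse d
      halves = ++-injectiveˡ (map ι t) (reverse d)
        (trans (length-map ι t) (trans len-t (sym (trans (length-reverse d) len-d))))
        (begin
          map ι t ++ map ι d      ≡⟨ map-++ ι t d ⟨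
          map ι (t ++ d)          ≡⟨ cong (map ι) t++d ⟩
          map ι v                 ≡⟨ reflected ⟩
          reverse v               ≡⟨ cong reverse t++d ⟨
          reverse (t ++ d)        ≡⟨ reverse-++ t d ⟩
          reverse d ++ reverse t  ∎)
        where open ≡-Reasoning
      occ-d : occ B d ≡ occ B t
      occ-d = begin
        occ B d            ≡⟨ occ-reverse B d ⟨
        occ B (reverse d)  ≡⟨ cong (occ B) halves ⟨
        occ B (map ι t)    ≡⟨ cong (λ C → occ C (map ι t)) ιB≡B ⟨
        occ (ι B) (map ι t) ≡⟨ occ-map _≟_ _≟_ ι-injective B t ⟩
        occ B t            ∎
        where open ≡-Reasoning
      total : occ B v ≡ occ B t + occ B t
      total = trans (cong (occ B) (sym t++d)) (trans (occ-++ B t d) (cong (occ B t +_) occ-d))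
      odd : ∀ n → 1 ≢ n + n
      odd zero    ()
      odd (suc n) eq = contradiction (ℕ.suc-injective (trans eq (cong suc (ℕ.+-suc n n)))) λ ()

  -- o B is the number of letters B before the word v.
  module Block {v : List Y} (good : Good v) (o : Y → ℕ) (o-ι : ∀ B → o (ι B) ≡ o B)
               (o-bound : ∀ B → o B + occ B v ≤ 2) where
    open Good good

    local : Y → Y → ℕ → ℤ
    local B D l = if does (B ≟ D) then 1ℤ else value (o B + before B D l v)

    local-refl : ∀ B l → local B B l ≡ 1ℤ
    local-refl B l = cong (λ b → if b then 1ℤ else value (o B + before B B l v)) (dec-true (B ≟ B) refl)

    local-≢ : ∀ {B D} l → B ≢ D → local B D l ≡ value (o B + before B D l v)
    local-≢ {B} {D} l B≢D =
      cong (λ b → if b then 1ℤ else value (o B + before B D l v)) (dec-false (B ≟ D) B≢D)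

    complementary : ∀ {B D} l m → suc (l + m) ≡ occ D v → B ≢ D →
                    before B D l v + before (ι B) (ι D) m v ≡ occ B v
    complementary {B} {D} l m eq B≢D = trans (sym (ℕ.+-identityʳ _)) (trans
      (cong (before B D l v + before (ι B) (ι D) m v +_) (sym (ind-≢ B≢D))) (before-ι B D l m eq))

    -- If both letters B lie in v, none precedes v, and the reflection replaces the count b by 2 -
    -- b, which has the same `value`. If B does not occur in v, all counts are `o B`.
    local-both : ∀ {B} → occ B v ≡ 0 ⊎ occ B v ≡ 2 → ∀ D l m → suc (l + m) ≡ occ D v →
                 local (ι B) (ι D) m ≡ local B D l
    local-both {B} occ≡ D l m eq with B ≟ D
    ... | yes refl = local-refl (ι B) m
    ... | no B≢D = trans (local-≢ m (B≢D ∘ ι-injective)) (trans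
      (cong (λ o → value (o + before (ι B) (ι D) m v)) (o-ι B)) (case occ≡ of λ
        { (inj₁ ≡0) → cong value (cong (o B +_) (trans
            (before-∉ (ι D) m v (trans (occ-ι B) ≡0)) (sym (before-∉ D l v ≡0))))
        ; (inj₂ ≡2) → cases (o B) (ℕ.n≤0⇒n≡0 (ℕ.+-cancelʳ-≤ 2 _ 0 (subst (λ k → o B + k ≤ 2) ≡2 (o-bound B)))) ≡2 }))
      where
      cases : ∀ o → o ≡ 0 → occ B v ≡ 2 →
              value (o + before (ι B) (ι D) m v) ≡ value (o + before B D l v)
      cases .0 refl ≡2 = value-reflect (before B D l v) (before (ι B) (ι D) m v) (trans
        (ℕ.+-comm (before (ι B) (ι D) m v) _) (trans (complementary l m eq B≢D) ≡2))

    -- If v contains one end of the arc of B, the two mirror positions have counts that differ by 1,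
    -- starting from the same number `o B` of 0 or 1 earlier letters. Whether the arc begins or ends
    -- in v, one position is inside with value 2 and the other outside with value 0; if B = D, both
    -- values are 1.
    local-one : ∀ {B} → occ B v ≡ 1 → ∀ D l m → suc (l + m) ≡ occ D v →
                local B D l ℤ.+ local (ι B) (ι D) m ≡ ℤ.+ 2
    local-one {B} ≡1 D l m eq with B ≟ D
    ... | yes refl = cong (λ k → 1ℤ ℤ.+ k) (local-refl (ι B) m)
    ... | no B≢D = trans (cong (λ k → value (o B + before B D l v) ℤ.+ k)
        (trans (local-≢ m (B≢D ∘ ι-injective)) (cong (λ o → value (o + before (ι B) (ι D) m v)) (o-ι B))))
      (values (o B) _ _ (ℕ.+-cancelʳ-≤ 1 _ 1 (subst (λ k → o B + k ≤ 2) ≡1 (o-bound B)))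
        (trans (complementary l m eq B≢D) ≡1))
      where
      values : ∀ o b b′ → o ≤ 1 → b + b′ ≡ 1 → value (o + b) ℤ.+ value (o + b′) ≡ ℤ.+ 2
      values 0 0 .1 _ refl = refl
      values 0 1 0  _ refl = refl
      values 1 0 .1 _ refl = refl
      values 1 1 0  _ refl = refl
      values 0 (suc (suc _)) _ _ ()
      values 1 (suc (suc _)) _ _ ()
      values (suc (suc _)) _ _ (s≤s ()) _

    local-absent : ∀ {B} → occ B v ≡ 0 → ∀ D l → l < occ D v → local B D l ≡ value (o B)
    local-absent {B} ≡0 D l l< = trans
      (local-≢ l λ { refl → contradiction (subst (l <_) ≡0 l<) λ () })
      (cong value (trans (cong (o B +_) (before-∉ D l v ≡0)) (ℕ.+-identityʳ _)))

    -- By `local-one` the reflection carries h_B to 2 - h_{ιB} and h_{ιB} to 2 - h_B on v, and the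
    -- constants cancel in the difference. If B does not occur in v, both functions are constant
    -- there.
    local-difference : ∀ {B} → occ B v ≡ 0 ⊎ occ B v ≡ 1 → ∀ D l m → suc (l + m) ≡ occ D v →
                       local B (ι D) m ℤ.- local (ι B) (ι D) m ≡ local B D l ℤ.- local (ι B) D l
    local-difference {B} (inj₁ ≡0) D l m eq = cong₂ ℤ._-_
      (trans (local-absent ≡0 (ι D) m m<) (sym (local-absent ≡0 D l l<)))
      (trans (local-absent ι≡0 (ι D) m m<) (sym (local-absent ι≡0 D l l<)))
      where
      ι≡0 = trans (occ-ι B) ≡0
      l< : l < occ D v
      l< = subst (l <_) eq (s≤s (ℕ.m≤m+n l m))
      m< : m < occ (ι D) v
      m< = subst (m <_) (trans eq (sym (occ-ι D))) (s≤s (ℕ.m≤n+m m l))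
    local-difference {B} (inj₂ ≡1) D l m eq = lemma
      (local B D l) (local (ι B) D l) (local B (ι D) m) (local (ι B) (ι D) m)
      (local-one ≡1 D l m eq)
      (subst (λ C → local (ι B) D l ℤ.+ local C (ι D) m ≡ ℤ.+ 2) (ιι B)
        (local-one (trans (occ-ι B) ≡1) D l m eq))
      where
      lemma : ∀ p q p′ q′ → p ℤ.+ q′ ≡ ℤ.+ 2 → q ℤ.+ p′ ≡ ℤ.+ 2 → p′ ℤ.- q′ ≡ p ℤ.- q
      lemma p q p′ q′ e e′ = trans (solve₁ p q p′ q′) (trans
        (cong (λ k → k ℤ.- (p ℤ.+ q′) ℤ.+ (p ℤ.- q)) (trans e′ (sym e)))
        (solve₂ (p ℤ.+ q′) (p ℤ.- q)))
        where
        solve₁ : ∀ p q p′ q′ → p′ ℤ.- q′ ≡ (q ℤ.+ p′) ℤ.- (p ℤ.+ q′) ℤ.+ (p ℤ.- q)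
        solve₁ = solve-∀
        solve₂ : ∀ k l → k ℤ.- k ℤ.+ l ≡ l
        solve₂ = solve-∀

value-even : ∀ {n} → 2 ∣ n → value n ≡ 0ℤ
value-even {0}           _ = refl
value-even {1}           2∣1 = contradiction (ℕ∣.∣⇒≤ 2∣1) λ { (s≤s ()) }
value-even {suc (suc _)} _ = refl

parity-even : ∀ {n} → Parity Sign.+ n → 2 ∣ n
parity-even none = divides 0 refl
parity-even both = divides 1 refl

parity-one : ∀ {n} → Parity Sign.- n → n ≡ 0 ⊎ n ≡ 1
parity-one none = inj₁ refl
parity-one one  = inj₂ refl

parity-both : ∀ {n} → Parity Sign.+ n → n ≡ 0 ⊎ n ≡ 2
parity-both none = inj₁ refl
parity-both both = inj₂ refl

-- The order of the two occurrences of a letter is reversed by the reflection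
-- exactly if both of them lie in the same word of the phrase.
turn : Sign → ℕ → ℕ
turn Sign.+ k = 1 ℕ.∸ k
turn Sign.- k = k

-- If both occurrences lie in the word, none precedes it, and l and m are 0 and 1 in some order. If
-- only one lies there, l = m = 0 and its number o is kept.
turn-position : ∀ {s n} o l m → Parity s n → suc (l + m) ≡ n → o + n ≤ 2 → turn s (o + l) ≡ o + m
turn-position o l m both eq o+2≤2 with ℕ.n≤0⇒n≡0 (ℕ.+-cancelʳ-≤ 2 o 0 o+2≤2)
turn-position .0 0 1 both refl _ | refl = refl
turn-position .0 1 0 both refl _ | refl = refl
turn-position .0 (suc (suc _)) _ both () _ | refl
turn-position o 0 .0 one refl _ = refl

-- Levels in a word into which a symmetric phrase is inserted

module Shuffles {X Y : Set} (_≟₁_ : DecidableEquality X) (_≟₂_ : DecidableEquality Y)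
                (_≟_ : DecidableEquality (X ⊎ Y))
                (ι : Y → Y) (ιι : ∀ B → ι (ι B) ≡ B) (sgn : Y → Sign) where
  open Reflection _≟₂_ ι ιι sgn
  open Words _≟_
  private
    module X = Words _≟₁_
    module Y = Words _≟₂_

  -- The words x₁ v₁ x₂ v₂ ⋯ together with x₁ x₂ ⋯.
  data Shuffle : List (X ⊎ Y) → List X → Set where
    []    : Shuffle [] []
    outer : ∀ x {w u} → Shuffle w u → Shuffle (map inj₁ x ++ w) (x ++ u)
    inner : ∀ v {w u} → Good v → Shuffle w u → Shuffle (map inj₂ v ++ w) u

  occ₁ : ∀ A x → occ (inj₁ A) (map inj₁ x) ≡ X.occ A x
  occ₁ = occ-map _≟₁_ _≟_ Sum.inj₁-injective
  occ₂ : ∀ B v → occ (inj₂ B) (map inj₂ v) ≡ Y.occ B v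
  occ₂ = occ-map _≟₂_ _≟_ Sum.inj₂-injective
  occ₁₂ : ∀ A v → occ (inj₁ A) (map inj₂ v) ≡ 0
  occ₁₂ A = occ-map-∉ _≟_ λ _ ()
  occ₂₁ : ∀ B x → occ (inj₂ B) (map inj₁ x) ≡ 0
  occ₂₁ B = occ-map-∉ _≟_ λ _ ()

  shuffle-occ-ι : ∀ {w u} → Shuffle w u → ∀ B → occ (inj₂ (ι B)) w ≡ occ (inj₂ B) w
  shuffle-occ-ι []               B = refl
  shuffle-occ-ι (outer x {w} sh) B = trans (occ-++ _ (map inj₁ x) w) (trans
    (cong₂ _+_ (trans (occ₂₁ (ι B) x) (sym (occ₂₁ B x))) (shuffle-occ-ι sh B))
    (sym (occ-++ _ (map inj₁ x) w)))
  shuffle-occ-ι (inner v {w} good sh) B = trans (occ-++ _ (map inj₂ v) w) (trans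
    (cong₂ _+_ (trans (occ₂ (ι B) v) (trans (Good.occ-ι good B) (sym (occ₂ B v)))) (shuffle-occ-ι sh B))
    (sym (occ-++ _ (map inj₂ v) w)))

  shuffle-even : ∀ {w u} → Shuffle w u → ∀ B → sgn B ≡ Sign.+ → 2 ∣ occ (inj₂ B) w
  shuffle-even []               B B+ = divides 0 refl
  shuffle-even (outer x {w} sh) B B+ = subst (2 ∣_)
    (sym (trans (occ-++ _ (map inj₁ x) w) (cong (_+ occ (inj₂ B) w) (occ₂₁ B x))))
    (shuffle-even sh B B+)
  shuffle-even (inner v {w} good sh) B B+ = subst (2 ∣_)
    (sym (trans (occ-++ _ (map inj₂ v) w) (cong (_+ occ (inj₂ B) w) (occ₂ B v))))
    (ℕ∣.∣m∣n⇒∣m+n (parity-even (subst (λ s → Parity s (Y.occ B v)) B+ (Good.parity good B)))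
      (shuffle-even sh B B+))

  shuffle-before : ∀ {w u} → Shuffle w u → ∀ A D k → before (inj₁ A) (inj₁ D) k w ≡ X.before A D k u
  shuffle-before []                   A D k = refl
  shuffle-before (outer x {w} {u} sh) A D k with k ℕ.<? X.occ D x
  ... | yes k< = begin
    before (inj₁ A) (inj₁ D) k (map inj₁ x ++ w)
      ≡⟨ before-++ˡ (inj₁ A) (inj₁ D) k (map inj₁ x) w (subst (k <_) (sym (occ₁ D x)) k<) ⟩
    before (inj₁ A) (inj₁ D) k (map inj₁ x)
      ≡⟨ before-map _≟₁_ _≟_ Sum.inj₁-injective A D k x ⟩
    X.before A D k x
      ≡⟨ X.before-++ˡ A D k x u k< ⟨
    X.before A D k (x ++ u) ∎
    where open ≡-Reasoning
  ... | no k≮ = begin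
    before (inj₁ A) (inj₁ D) k (map inj₁ x ++ w)
      ≡⟨ cong (λ k → before (inj₁ A) (inj₁ D) k (map inj₁ x ++ w)) k≡ ⟩
    before (inj₁ A) (inj₁ D) (occ (inj₁ D) (map inj₁ x) + m) (map inj₁ x ++ w)
      ≡⟨ before-++ʳ (inj₁ A) (inj₁ D) m (map inj₁ x) w ⟩
    occ (inj₁ A) (map inj₁ x) + before (inj₁ A) (inj₁ D) m w
      ≡⟨ cong₂ _+_ (occ₁ A x) (shuffle-before sh A D m) ⟩
    X.occ A x + X.before A D m u
      ≡⟨ X.before-++ʳ A D m x u ⟨
    X.before A D (X.occ D x + m) (x ++ u)
      ≡⟨ cong (λ k → X.before A D k (x ++ u)) (ℕ.m+[n∸m]≡n (ℕ.≮⇒≥ k≮)) ⟩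
    X.before A D k (x ++ u) ∎
    where
    open ≡-Reasoning
    m = k ℕ.∸ X.occ D x
    k≡ : k ≡ occ (inj₁ D) (map inj₁ x) + m
    k≡ = trans (sym (ℕ.m+[n∸m]≡n (ℕ.≮⇒≥ k≮))) (cong (_+ m) (sym (occ₁ D x)))
  shuffle-before (inner v {w} good sh) A D k = trans
    (before-skip _≟_ (inj₁ A) {u = map inj₂ v} k w (occ₁₂ D v))
    (trans (cong (_+ before (inj₁ A) (inj₁ D) k w) (occ₁₂ A v)) (shuffle-before sh A D k))

  data Piece : List (X ⊎ Y) → Set where
    outer : ∀ x → Piece (map inj₁ x)
    inner : ∀ v → Good v → Piece (map inj₂ v)

  -- An occurrence is placed in a piece whose prefix is again a shuffle. The levels at the
  -- occurrence depend on the prefix only through its numbers of letters, and for the letters of the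
  -- phrase these are invariant under ι by `shuffle-occ-ι`.
  record Located (w : List (X ⊎ Y)) (D : X ⊎ Y) (k : ℕ) : Set where
    field
      {prefix suffix piece} : List (X ⊎ Y)
      {prefix₀}             : List X
      split                 : w ≡ prefix ++ piece ++ suffix
      shuffle               : Shuffle prefix prefix₀
      isPiece               : Piece piece
      l                     : ℕ
      k≡                    : k ≡ occ D prefix + l
      l<                    : l < occ D piece

    occ-split : ∀ E → occ E w ≡ occ E prefix + (occ E piece + occ E suffix)
    occ-split E = trans (cong (occ E) split) (trans (occ-++ E prefix _)
      (cong (occ E prefix +_) (occ-++ E piece suffix)))

    before-split : ∀ A E m → m < occ E piece →
                   before A E (occ E prefix + m) w ≡ occ A prefix + before A E m piece
    before-split A E m m< = trans (cong (before A E (occ E prefix + m)) split) (trans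
      (before-++ʳ A E m prefix (piece ++ suffix))
      (cong (occ A prefix +_) (before-++ˡ A E m piece suffix m<)))

  private
    inPiece : ∀ {q w D k} → Piece q → k < occ D q → Located (q ++ w) D k
    inPiece p k< = record { split = refl ; shuffle = [] ; isPiece = p ; l = _ ; k≡ = refl ; l< = k< }

    inRest : ∀ {q w D k} → (∀ {u u₀} → Shuffle u u₀ → ∃[ u₁ ] Shuffle (q ++ u) u₁) →
            occ D q ≤ k → Located w D (k ℕ.∸ occ D q) → Located (q ++ w) D k
    inRest {q} {D = D} extend k≥ loc = record
      { split   = trans (cong (q ++_) split) (sym (++-assoc q _ _))
      ; shuffle = proj₂ (extend shuffle)
      ; isPiece = isPiece
      ; l       = l
      ; k≡      = trans (sym (ℕ.m+[n∸m]≡n k≥)) (trans (cong (occ D q +_) k≡) (trans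
                    (sym (ℕ.+-assoc (occ D q) _ l)) (cong (_+ l) (sym (occ-++ D q _)))))
      ; l<      = l<
      }
      where open Located loc

    rest : ∀ {q w D k} → k < occ D (q ++ w) → occ D q ≤ k → k ℕ.∸ occ D q < occ D w
    rest {q} {w} {D} {k} k< k≥ = ℕ.+-cancelˡ-< (occ D q) _ _
      (subst₂ _<_ (sym (ℕ.m+[n∸m]≡n k≥)) (occ-++ D q w) k<)

  locate : ∀ {w u} → Shuffle w u → ∀ D k → k < occ D w → Located w D k
  locate (outer x {w} sh) D k k< with k ℕ.<? occ D (map inj₁ x)
  ... | yes k<x = inPiece (outer x) k<x
  ... | no  k≮x = inRest (λ sh → _ , outer x sh) (ℕ.≮⇒≥ k≮x)
    (locate sh D _ (rest {map inj₁ x} {w} k< (ℕ.≮⇒≥ k≮x)))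
  locate (inner v {w} good sh) D k k< with k ℕ.<? occ D (map inj₂ v)
  ... | yes k<v = inPiece (inner v good) k<v
  ... | no  k≮v = inRest (λ sh → _ , inner v good sh) (ℕ.≮⇒≥ k≮v)
    (locate sh D _ (rest {map inj₂ v} {w} k< (ℕ.≮⇒≥ k≮v)))

  module _ {w w′} (sh : Shuffle w w′) (occ≡2 : ∀ D → occ D w ≡ 2) where
    private
      locate₂ : ∀ D k → k < 2 → Located w D k
      locate₂ D k k<2 = locate sh D k (subst (k <_) (sym (occ≡2 D)) k<2)

      -- In front of a remaining letter lie only complete words of the phrase. So B and ι B have
      -- been passed equally often, and evenly often if the sign of B is +.
      before-outer : ∀ B D k → k < 2 → ∃[ u ] ∃[ u₀ ] Shuffle u u₀ ×
                     before (inj₂ B) (inj₁ D) k w ≡ occ (inj₂ B) u ×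
                     before (inj₂ (ι B)) (inj₁ D) k w ≡ occ (inj₂ (ι B)) u
      before-outer B D k k<2 with locate₂ (inj₁ D) k k<2
      ... | record { isPiece = inner v good ; l< = l< } = contradiction (subst (_ <_) (occ₁₂ D v) l<) λ ()
      ... | loc@record { shuffle = sh ; isPiece = outer x ; l = l ; k≡ = refl ; l< = l< } =
        _ , _ , sh , at B , at (ι B)
        where
        open Located loc using (prefix; before-split)
        at : ∀ C → before (inj₂ C) (inj₁ D) (occ (inj₁ D) prefix + l) w ≡ occ (inj₂ C) prefix
        at C = trans (before-split (inj₂ C) (inj₁ D) l l<) (trans
          (cong (occ (inj₂ C) prefix +_) (before-∉ (inj₁ D) l (map inj₁ x) (occ₂₁ C x))) (ℕ.+-identityʳ _))

    outer-even : ∀ B D k → k < 2 → sgn B ≡ Sign.+ → level (inj₂ B) (inj₁ D) k w ≡ 0ℤ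
    outer-even B D k k<2 B+ with before-outer B D k k<2
    ... | u , _ , sh , eq , _ = trans (level-≢ k w λ ()) (trans (cong value eq) (value-even (shuffle-even sh B B+)))

    outer-ι : ∀ B D k → k < 2 → level (inj₂ B) (inj₁ D) k w ≡ level (inj₂ (ι B)) (inj₁ D) k w
    outer-ι B D k k<2 with before-outer B D k k<2
    ... | u , _ , sh , eq , eq′ = trans (level-≢ k w λ ()) (trans
      (cong value (trans eq (trans (sym (shuffle-occ-ι sh B)) (sym eq′)))) (sym (level-≢ k w λ ())))

    -- The mirror image of occurrence k of D is the occurrence of ι D with number `ρ D k`.
    ρ : Y → ℕ → ℕ
    ρ D k = turn (sgn D) k

    private
      record Reflected (D : Y) (k : ℕ) : Set where
        field
          {v} : List Y
          good : Good v
          o₁ : X → ℕ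
          o : Y → ℕ
          o-ι : ∀ B → o (ι B) ≡ o B
          bound : ∀ B → o B + Y.occ B v ≤ 2
          l m : ℕ
          l+m : suc (l + m) ≡ Y.occ D v
        open Block good o o-ι bound public
        field
          outer-level   : ∀ A → level (inj₁ A) (inj₂ D) k w ≡ value (o₁ A)
          outer-level-ι : ∀ A → level (inj₁ A) (inj₂ (ι D)) (ρ D k) w ≡ value (o₁ A)
          inner-level   : ∀ B → level (inj₂ B) (inj₂ D) k w ≡ local B D l
          inner-level-ι : ∀ B → level (inj₂ B) (inj₂ (ι D)) (ρ D k) w ≡ local B (ι D) m

      reflect : ∀ D k → k < 2 → Reflected D k
      reflect D k k<2 with locate₂ (inj₂ D) k k<2
      ... | record { isPiece = outer x ; l< = l< } = contradiction (subst (_ <_) (occ₂₁ D x) l<) λ ()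
      ... | loc@record { prefix = prefix ; shuffle = sh ; isPiece = inner v good ; l = l ; k≡ = refl ; l< = l< } = record
        { good = good
        ; o₁ = λ A → occ (inj₁ A) prefix
        ; o = o
        ; o-ι = shuffle-occ-ι sh
        ; bound = bound
        ; l = l
        ; m = m
        ; l+m = l+m
        ; outer-level   = outer-at D l l<
        ; outer-level-ι = λ A → subst (λ k → level (inj₁ A) (inj₂ (ι D)) k w ≡ value (occ (inj₁ A) prefix))
            (sym ρ≡) (outer-at (ι D) m m< A)
        ; inner-level   = inner-at D l l<
        ; inner-level-ι = λ B → subst (λ k → level (inj₂ B) (inj₂ (ι D)) k w ≡ local B (ι D) m)
            (sym ρ≡) (inner-at (ι D) m m< B)
        }
        where
        open Located loc using (occ-split; before-split; suffix)
        open Good good using (parity; occ-ι)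
        o : Y → ℕ
        o B = occ (inj₂ B) prefix
        bound : ∀ B → o B + Y.occ B v ≤ 2
        bound B = subst₂ (λ p q → o B + p ≤ q) (occ₂ B v) (occ≡2 (inj₂ B))
          (subst (o B + occ (inj₂ B) (map inj₂ v) ≤_) (sym (occ-split (inj₂ B)))
            (ℕ.+-monoʳ-≤ (o B) (ℕ.m≤m+n _ (occ (inj₂ B) suffix))))
        open Block good o (shuffle-occ-ι sh) bound
        -- The number of the mirror image inside v: the occurrences of D behind the given one, which
        -- the reflection puts in front.
        m = Y.occ D v ℕ.∸ suc l
        l+m : suc (l + m) ≡ Y.occ D v
        l+m = ℕ.m+[n∸m]≡n (subst (l <_) (occ₂ D v) l<)
        m< : m < occ (inj₂ (ι D)) (map inj₂ v)
        m< = subst (m <_) (trans l+m (sym (trans (occ₂ (ι D) v) (occ-ι D)))) (s≤s (ℕ.m≤n+m m l))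
        ρ≡ : ρ D (o D + l) ≡ occ (inj₂ (ι D)) prefix + m
        ρ≡ = trans (turn-position (o D) l m (parity D) l+m (bound D)) (cong (_+ m) (sym (shuffle-occ-ι sh D)))
        outer-at : ∀ E n → n < occ (inj₂ E) (map inj₂ v) → ∀ A →
                   level (inj₁ A) (inj₂ E) (occ (inj₂ E) prefix + n) w ≡ value (occ (inj₁ A) prefix)
        outer-at E n n< A = trans (level-≢ _ w λ ()) (cong value (trans (before-split (inj₁ A) (inj₂ E) n n<)
          (trans (cong (occ (inj₁ A) prefix +_) (before-∉ (inj₂ E) n (map inj₂ v) (occ₁₂ A v))) (ℕ.+-identityʳ _))))
        inner-at : ∀ E n → n < occ (inj₂ E) (map inj₂ v) → ∀ B →
                   level (inj₂ B) (inj₂ E) (occ (inj₂ E) prefix + n) w ≡ local B E n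
        inner-at E n n< B = cong₂ (λ b k → if b then 1ℤ else value k)
          (does-map _≟₂_ _≟_ Sum.inj₂-injective B E)
          (trans (before-split (inj₂ B) (inj₂ E) n n<)
            (cong (o B +_) (before-map _≟₂_ _≟_ Sum.inj₂-injective B E n v)))

    outer-reflected : ∀ A D k → k < 2 →
      level (inj₁ A) (inj₂ (ι D)) (ρ D k) w ≡ level (inj₁ A) (inj₂ D) k w
    outer-reflected A D k k<2 = trans (outer-level-ι A) (sym (outer-level A))
      where open Reflected (reflect D k k<2)

    both-reflected : ∀ B D k → k < 2 → sgn B ≡ Sign.+ →
      level (inj₂ (ι B)) (inj₂ (ι D)) (ρ D k) w ≡ level (inj₂ B) (inj₂ D) k w
    both-reflected B D k k<2 B+ = trans (inner-level-ι (ι B)) (trans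
      (local-both (parity-both (subst (λ s → Parity s (Y.occ B v)) B+ (Good.parity good B))) D l m l+m)
      (sym (inner-level B)))
      where open Reflected (reflect D k k<2)

    one-reflected : ∀ B D k → k < 2 → sgn B ≡ Sign.- →
      level (inj₂ B) (inj₂ (ι D)) (ρ D k) w ℤ.- level (inj₂ (ι B)) (inj₂ (ι D)) (ρ D k) w ≡
      level (inj₂ B) (inj₂ D) k w ℤ.- level (inj₂ (ι B)) (inj₂ D) k w
    one-reflected B D k k<2 B- = trans (cong₂ ℤ._-_ (inner-level-ι B) (inner-level-ι (ι B))) (trans
      (local-difference (parity-one (subst (λ s → Parity s (Y.occ B v)) B- (Good.parity good B))) D l m l+m)
      (sym (cong₂ ℤ._-_ (inner-level B) (inner-level (ι B)))))
      where open Reflected (reflect D k k<2)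

-- The bordism of a surgery

module _ {a} {α : Set a} (τ : α → α) (τ-involutive : Involutive _≡_ τ) where
  open Coefficients τ
  open Matchings τ τ-involutive
  open Bordisms τ τ-involutive

  module Surgeries (𝒜 ℬ : Alphabet α) (ι : Alphabet.Letter ℬ → Alphabet.Letter ℬ)
                   (ιι : ∀ B → ι (ι B) ≡ B) (sgn : Alphabet.Letter ℬ → Sign)
                   (sgn-ι : ∀ B → sgn (ι B) ≡ sgn B)
                   (label-ι : ∀ B → Alphabet.∣_∣ ℬ (ι B) ≡ act (sgn B) (Alphabet.∣_∣ ℬ B)) where
    private
      module 𝒜 = Alphabet 𝒜
      module ℬ = Alphabet ℬ
      𝒞 = 𝒜 ⊎ᵃ ℬ
      module 𝒞 = Alphabet 𝒞
    open Shuffles 𝒜._≟_ ℬ._≟_ 𝒞._≟_ ι ιι sgn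
    open Reflection ℬ._≟_ ι ιι sgn

    module _ {w w′} (twice : ∀ A → 𝒞.occurrences A w ≡ 2) (twice′ : ∀ A → 𝒜.occurrences A w′ ≡ 2)
             (sh : Shuffle w w′) where
      private
        W = record { alphabet = 𝒞 ; word = w ; twice = twice }
        W′ = record { alphabet = 𝒜 ; word = w′ ; twice = twice′ }
        module F = NanowordForm τ W
        module F′ = NanowordForm τ W′
        𝓅 = pairing τ W
        𝓆 = pairing τ W′
        open Pair 𝓅 𝓆
        occ≡2 = F.occ≡2
        level : 𝒞.Letter → 𝒞.Letter → ℕ → ℤ
        level A D k = F.h (just A) D k

        ρ′ : ℬ.Letter → ℕ → ℕ
        ρ′ = ρ sh occ≡2

        -- For the sign -, a word of the phrase that contains B contains it only once, which
        -- `fixed-occ` excludes for a fixed letter.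
        fixed-sign : ∀ B → ι B ≡ B → sgn B ≡ Sign.+
        fixed-sign B ιB≡B with locate sh (inj₂ B) 0 (F.occurs (inj₂ B) (s≤s z≤n))
        ... | record { isPiece = outer x ; l< = l< } = contradiction (subst (_ <_) (occ₂₁ B x) l<) λ ()
        ... | record { isPiece = inner v good ; l< = l< }
          with sgn B | Words.occ ℬ._≟_ B v in eq | Good.parity good B
        ...   | _     | _ | none = contradiction (subst (_ <_) (trans (occ₂ B v) eq) l<) λ ()
        ...   | Sign.+ | _ | both = refl
        ...   | Sign.- | _ | one  = contradiction eq (Good.fixed-occ good ιB≡B)

        -- The subgroup is cut out by the properties that make the forms agree and not generated by
        -- the vectors of the filling; its closure under sums is then immediate.
        record Balanced (x : Maybe Letter → ℤ) : Set where
          field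
            {ξ}       : 𝒞.Letter → ℕ → ℤ
            {ξ′}      : 𝒜.Letter → ℕ → ℤ
            profile   : F.Profile (x ∘ Maybe.map inj₁) ξ
            profile′  : F′.Profile (x ∘ Maybe.map inj₂) ξ′
            outside   : ∀ D k → k < 2 → ξ (inj₁ D) k ≡ ξ′ D k
            reflected : ∀ D k → k < 2 → ξ (inj₂ (ι D)) (ρ′ D k) ≡ ξ (inj₂ D) k

        balanced-resp : ∀ {x y} → x ≗ y → Balanced x → Balanced y
        balanced-resp x≗y b = record
          { profile   = F.resp (λ u → x≗y _) profile
          ; profile′  = F′.resp (λ u → x≗y _) profile′
          ; outside   = outside
          ; reflected = reflected
          }
          where open Balanced b

        balanced-add : ∀ {x y} → Balanced x → Balanced y → Balanced (λ u → x u ℤ.+ y u)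
        balanced-add b c = record
          { profile   = F.add B.profile C.profile
          ; profile′  = F′.add B.profile′ C.profile′
          ; outside   = λ D k k<2 → cong₂ ℤ._+_ (B.outside D k k<2) (C.outside D k k<2)
          ; reflected = λ D k k<2 → cong₂ ℤ._+_ (B.reflected D k k<2) (C.reflected D k k<2)
          }
          where
          module B = Balanced b
          module C = Balanced c

        balanced-neg : ∀ {x} → Balanced x → Balanced (λ u → ℤ.- x u)
        balanced-neg b = record
          { profile   = F.neg profile
          ; profile′  = F′.neg profile′
          ; outside   = λ D k k<2 → cong ℤ.-_ (outside D k k<2)
          ; reflected = λ D k k<2 → cong ℤ.-_ (reflected D k k<2)
          }
          where open Balanced b

        subgroup : IsSubgroup Balanced
        subgroup = record
          { resp = balanced-resp
          ; null = record
            { profile   = F.null-profile λ _ → refl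
            ; profile′  = F′.null-profile λ _ → refl
            ; outside   = λ _ _ _ → refl
            ; reflected = λ _ _ _ → refl
            }
          ; add  = balanced-add
          ; neg  = balanced-neg
          }

        turn-turn : ∀ s {k} → k < 2 → turn s k < 2 × turn s (turn s k) ≡ k
        turn-turn Sign.+ {0} k<2 = s≤s (s≤s z≤n) , refl
        turn-turn Sign.+ {1} k<2 = s≤s z≤n , refl
        turn-turn Sign.+ {suc (suc _)} (s≤s (s≤s ()))
        turn-turn Sign.- k<2 = k<2 , refl

        -- The coefficients of the remaining letters coincide. For a letter D of the phrase with
        -- sign +, the reflection exchanges the order of the two occurrences, so the coefficient of
        -- ι D is opposite while the label is the same. With sign -, the coefficient is the same
        -- while the label is moved by `τ`, which negates the generator. In both cases the terms of
        -- D and ι D cancel.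
        agree : ∀ {x y} → Balanced x → Balanced y →
                Pairing.ẽ 𝓅 (x ∘ Maybe.map inj₁) (y ∘ Maybe.map inj₁) ≋
                Pairing.ẽ 𝓆 (x ∘ Maybe.map inj₂) (y ∘ Maybe.map inj₂)
        agree b c with F.ẽ-represents (Balanced.profile b) (Balanced.profile c)
                     | F′.ẽ-represents (Balanced.profile′ b) (Balanced.profile′ c)
        ... | F.represents N N≡ N≋ | F′.represents N′ N′≡ N′≋ = begin
          _
            ≈⟨ N≋ ⟩
          F.Φ N
            ≈⟨ ∑-⊎ 𝒜.letters ℬ.letters (λ D → N D • gen 𝒞.∣ D ∣) ⟩
          F′.Φ (N ∘ inj₁) ⊹ ∑ τ ℬ.letters (λ D → N (inj₂ D) • gen ℬ.∣ D ∣)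
            ≈⟨ ⊹-cong (F′.Φ-cong {N ∘ inj₁} {N′} N≡N′)
                 (∑-antisymmetric τ ℬ.letters ι (λ D → N (inj₂ D) • gen ℬ.∣ D ∣) ιι
                   (λ D → antisymmetric D (sgn D) refl) fixed) ⟩
          F′.Φ N′ ⊹ 𝟘
            ≈⟨ π.identityʳ _ ⟩
          F′.Φ N′
            ≈⟨ N′≋ ⟨
          _ ∎
          where
          open import Relation.Binary.Reasoning.Setoid π.setoid
          module B = Balanced b
          module C = Balanced c
          N≡N′ : ∀ D → N (inj₁ D) ≡ N′ D
          N≡N′ D = double-injective (trans (N≡ (inj₁ D)) (trans
            (det-cong (B.outside D) (C.outside D)) (sym (N′≡ D))))
          flipped : ∀ D → sgn D ≡ Sign.+ → N (inj₂ (ι D)) ≡ ℤ.- N (inj₂ D)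
          flipped D D+ = double-injective {l = ℤ.- N (inj₂ D)} (trans (N≡ (inj₂ (ι D))) (trans
            (det-cong (at {B.ξ} B.reflected) (at {C.ξ} C.reflected))
            (trans (det-reverse (B.ξ (inj₂ D)) (C.ξ (inj₂ D)))
              (trans (cong ℤ.-_ (sym (N≡ (inj₂ D)))) (ℤ.neg-distrib-+ (N (inj₂ D)) (N (inj₂ D)))))))
            where
            at : ∀ {X : 𝒞.Letter → ℕ → ℤ} → (∀ D k → k < 2 → X (inj₂ (ι D)) (ρ′ D k) ≡ X (inj₂ D) k) →
                 ∀ k → k < 2 → X (inj₂ (ι D)) k ≡ X (inj₂ D) (1 ℕ.∸ k)
            at {X} reflected k k<2 = let <2 , tt = turn-turn Sign.+ k<2 in trans
              (cong (X (inj₂ (ι D))) (trans (sym tt) (cong (λ s → turn s (1 ℕ.∸ k)) (sym D+))))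
              (reflected D (1 ℕ.∸ k) <2)
          kept : ∀ D → sgn D ≡ Sign.- → N (inj₂ (ι D)) ≡ N (inj₂ D)
          kept D D- = double-injective (trans (N≡ (inj₂ (ι D))) (trans
            (det-cong (at {B.ξ} B.reflected) (at {C.ξ} C.reflected)) (sym (N≡ (inj₂ D)))))
            where
            at : ∀ {X : 𝒞.Letter → ℕ → ℤ} → (∀ D k → k < 2 → X (inj₂ (ι D)) (ρ′ D k) ≡ X (inj₂ D) k) →
                 ∀ k → k < 2 → X (inj₂ (ι D)) k ≡ X (inj₂ D) k
            at {X} reflected k k<2 = trans
              (cong (λ s → X (inj₂ (ι D)) (turn s k)) (sym D-)) (reflected D k k<2)
          antisymmetric : ∀ D s → sgn D ≡ s → N (inj₂ (ι D)) • gen ℬ.∣ ι D ∣ ≋ ⊖ (N (inj₂ D) • gen ℬ.∣ D ∣)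
          antisymmetric D Sign.+ D+ = begin
            N (inj₂ (ι D)) • gen ℬ.∣ ι D ∣
              ≡⟨ cong₂ (λ k c → k • gen c) (flipped D D+)
                   (trans (label-ι D) (cong (λ s → act s ℬ.∣ D ∣) D+)) ⟩
            (ℤ.- N (inj₂ D)) • gen ℬ.∣ D ∣
              ≈⟨ •-homo-neg (N (inj₂ D)) _ ⟩
            ⊖ (N (inj₂ D) • gen ℬ.∣ D ∣) ∎
          antisymmetric D Sign.- D- = begin
            N (inj₂ (ι D)) • gen ℬ.∣ ι D ∣
              ≡⟨ cong₂ (λ k c → k • gen c) (kept D D-)
                   (trans (label-ι D) (cong (λ s → act s ℬ.∣ D ∣) D-)) ⟩
            N (inj₂ D) • gen (τ ℬ.∣ D ∣)
              ≈⟨ •-cong (N (inj₂ D)) (gen-τ ℬ.∣ D ∣) ⟩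
            N (inj₂ D) • (⊖ gen ℬ.∣ D ∣)
              ≈⟨ •-⊖ (N (inj₂ D)) _ ⟩
            ⊖ (N (inj₂ D) • gen ℬ.∣ D ∣) ∎
          -- A term equal to its own negative might survive in `π`. Here the sign is + and the
          -- integer coefficient itself is its own negative, hence 0.
          fixed : ∀ D → ι D ≡ D → N (inj₂ D) • gen ℬ.∣ D ∣ ≋ 𝟘
          fixed D ιD≡D = •-congˡ (gen ℬ.∣ D ∣) (double-injective {N (inj₂ D)} {0ℤ} (trans
            (cong (ℤ._+ N (inj₂ D)) (trans (cong (N ∘ inj₂) (sym ιD≡D)) (flipped D (fixed-sign D ιD≡D))))
            (ℤ.+-inverseˡ (N (inj₂ D)))))

        partnerᴮ : ∀ B → Dec (ι B ≡ B) → Maybe (Sign × Letter)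
        partnerᴮ B (yes _) = nothing
        partnerᴮ B (no _)  = just (sgn B , inj₁ (inj₂ (ι B)))

        partner : Letter → Maybe (Sign × Letter)
        partner (inj₁ (inj₁ A)) = just (Sign.+ , inj₂ A)
        partner (inj₁ (inj₂ B)) = partnerᴮ B (ι B ℬ.≟ B)
        partner (inj₂ A)        = just (Sign.+ , inj₁ (inj₁ A))

        partnerᴮ-no : ∀ {B} → ι B ≢ B → ∀ d → partnerᴮ B d ≡ just (sgn B , inj₁ (inj₂ (ι B)))
        partnerᴮ-no ¬p (yes p) = contradiction p ¬p
        partnerᴮ-no ¬p (no _)  = refl

        symmetricᴮ : ∀ B d {s y} → partnerᴮ B d ≡ just (s , y) → partner y ≡ just (s , inj₁ (inj₂ B))
        symmetricᴮ B (no ιB≢B) refl = trans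
          (partnerᴮ-no (λ eq → ιB≢B (sym (trans (sym (ιι B)) eq))) (ι (ι B) ℬ.≟ ι B))
          (cong₂ (λ s C → just (s , inj₁ (inj₂ C))) (sgn-ι B) (ιι B))
        distinctᴮ : ∀ B d {s y} → partnerᴮ B d ≡ just (s , y) → inj₁ (inj₂ B) ≢ y
        distinctᴮ B (no ιB≢B) refl eq = ιB≢B (sym (Sum.inj₂-injective (Sum.inj₁-injective eq)))
        compatibleᴮ : ∀ B d {s y} → partnerᴮ B d ≡ just (s , y) → ℬ.∣ B ∣ ≡ act s ∣ y ∣
        compatibleᴮ B (no _) refl = act-flip (sgn B) (label-ι B)

        δ-in₁ : ∀ c u → δ _≟_ (inj₁ c) (inj₁ u) ≡ δ 𝒞._≟_ c u
        δ-in₁ c u = δ-cong _≟_ 𝒞._≟_ {inj₁ c} {inj₁ u} {c} {u} Sum.inj₁-injective (cong inj₁)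
        δ-in₂ : ∀ c u → δ _≟_ (inj₂ c) (inj₂ u) ≡ δ 𝒜._≟_ c u
        δ-in₂ c u = δ-cong _≟_ 𝒜._≟_ {inj₂ c} {inj₂ u} {c} {u} Sum.inj₂-injective (cong inj₂)
        δ-off₁ : ∀ c u → δ _≟_ (inj₂ c) (inj₁ u) ≡ 0ℤ
        δ-off₁ c u = δ-≢ _≟_ {inj₂ c} {inj₁ u} λ ()
        δ-off₂ : ∀ c u → δ _≟_ (inj₁ c) (inj₂ u) ≡ 0ℤ
        δ-off₂ c u = δ-≢ _≟_ {inj₁ c} {inj₂ u} λ ()

        memberᴬ : ∀ {x} A → (∀ u → extend x (Maybe.map inj₁ u) ≡ δ (Maybe.≡-dec 𝒞._≟_) (just (inj₁ A)) u) →
                  (∀ u → extend x (Maybe.map inj₂ u) ≡ δ (Maybe.≡-dec 𝒜._≟_) (just A) u) →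
                  Balanced (extend x)
        memberᴬ A in₁ in₂ = record
          { profile   = F.resp (sym ∘ in₁) (F.basis (just (inj₁ A)))
          ; profile′  = F′.resp (sym ∘ in₂) (F′.basis (just A))
          ; outside   = λ D k k<2 → cong₂ (λ b v → if b then 1ℤ else value v)
              (does-map 𝒜._≟_ 𝒞._≟_ Sum.inj₁-injective A D) (shuffle-before sh A D k)
          ; reflected = λ D k k<2 → outer-reflected sh occ≡2 A D k k<2
          }

        -- The sign prescribed by the labels is the one that works for the functions. For the sign
        -- +, h_B and h_{ιB} vanish at the remaining letters and are exchanged by the reflection, so
        -- their sum is invariant. For the sign -, they coincide at the remaining letters and only
        -- their difference is invariant.
        combine : ∀ B s → sgn B ≡ s →
          (∀ D k → k < 2 → level (inj₂ B) (inj₁ D) k ℤ.+ scale s (level (inj₂ (ι B)) (inj₁ D) k) ≡ 0ℤ) ×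
          (∀ D k → k < 2 →
            level (inj₂ B) (inj₂ (ι D)) (ρ′ D k) ℤ.+ scale s (level (inj₂ (ι B)) (inj₂ (ι D)) (ρ′ D k)) ≡
            level (inj₂ B) (inj₂ D) k ℤ.+ scale s (level (inj₂ (ι B)) (inj₂ D) k))
        combine B Sign.+ B+ =
          (λ D k k<2 → cong₂ ℤ._+_ (outer-even sh occ≡2 B D k k<2 B+)
                                   (outer-even sh occ≡2 (ι B) D k k<2 (trans (sgn-ι B) B+))) ,
          (λ D k k<2 → trans (cong₂ ℤ._+_
            (subst (λ C → level (inj₂ C) (inj₂ (ι D)) (ρ′ D k) ≡ level (inj₂ (ι B)) (inj₂ D) k) (ιι B)
              (both-reflected sh occ≡2 (ι B) D k k<2 (trans (sgn-ι B) B+)))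
            (both-reflected sh occ≡2 B D k k<2 B+))
            (ℤ.+-comm (level (inj₂ (ι B)) (inj₂ D) k) (level (inj₂ B) (inj₂ D) k)))
        combine B Sign.- B- =
          (λ D k k<2 → trans (cong (ℤ._- level (inj₂ (ι B)) (inj₁ D) k) (outer-ι sh occ≡2 B D k k<2))
            (ℤ.+-inverseʳ (level (inj₂ (ι B)) (inj₁ D) k))) ,
          (λ D k k<2 → one-reflected sh occ≡2 B D k k<2 B-)

        memberᴮ : ∀ B d → Balanced (extend (vec _≟_ (inj₁ (inj₂ B)) (partnerᴮ B d)))
        memberᴮ B (yes ιB≡B) = record
          { profile   = F.resp (λ { nothing → refl ; (just u) → sym (δ-in₁ (inj₂ B) u) }) (F.basis (just (inj₂ B)))
          ; profile′  = F′.null-profile (λ { nothing → refl ; (just u) → sym (δ-off₂ (inj₂ B) u) })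
          ; outside   = λ D k k<2 → outer-even sh occ≡2 B D k k<2 B+
          ; reflected = λ D k k<2 →
              subst (λ C → level (inj₂ C) (inj₂ (ι D)) (ρ′ D k) ≡ level (inj₂ B) (inj₂ D) k) ιB≡B
                (both-reflected sh occ≡2 B D k k<2 B+)
          }
          where B+ = fixed-sign B ιB≡B
        memberᴮ B (no _) = record
          { profile   = F.resp
              (λ { nothing  → trans (ℤ.+-identityˡ _) (scale-0 (sgn B))
                 ; (just u) → sym (cong₂ (λ k l → k ℤ.+ scale (sgn B) l) (δ-in₁ (inj₂ B) u) (δ-in₁ (inj₂ (ι B)) u)) })
              (F.add (F.basis (just (inj₂ B))) (F.scale-profile (sgn B) (F.basis (just (inj₂ (ι B))))))
          ; profile′  = F′.null-profile (λ { nothing → refl ; (just u) → sym (trans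
              (cong₂ (λ k l → k ℤ.+ scale (sgn B) l) (δ-off₂ (inj₂ B) u) (δ-off₂ (inj₂ (ι B)) u))
              (trans (ℤ.+-identityˡ _) (scale-0 (sgn B)))) })
          ; outside   = proj₁ (combine B (sgn B) refl)
          ; reflected = proj₂ (combine B (sgn B) refl)
          }

        member : ∀ z → Balanced (extend (vec _≟_ z (partner z)))
        member (inj₁ (inj₁ A)) = memberᴬ A
          (λ { nothing → refl ; (just u) → trans (cong₂ ℤ._+_ (δ-in₁ (inj₁ A) u) (δ-off₁ A u)) (ℤ.+-identityʳ _) })
          (λ { nothing → refl ; (just u) → trans (cong₂ ℤ._+_ (δ-off₂ (inj₁ A) u) (δ-in₂ A u)) (ℤ.+-identityˡ _) })
        member (inj₁ (inj₂ B)) = memberᴮ B (ι B ℬ.≟ B)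
        member (inj₂ A) = memberᴬ A
          (λ { nothing → refl ; (just u) → trans (cong₂ ℤ._+_ (δ-off₁ A u) (δ-in₁ (inj₁ A) u)) (ℤ.+-identityˡ _) })
          (λ { nothing → refl ; (just u) → trans (cong₂ ℤ._+_ (δ-in₂ A u) (δ-off₂ (inj₁ A) u)) (ℤ.+-identityʳ _) })

      surgery-bordism : Bordism 𝓅 𝓆
      surgery-bordism = record
        { L        = Balanced
        ; subgroup = subgroup
        ; base     = record
          { profile   = F.resp (λ { nothing → refl ; (just _) → refl }) (F.basis nothing)
          ; profile′  = F′.resp (λ { nothing → refl ; (just _) → refl }) (F′.basis nothing)
          ; outside   = λ _ _ _ → refl
          ; reflected = λ _ _ _ → refl }
        ; agree    = agree
        ; matching = record
          { partner    = partner
          ; symmetric  = λ { {inj₁ (inj₁ A)} refl → refl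
                           ; {inj₁ (inj₂ B)} → symmetricᴮ B (ι B ℬ.≟ B)
                           ; {inj₂ A} refl → refl }
          ; distinct   = λ { {inj₁ (inj₁ A)} refl ()
                           ; {inj₁ (inj₂ B)} → distinctᴮ B (ι B ℬ.≟ B)
                           ; {inj₂ A} refl () }
          ; compatible = λ { {inj₁ (inj₁ A)} refl → refl
                           ; {inj₁ (inj₂ B)} → compatibleᴮ B (ι B ℬ.≟ B)
                           ; {inj₂ A} refl → refl }
          ; member     = member
          }
        }

-- From symmetric factors of nanowords to shuffles

map-interleave : ∀ {X Y V Z : Set} {k} (h : Y → Z) (i : X → Y) (j : V → Y)
  (xs : Vec (List X) (suc k)) (vs : Vec (List V) k) →
  map h (interleave (Vec.map (map i) xs) (Vec.map (map j) vs)) ≡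
  interleave (Vec.map (map (h ∘ i)) xs) (Vec.map (map (h ∘ j)) vs)
map-interleave h i j (x ∷ [])         []       = sym (map-∘ x)
map-interleave h i j (x ∷ xs@(_ ∷ _)) (v ∷ vs) = trans (map-++ h (map i x) _)
  (cong₂ _++_ (sym (map-∘ x)) (trans (map-++ h (map j v) _)
    (cong₂ _++_ (sym (map-∘ v)) (map-interleave h i j xs vs))))

concat : ∀ {X : Set} {k} → Vec (List X) k → List X
concat = Vec.foldr′ _++_ []

module _ {X : Set} where

  any-≡ : ∀ {k} {f g : X → ℕ} {vs : Vec X k} {n} →
          All (λ v → f v ≡ g v) vs → Any (λ v → f v ≡ n) vs → Any (λ v → g v ≡ n) vs
  any-≡ (f≡g ∷ _) (here fv≡n) = here (trans (sym f≡g) fv≡n)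
  any-≡ (_ ∷ f≡g) (there any) = there (any-≡ f≡g any)

module _ {X : Set} (_≟_ : DecidableEquality X) where
  open Words _≟_

  private
    occ-concat : ∀ {k} B v (vs : Vec (List X) k) → occ B (concat (v ∷ vs)) ≡ occ B v + occ B (concat vs)
    occ-concat B v vs = occ-++ B v (concat vs)

  occ-concat-0 : ∀ {k} B s (vs : Vec (List X) k) → occ B (concat vs) ≡ 0 → All (λ v → Parity s (occ B v)) vs
  occ-concat-0 B s []       ≡0 = []
  occ-concat-0 B s (v ∷ vs) ≡0 =
    subst (Parity s) (sym (ℕ.m+n≡0⇒m≡0 _ sum≡0)) none ∷ occ-concat-0 B s vs (ℕ.m+n≡0⇒n≡0 (occ B v) sum≡0)
    where sum≡0 = trans (sym (occ-concat B v vs)) ≡0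

  any-≤ : ∀ {k} B {vs : Vec (List X) k} → Any (λ v → occ B v ≡ 2) vs → 2 ≤ occ B (concat vs)
  any-≤ B {v ∷ vs} (here ≡2)   = subst (2 ≤_) (sym (occ-concat B v vs))
    (subst (λ k → 2 ≤ k + occ B (concat vs)) (sym ≡2) (ℕ.m≤m+n 2 _))
  any-≤ B {v ∷ vs} (there any) = subst (2 ≤_) (sym (occ-concat B v vs))
    (ℕ.≤-trans (any-≤ B any) (ℕ.m≤n+m _ (occ B v)))

  parity-any : ∀ {k} B (vs : Vec (List X) k) → occ B (concat vs) ≤ 2 →
               Any (λ v → occ B v ≡ 2) vs → All (λ v → Parity Sign.+ (occ B v)) vs
  parity-any B (v ∷ vs) ≤2 (here ≡2) = subst (Parity Sign.+) (sym ≡2) both ∷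
    occ-concat-0 B Sign.+ vs (ℕ.n≤0⇒n≡0 (ℕ.+-cancelˡ-≤ 2 _ 0
      (subst (λ k → k + occ B (concat vs) ≤ 2) ≡2 (subst (_≤ 2) (occ-concat B v vs) ≤2))))
  parity-any B (v ∷ vs) ≤2 (there any) =
    subst (Parity Sign.+) (sym v≡0) none ∷ parity-any B vs (ℕ.≤-trans (ℕ.m≤n+m _ (occ B v)) sum≤2) any
    where
    sum≤2 : occ B v + occ B (concat vs) ≤ 2
    sum≤2 = subst (_≤ 2) (occ-concat B v vs) ≤2
    v≡0 : occ B v ≡ 0
    v≡0 = ℕ.n≤0⇒n≡0 (ℕ.+-cancelʳ-≤ 2 _ 0 (ℕ.≤-trans (ℕ.+-monoʳ-≤ (occ B v) (any-≤ B any)) sum≤2))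

  parity-none : ∀ {k} B (vs : Vec (List X) k) → occ B (concat vs) ≤ 2 →
                ¬ Any (λ v → occ B v ≡ 2) vs → All (λ v → Parity Sign.- (occ B v)) vs
  parity-none B []       ≤2 ¬any = []
  parity-none B (v ∷ vs) ≤2 ¬any =
    small (occ B v) (ℕ.m+n≤o⇒m≤o (occ B v) sum≤2) (¬any ∘ here) ∷
    parity-none B vs (ℕ.m+n≤o⇒n≤o (occ B v) sum≤2) (¬any ∘ there)
    where
    sum≤2 : occ B v + occ B (concat vs) ≤ 2
    sum≤2 = subst (_≤ 2) (occ-concat B v vs) ≤2
    small : ∀ n → n ≤ 2 → n ≢ 2 → Parity Sign.- n
    small 0 _ _ = none
    small 1 _ _ = one
    small 2 _ ≢2 = contradiction refl ≢2
    small (suc (suc (suc _))) (s≤s (s≤s ())) _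

  occurs-in : ∀ {k} {P : List X → Set} B (vs : Vec (List X) k) → All P vs → occ B (concat vs) ≢ 0 →
              ∃[ v ] P v × occ B v ≢ 0
  occurs-in B []       []         ≢0 = contradiction refl ≢0
  occurs-in B (v ∷ vs) (Pv ∷ Pvs) ≢0 with occ B v ℕ.≟ 0
  ... | no v≢0  = v , Pv , v≢0
  ... | yes v≡0 = occurs-in B vs Pvs λ vs≡0 → ≢0 (trans (occ-concat B v vs) (cong₂ _+_ v≡0 vs≡0))

  fixed-letter : ∀ (f : X → X) {B} v → map f v ≡ v → occ B v ≢ 0 → f B ≡ B
  fixed-letter f     []      eq ≢0 = contradiction refl ≢0
  fixed-letter f {B} (C ∷ v) eq ≢0 with B ≟ C
  ... | yes refl = ∷-injectiveˡ eq
  ... | no  _    = fixed-letter f v (∷-injectiveʳ eq) ≢0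

module _ {a} {α : Set a} (τ : α → α) (τ-involutive : Involutive _≡_ τ) where
  open Coefficients τ
  open Matchings τ τ-involutive
  open Bordisms τ τ-involutive

  module SymmetricPhrase (∇ : Nanophrase α) (even : Nanophrase.Even ∇) (symmetric : Nanophrase.Symmetric ∇ τ) where
    open Nanophrase ∇
    open Endo α using (_^_)
    module W = Words _≟_

    ι : Letter → Letter
    ι = Inverse.to (proj₁ symmetric)

    reflected : All (λ v → map ι v ≡ reverse v) phrase
    reflected = proj₁ (proj₂ symmetric)

    spread? : ∀ B → Dec (Any (λ v → occurrences B v ≡ 2) phrase)
    spread? B = any? (λ v → occurrences B v ℕ.≟ 2) phrase

    sgn : Letter → Sign
    sgn B = if does (spread? B) then Sign.+ else Sign.-

    occ≡2 : ∀ B → W.occ B (concat phrase) ≡ 2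
    occ≡2 B = trans (W.occ≡occurrences B (concat phrase)) (twice B)

    -- Applying ι twice reverses every word of the phrase twice and so fixes it letter by letter;
    -- each letter occurs in some word.
    ιι : ∀ B → ι (ι B) ≡ B
    ιι B with occurs-in _≟_ B phrase reflected (λ ≡0 → contradiction (trans (sym (occ≡2 B)) ≡0) λ ())
    ... | v , ιv , B∈v = fixed-letter _≟_ (ι ∘ ι) v (begin
      map (ι ∘ ι) v      ≡⟨ map-∘ v ⟩
      map ι (map ι v)    ≡⟨ cong (map ι) ιv ⟩
      map ι (reverse v)  ≡⟨ reverse-map ι v ⟩
      reverse (map ι v)  ≡⟨ cong reverse ιv ⟩
      reverse (reverse v) ≡⟨ reverse-involutive v ⟩
      v                  ∎) B∈v
      where open ≡-Reasoning

    open Reflection _≟_ ι ιι sgn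

    occurrences-ι : ∀ B {k} {vs : Vec (List Letter) k} → All (λ v → map ι v ≡ reverse v) vs →
                    All (λ v → occurrences (ι B) v ≡ occurrences B v) vs
    occurrences-ι B []         = []
    occurrences-ι B {vs = v ∷ _} (ιv ∷ ιvs) = (begin
      occurrences (ι B) v            ≡⟨ occurrences-reverse letters (ι B) v ⟨
      occurrences (ι B) (reverse v)  ≡⟨ cong (occurrences (ι B)) ιv ⟨
      occurrences (ι B) (map ι v)    ≡⟨ occurrences-map letters letters ι ι-injective B v ⟩
      occurrences B v                ∎) ∷ occurrences-ι B ιvs
      where open ≡-Reasoning

    sgn-ι : ∀ B → sgn (ι B) ≡ sgn B
    sgn-ι B = cong (λ b → if b then Sign.+ else Sign.-) (does-⇔ (mk⇔
      (any-≡ (occurrences-ι B reflected))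
      (any-≡ (subst (λ C → All (λ v → occurrences C v ≡ occurrences (ι B) v) phrase) (ιι B)
        (occurrences-ι (ι B) reflected))))
      (spread? (ι B)) (spread? B))

    label-ι : ∀ B → ∣ ι B ∣ ≡ act (sgn B) ∣ B ∣
    label-ι B = trans (proj₂ (proj₂ symmetric) B) (power (does (spread? B)) ∣ B ∣)
      where
      power : ∀ b c → (τ ^ (if b then 0 else 1)) c ≡ act (if b then Sign.+ else Sign.-) c
      power true  c = refl
      power false c = refl

    parity : ∀ B → All (λ v → Parity (sgn B) (W.occ B v)) phrase
    parity B with spread? B
    ... | yes any = parity-any _≟_ B phrase (ℕ.≤-reflexive (occ≡2 B))
      (Any.map (λ {v} eq → trans (W.occ≡occurrences B v) eq) any)
    ... | no ¬any = parity-none _≟_ B phrase (ℕ.≤-reflexive (occ≡2 B))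
      (¬any ∘ Any.map λ {v} eq → trans (sym (W.occ≡occurrences B v)) eq)

    good : All Good phrase
    good = combine reflected even parity
      where
      combine : ∀ {k} {vs : Vec (List Letter) k} → All (λ v → map ι v ≡ reverse v) vs →
                All (λ v → 2 ∣ length v) vs → (∀ B → All (λ v → Parity (sgn B) (W.occ B v)) vs) → All Good vs
      combine []         []         par = []
      combine (ιv ∷ ιvs) (2∣ ∷ 2∣s) par =
        record { reflected = ιv ; even = 2∣ ; parity = λ B → All.head (par B) } ∷
        combine ιvs 2∣s (λ B → All.tail (par B))

  module _ {w w′ : Nanoword α} (surg : Surgery τ w w′) where
    open Surgery surg hiding (even; symmetric)
    private
      module w = Nanoword w
      module w′ = Nanoword w′
      module S = SymmetricPhrase ∇ (Surgery.even surg) (Surgery.symmetric surg)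
      𝒞 = w′.alphabet ⊎ᵃ ∇.alphabet
      module 𝒞 = Alphabet 𝒞
      open Shuffles w′._≟_ ∇._≟_ 𝒞._≟_ S.ι S.ιι S.sgn
      open Reflection ∇._≟_ S.ι S.ιι S.sgn using (Good)

      to : 𝒞.Letter → w.Letter
      to = [ f.⟦_⟧ , g.⟦_⟧ ]′

      disjoint : ∀ A B → f.⟦ A ⟧ ≢ g.⟦ B ⟧
      disjoint A B eq = Equivalence.to (complement (f.⟦ A ⟧)) (A , refl) (B , sym eq)

      to-injective : Injective _≡_ _≡_ to
      to-injective {inj₁ A} {inj₁ B} eq = cong inj₁ (f.injective eq)
      to-injective {inj₁ A} {inj₂ B} eq = contradiction eq (disjoint A B)
      to-injective {inj₂ A} {inj₁ B} eq = contradiction (sym eq) (disjoint B A)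
      to-injective {inj₂ A} {inj₂ B} eq = cong inj₂ (g.injective eq)

      -- The remaining letters are described by a negation, so a case distinction is required to
      -- invert `to`; it is decided by a search through the finite alphabet of ∇.
      preimage : ∀ A → ∃[ C ] to C ≡ A
      preimage A with Fin.any? (λ i → g.⟦ Inverse.from ∇.enumeration i ⟧ w.≟ A)
      ... | yes (i , eq) = inj₂ (Inverse.from ∇.enumeration i) , eq
      ... | no ¬∃ = let B , eq = Equivalence.from (complement A) ¬image in inj₁ B , eq
        where
        ¬image : ¬ (A g.∈image)
        ¬image (B , eq) = ¬∃ (Inverse.to ∇.enumeration B ,
          trans (cong g.⟦_⟧ (Inverse.inverseʳ ∇.enumeration refl)) eq)

      σ : 𝒞.Letter ↔ w.Letter
      σ = mk↔ₛ′ to (proj₁ ∘ preimage) (proj₂ ∘ preimage) (λ C → to-injective (proj₂ (preimage (to C))))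

      ŵ : List 𝒞.Letter
      ŵ = interleave (Vec.map (map inj₁) xs) (Vec.map (map inj₂) ∇.phrase)

      word≡ŵ : w.word ≡ map to ŵ
      word≡ŵ = trans word≡ (sym (map-interleave to inj₁ inj₂ xs ∇.phrase))

      Ŵ : Nanoword α
      Ŵ = record
        { alphabet = 𝒞
        ; word     = ŵ
        ; twice    = λ A → trans (sym (occurrences-map 𝒞.letters w.letters to to-injective A ŵ))
                             (trans (cong (w.occurrences (to A)) (sym word≡ŵ)) (w.twice (to A)))
        }

      shuffle : ∀ {k} (xs : Vec (List w′.Letter) (suc k)) {vs : Vec (List ∇.Letter) k} → All Good vs →
                Shuffle (interleave (Vec.map (map inj₁) xs) (Vec.map (map inj₂) vs)) (concat xs)
      shuffle (x ∷ [])         []             =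
        subst (λ w → Shuffle w (x ++ [])) (++-identityʳ (map inj₁ x)) (outer x [])
      shuffle (x ∷ xs@(_ ∷ _)) {v ∷ _} (good ∷ goods) = outer x (inner v good (shuffle xs goods))

      isomorphism′ : Isomorphism τ Ŵ w
      isomorphism′ = record
        { f = σ ; preserves = λ { (inj₁ A) → f.preserves A ; (inj₂ B) → g.preserves B } ; word≡ = word≡ŵ }

    -- The alphabet of w is only in bijection with the disjoint union of the remaining letters and
    -- the letters of ∇. The word is first rewritten over that union, where an isomorphism gives the
    -- bordism.
    general-surgery-bordism : Bordism (pairing τ w) (pairing τ w′)
    general-surgery-bordism = bordism-trans
      (bordism-sym (isomorphism-bordism τ τ-involutive isomorphism′))
      (Surgeries.surgery-bordism τ τ-involutive w′.alphabet ∇.alphabet S.ι S.ιι S.sgn S.sgn-ι S.label-ι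
        (Nanoword.twice Ŵ) w′.twice (subst (Shuffle ŵ) (sym word′≡) (shuffle xs S.good)))

  -- The first two homotopy moves as surgeries

  private
    finite : ℕ → FiniteSet
    finite n = record { Elem = Fin n ; size = n ; enumeration = ↔-id _ }

  -- The factor is the phrase (AA) of one word, symmetric under the identity with ε = 0.
  move₁-surgery : ∀ {w w′} → Move₁ τ w w′ → Surgery τ w w′
  move₁-surgery {w} {w′} move = record
    { ∇ = record
      { alphabet = record { letters = finite 1 ; ∣_∣ = λ _ → w.∣ A ∣ }
      ; k = 1
      ; phrase = (0F ∷ 0F ∷ []) ∷ []
      ; twice = λ { 0F → refl }
      }
    ; even = divides 1 refl ∷ []
    ; symmetric = ↔-id _ , refl ∷ [] , λ { 0F → refl }
    ; g = record { ⟦_⟧ = λ _ → A ; injective = λ { {0F} {0F} _ → refl } ; preserves = λ _ → refl }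
    ; f = f
    ; complement = λ D → mk⇔
        (λ D∈ (_ , A≡D) → Equivalence.to (complement D) D∈ (sym A≡D))
        (λ D∉ → Equivalence.from (complement D) (λ D≡A → D∉ (0F , sym D≡A)))
    ; xs = x ∷ y ∷ []
    ; word≡ = word≡
    ; word′≡ = trans word′≡ (cong (x ++_) (sym (++-identityʳ y)))
    }
    where
    open Move₁ move
    module w = Nanoword w

  -- The factor is the phrase (AB|BA), with ι exchanging A and B. Each letter lies in both words, so
  -- ε = 1 and the symmetry asks for |B| = τ(|A|), which is the condition of the move, and for its
  -- converse, which follows as `τ` is an involution.
  move₂-surgery : ∀ {w w′} → Move₂ τ w w′ → Surgery τ w w′
  move₂-surgery {w} {w′} move = record
    { ∇ = record
      { alphabet = record { letters = finite 2 ; ∣_∣ = λ i → w.∣ letter i ∣ }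
      ; k = 2
      ; phrase = (0F ∷ 1F ∷ []) ∷ (1F ∷ 0F ∷ []) ∷ []
      ; twice = λ { 0F → refl ; 1F → refl }
      }
    ; even = divides 1 refl ∷ divides 1 refl ∷ []
    ; symmetric = mk↔ₛ′ exchange exchange exchange² exchange² , refl ∷ refl ∷ [] ,
        λ { 0F → ∣B∣≡τ∣A∣ ; 1F → sym (trans (cong τ ∣B∣≡τ∣A∣) (τ-involutive w.∣ A ∣)) }
    ; g = record { ⟦_⟧ = letter ; injective = letter-injective ; preserves = λ _ → refl }
    ; f = f
    ; complement = λ D → mk⇔
        (λ { D∈ (0F , A≡D) → Equivalence.to (complement D) D∈ (inj₁ (sym A≡D))
           ; D∈ (1F , B≡D) → Equivalence.to (complement D) D∈ (inj₂ (sym B≡D)) })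
        (λ D∉ → Equivalence.from (complement D)
          λ { (inj₁ D≡A) → D∉ (0F , sym D≡A) ; (inj₂ D≡B) → D∉ (1F , sym D≡B) })
    ; xs = x ∷ y ∷ z ∷ []
    ; word≡ = word≡
    ; word′≡ = trans word′≡ (cong (λ z → x ++ y ++ z) (sym (++-identityʳ z)))
    }
    where
    open Move₂ move
    open _↪_ f using (⟦_⟧*)
    module w = Nanoword w
    open Words w._≟_
    letter : Fin 2 → w.Letter
    letter 0F = A
    letter 1F = B
    exchange : Fin 2 → Fin 2
    exchange 0F = 1F
    exchange 1F = 0F
    exchange² : ∀ i → exchange (exchange i) ≡ i
    exchange² 0F = refl
    exchange² 1F = refl
    -- Otherwise A would occur four times.
    A≢B : A ≢ B
    A≢B refl = contradiction (trans (sym count) (trans (sym (cong (occ A) word≡))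
      (NanowordForm.occ≡2 τ w A))) (four (occ A ⟦ x ⟧*) (occ A ⟦ y ⟧*) (occ A ⟦ z ⟧*))
      where
      count : occ A (⟦ x ⟧* ++ A ∷ A ∷ ⟦ y ⟧* ++ A ∷ A ∷ ⟦ z ⟧*) ≡
              occ A ⟦ x ⟧* + (1 + (1 + (occ A ⟦ y ⟧* + (1 + (1 + occ A ⟦ z ⟧*)))))
      count = trans (occ-++ A ⟦ x ⟧* _) (trans
        (cong (λ k → occ A ⟦ x ⟧* + (ind A A + (ind A A + k))) (occ-++ A ⟦ y ⟧* _))
        (cong (λ i → occ A ⟦ x ⟧* + (i + (i + (occ A ⟦ y ⟧* + (i + (i + occ A ⟦ z ⟧*)))))) (ind-refl A)))
      four : ∀ m n o → m + (1 + (1 + (n + (1 + (1 + o))))) ≢ 2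
      four m n o eq = ℕ.1+n≰n (ℕ.≤-trans (ℕ.m≤n+m 3 (m + n + o + 1))
        (ℕ.≤-reflexive (trans (lemma m n o) eq)))
        where
        lemma : ∀ m n o → m + n + o + 1 + 3 ≡ m + (1 + (1 + (n + (1 + (1 + o)))))
        lemma = ℕ-Solver.solve-∀
    letter-injective : Injective _≡_ _≡_ letter
    letter-injective {0F} {0F} _  = refl
    letter-injective {0F} {1F} eq = contradiction eq A≢B
    letter-injective {1F} {0F} eq = contradiction (sym eq) A≢B
    letter-injective {1F} {1F} _  = refl

  step-bordism : ∀ {w w′} → Step τ w w′ → Bordism (pairing τ w) (pairing τ w′)
  step-bordism (isomorphism iso) = isomorphism-bordism τ τ-involutive iso
  step-bordism (move₁ m)         = general-surgery-bordism (move₁-surgery m)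
  step-bordism (move₂ m)         = general-surgery-bordism (move₂-surgery m)
  step-bordism (move₃ {twice = t} {t′} m) = third-move-bordism τ τ-involutive {twice = t} {t′} m
  step-bordism (surgery s)       = general-surgery-bordism s

  bordism-refl : ∀ {p} → Bordism p p
  bordism-refl {p} = isometry (↔-id _) (λ _ → refl) λ
    { nothing nothing → ∼-refl ; nothing (just _) → ∼-refl ; (just _) nothing → ∼-refl ; (just _) (just _) → ∼-refl }

  bordism-isEquivalence : IsEquivalence Bordism
  bordism-isEquivalence = record { refl = bordism-refl ; sym = bordism-sym ; trans = bordism-trans }

theorem7p3p1 : ∀ {a} {α : Set a} (τ : α → α) → Involutive _≡_ τ →
    IsGroupHomomorphism (𝒩c τ) (𝒫sk τ) (p τ)
theorem7p3p1 τ τ-involutive = record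
  { isMonoidHomomorphism = record
    { isMagmaHomomorphism = record
      { isRelHomomorphism = record
        -- Cobordism of nanowords is an equivalence closure and `Bordism` an equivalence relation,
        -- so a bordism for each single step suffices. Only the composite is turned into a filling.
        { cong = hyperbolic ∘ gfold (bordism-isEquivalence τ τ-involutive) (pairing τ) (step-bordism τ τ-involutive) }
      ; homo = λ v w → hyperbolic (product-bordism τ τ-involutive v w)
      }
    ; ε-homo = hyperbolic (isometry (↔-id _) (λ ()) λ
        { nothing nothing → ∼-refl ; nothing (just ()) ; (just ()) _ })
    }
  ; ⁻¹-homo = λ w → hyperbolic (reverse-bordism τ τ-involutive w)
  }
  where open Bordisms τ τ-involutive
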